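{- Let $h\ge 1$ and let $p_h^E(W)$ be the probability that a growing self-avoiding walk $W$ on $\mathcal G_h$ occurs under the energetic model with parameter $C$. Then the generating function $$f_h^E(x,y,C)=\sum_{W\in W_{(0,h-1)}(\mathcal G_h)}p_h^E(W)\,x^{|W|}y^{\|W\|}$$ that counts GSAWs on $\mathcal G_h$ that start in the top-left corner $(0,h-1)$ by length and displacement is rational (as a function of $x$, $y$ and $C$).
   Context: $\mathcal G_h$ is the half-infinite grid graph with vertex set $\mathbb N\times\{0,\dots,h-1\}$ ($0\in\mathbb N$), with an edge between two points exactly when they are at Euclidean distance $1$. A growing self-avoiding walk (GSAW) on a graph is a finite directed walk that visits no vertex twice and whose final vertex is trapped, i.e. all of its neighbors are visited by the walk. $W_v(G)$ denotes the set of GSAWs on $G$ starting at the vertex $v$. $|W|$ is the length of $W$ (number of edges) and $\|W\|$ is its displacement (difference between the largest and smallest $x$-coordinates of its vertices). Energetic model: let $C$ be a positive constant. Suppose $v$ is the endpoint of a partially built walk and $N(v)$ is the set of unvisited neighbors of $v$. The energy of $w\in N(v)$ is $E(w)=C^\ell$, where $\ell$ is the number of neighbors of $w$ that are already part of the walk, not counting $v$. The next vertex is $w\in N(v)$ with probability $E(w)/\sum_{w'\in N(v)}E(w')$. The probability $p_h^E(W)$ is the product of the probabilities of the steps of $W$; it is a rational function of $C$. "Rational" means that $f^E_h$, viewed as a formal power series in $x,y$ whose coefficients are rational functions of $C$, equals a quotient of two polynomials in $x,y,C$. -}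

module Defs where

open import Data.Nat as ℕ using (ℕ; zero; suc; NonZero; _⊔_; _⊓_; _∸_; ∣_-_∣)
import Data.Nat.Properties as ℕ
open import Data.Integer as ℤ using (ℤ; 0ℤ; 1ℤ)
import Data.Integer.Properties as ℤ
open import Data.Fin as Fin using (Fin; toℕ; fromℕ)
import Data.Fin.Properties as Fin
open import Data.Product using (_×_; _,_; proj₁; proj₂; Σ-syntax)
open import Data.Product.Properties using (≡-dec)
open import Data.Sum using (_⊎_; inj₁; inj₂; [_,_]′)
open import Data.List as List using (List; []; _∷_; length; filter; upTo; allFin; cartesianProduct; concatMap; foldr)
open import Data.List.Membership.Propositional using (_∈_; lose)
open import Data.List.Membership.Propositional.Properties
import Data.List.Membership.DecPropositional as DecMember
import Data.List.Relation.Unary.All as All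
import Data.List.Relation.Unary.All.Properties as All
open import Data.List.Relation.Unary.AllPairs as AllPairs using (AllPairs; []; _∷_)
import Data.List.Relation.Unary.AllPairs.Properties as AllPairs
open import Data.List.Relation.Unary.Any using (here)
open import Data.List.Relation.Unary.Unique.Propositional using (Unique)
import Data.List.Relation.Unary.Unique.Propositional.Properties as Unique
open import Data.List.Relation.Binary.Disjoint.Propositional using (Disjoint)
open import Data.Vec as Vec using (Vec; []; _∷_; head; last; foldr₁)
import Data.Vec.Properties as Vec
import Data.Vec.Membership.Propositional as Vec
import Data.Vec.Membership.DecPropositional as DecVecMember
import Data.Vec.Relation.Unary.AllPairs as VecAllPairs
import Data.Vec.Relation.Unary.Unique.Propositional as Vec
open import Data.Vec.Relation.Unary.Linked as Linked using (Linked; [-]; _∷_)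
open import Function using (_⇔_; mk⇔; Equivalence; _∘_)
open import Relation.Binary.PropositionalEquality
open import Relation.Nullary using (¬_; Dec; yes; no; ¬?; _×-dec_; contradiction)
open import Relation.Nullary.Decidable using (map′)

------------------------------------------------------------------------
-- ℤ[C]: coefficient lists, constant term first, compared coefficientwise
-- (so trailing zeros are harmless)

coeff : {A : Set} → A → List A → ℕ → A
coeff d []       _       = d
coeff d (a ∷ _)  zero    = a
coeff d (_ ∷ as) (suc k) = coeff d as k

ℤ[C] : Set
ℤ[C] = List ℤ

infix  4 _≈_ _≃_
infixl 6 _+ₚ_ _+_
infixl 7 _*ₚ_ _*_ _⊛_

_≈_ : ℤ[C] → ℤ[C] → Set
p ≈ q = ∀ k → coeff 0ℤ p k ≡ coeff 0ℤ q k

0ₚ 1ₚ : ℤ[C]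
0ₚ = []
1ₚ = 1ℤ ∷ []

_+ₚ_ : ℤ[C] → ℤ[C] → ℤ[C]
[]      +ₚ q       = q
(a ∷ p) +ₚ []      = a ∷ p
(a ∷ p) +ₚ (b ∷ q) = (a ℤ.+ b) ∷ (p +ₚ q)

_*ₚ_ : ℤ[C] → ℤ[C] → ℤ[C]
[]      *ₚ q = []
(a ∷ p) *ₚ q = List.map (a ℤ.*_) q +ₚ (0ℤ ∷ (p *ₚ q))

C^_ : ℕ → ℤ[C]
C^ zero  = 1ₚ
C^ suc k = 0ℤ ∷ C^ k

sumₚ : List ℤ[C] → ℤ[C]
sumₚ = foldr _+ₚ_ 0ₚ

coeff-+ₚ : ∀ p q k → coeff 0ℤ (p +ₚ q) k ≡ coeff 0ℤ p k ℤ.+ coeff 0ℤ q k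
coeff-+ₚ []      q       k       = sym (ℤ.+-identityˡ _)
coeff-+ₚ (a ∷ p) []      k       = sym (ℤ.+-identityʳ _)
coeff-+ₚ (a ∷ p) (b ∷ q) zero    = refl
coeff-+ₚ (a ∷ p) (b ∷ q) (suc k) = coeff-+ₚ p q k

coeff-map0 : ∀ q k → coeff 0ℤ (List.map (0ℤ ℤ.*_) q) k ≡ 0ℤ
coeff-map0 []      k       = refl
coeff-map0 (b ∷ q) zero    = refl
coeff-map0 (b ∷ q) (suc k) = coeff-map0 q k

*ₚ-shiftʳ : ∀ p q → p *ₚ (0ℤ ∷ q) ≈ 0ℤ ∷ (p *ₚ q)
*ₚ-shiftʳ []      q zero    = refl
*ₚ-shiftʳ []      q (suc k) = refl
*ₚ-shiftʳ (a ∷ p) q zero    = trans (ℤ.+-identityʳ _) (ℤ.*-zeroʳ a)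
*ₚ-shiftʳ (a ∷ p) q (suc k) = begin
  coeff 0ℤ (aq +ₚ p *ₚ (0ℤ ∷ q)) k                ≡⟨ coeff-+ₚ aq _ k ⟩
  coeff 0ℤ aq k ℤ.+ coeff 0ℤ (p *ₚ (0ℤ ∷ q)) k    ≡⟨ cong (ℤ._+_ (coeff 0ℤ aq k)) (*ₚ-shiftʳ p q k) ⟩
  coeff 0ℤ aq k ℤ.+ coeff 0ℤ (0ℤ ∷ (p *ₚ q)) k    ≡⟨ coeff-+ₚ aq _ k ⟨
  coeff 0ℤ (aq +ₚ (0ℤ ∷ (p *ₚ q))) k              ∎
  where
  open ≡-Reasoning
  aq = List.map (a ℤ.*_) q

0∷≈0 : ∀ {p} → p ≈ 0ₚ → 0ℤ ∷ p ≈ 0ₚ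
0∷≈0 p≈0 zero    = refl
0∷≈0 p≈0 (suc k) = p≈0 k

*ₚ-zero-product : ∀ p q → p *ₚ q ≈ 0ₚ → p ≈ 0ₚ ⊎ q ≈ 0ₚ
*ₚ-zero-product []      q       _    = inj₁ λ _ → refl
*ₚ-zero-product (a ∷ p) q       pq≈0 with a ℤ.≟ 0ℤ
... | yes refl = [ inj₁ ∘ 0∷≈0 , inj₂ ]′ (*ₚ-zero-product p q (pq≈0′ ∘ suc))
  where
  pq≈0′ : 0ℤ ∷ (p *ₚ q) ≈ 0ₚ
  pq≈0′ k = begin
    coeff 0ℤ (0ℤ ∷ (p *ₚ q)) k              ≡⟨ ℤ.+-identityˡ _ ⟨
    0ℤ ℤ.+ coeff 0ℤ (0ℤ ∷ (p *ₚ q)) k       ≡⟨ cong (ℤ._+ coeff 0ℤ (0ℤ ∷ (p *ₚ q)) k) (coeff-map0 q k) ⟨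
    _                                       ≡⟨ coeff-+ₚ (List.map (0ℤ ℤ.*_) q) _ k ⟨
    coeff 0ℤ ((0ℤ ∷ p) *ₚ q) k              ≡⟨ pq≈0 k ⟩
    0ℤ                                      ∎
    where open ≡-Reasoning
... | no  a≢0  = inj₂ (q≈0 q pq≈0)
  where
  q≈0 : ∀ q → (a ∷ p) *ₚ q ≈ 0ₚ → q ≈ 0ₚ
  q≈0 []      _  = λ _ → refl
  q≈0 (b ∷ q) eq with ℤ.i*j≡0⇒i≡0∨j≡0 a (trans (sym (ℤ.+-identityʳ _)) (eq zero))
  ... | inj₁ a≡0  = contradiction a≡0 a≢0
  ... | inj₂ refl = 0∷≈0 (q≈0 q λ k → trans (sym (*ₚ-shiftʳ (a ∷ p) q (suc k))) (eq (suc k)))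

*ₚ-≉0 : ∀ p q → ¬ p ≈ 0ₚ → ¬ q ≈ 0ₚ → ¬ p *ₚ q ≈ 0ₚ
*ₚ-≉0 p q p≉0 q≉0 = [ p≉0 , q≉0 ]′ ∘ *ₚ-zero-product p q

1ₚ≉0 : ¬ 1ₚ ≈ 0ₚ
1ₚ≉0 eq with () ← eq 0

------------------------------------------------------------------------
-- Fractions of ℤ[C] modulo _≃_: the same field as the fractions of ℚ[C]

record ℚ⟨C⟩ : Set where
  constructor frac
  field
    num   : ℤ[C]
    den   : ℤ[C]
    den≉0 : ¬ den ≈ 0ₚ

open ℚ⟨C⟩ public

_≃_ : ℚ⟨C⟩ → ℚ⟨C⟩ → Set
r ≃ s = num r *ₚ den s ≈ num s *ₚ den r

fromPoly : ℤ[C] → ℚ⟨C⟩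
fromPoly p = frac p 1ₚ 1ₚ≉0

_+_ _*_ : ℚ⟨C⟩ → ℚ⟨C⟩ → ℚ⟨C⟩
r + s = frac (num r *ₚ den s +ₚ num s *ₚ den r) (den r *ₚ den s)
             (*ₚ-≉0 (den r) (den s) (den≉0 r) (den≉0 s))
r * s = frac (num r *ₚ num s) (den r *ₚ den s)
             (*ₚ-≉0 (den r) (den s) (den≉0 r) (den≉0 s))

0# 1# : ℚ⟨C⟩
0# = fromPoly 0ₚ
1# = fromPoly 1ₚ

sum : List ℚ⟨C⟩ → ℚ⟨C⟩
sum = foldr _+_ 0#

------------------------------------------------------------------------
-- Formal power series in x, y over ℚ⟨C⟩: f i j is the coefficient of x^i y^j

Series : Set
Series = ℕ → ℕ → ℚ⟨C⟩

_⊛_ : Series → Series → Series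
(f ⊛ g) n m = sum (List.map (λ i →
              sum (List.map (λ j → f i j * g (n ∸ i) (m ∸ j))
                (upTo (suc m)))) (upTo (suc n)))

-- Polynomials in x, y, C as polynomials in x over polynomials in y over ℤ[C]

ℤ[x,y,C] : Set
ℤ[x,y,C] = List (List ℤ[C])

coeffₓᵧ : ℤ[x,y,C] → ℕ → ℕ → ℤ[C]
coeffₓᵧ P i j = coeff 0ₚ (coeff [] P i) j

IsZero : ℤ[x,y,C] → Set
IsZero P = ∀ i j → coeffₓᵧ P i j ≈ 0ₚ

toSeries : ℤ[x,y,C] → Series
toSeries P i j = fromPoly (coeffₓᵧ P i j)

-- f = P / Q. Series over a field form an integral domain, so Q ≠ 0 suffices
-- for the quotient to be well defined; integer rather than rational
-- coefficients are no restriction, as denominators can be cleared.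
IsRational : Series → Set
IsRational f = Σ[ P ∈ ℤ[x,y,C] ] Σ[ Q ∈ ℤ[x,y,C] ]
  ¬ IsZero Q × (∀ i j → (toSeries Q ⊛ f) i j ≃ toSeries P i j)

------------------------------------------------------------------------

Vertex : ℕ → Set
Vertex h = ℕ × Fin h

private variable
  h n : ℕ

dist² : Vertex h → Vertex h → ℕ
dist² (a , b) (c , d) = ∣ a - c ∣ ℕ.^ 2 ℕ.+ ∣ toℕ b - toℕ d ∣ ℕ.^ 2

-- The square of the condition that the Euclidean distance is 1
Adj : Vertex h → Vertex h → Set
Adj v w = dist² v w ≡ 1

topLeft : ∀ h .{{_ : NonZero h}} → Vertex h
topLeft (suc k) = 0 , fromℕ k

_≟ᵥ_ : (v w : Vertex h) → Dec (v ≡ w)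
_≟ᵥ_ = ≡-dec ℕ._≟_ Fin._≟_

adj? : (v w : Vertex h) → Dec (Adj v w)
adj? v w = dist² v w ℕ.≟ 1

neighbours : Vertex h → List (Vertex h)
neighbours {h} v = filter (adj? v) (cartesianProduct (upTo (2 ℕ.+ proj₁ v)) (allFin h))

dist²≡1⇒∣-∣≤1 : ∀ k l → k ℕ.^ 2 ℕ.+ l ≡ 1 → k ℕ.≤ 1
dist²≡1⇒∣-∣≤1 zero          l eq = ℕ.z≤n
dist²≡1⇒∣-∣≤1 (suc zero)    l eq = ℕ.≤-refl
dist²≡1⇒∣-∣≤1 (suc (suc k)) l ()

∈-neighbours : (v w : Vertex h) → w ∈ neighbours v ⇔ Adj v w
∈-neighbours {h} (a , b) (c , d) = mk⇔
  (λ m → proj₂ (∈-filter⁻ (adj? (a , b)) {xs = box} m))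
  (λ e → ∈-filter⁺ (adj? (a , b)) (∈-cartesianProduct⁺ (∈-upTo⁺ (c<2+a e)) (∈-allFin d)) e)
  where
  box = cartesianProduct (upTo (2 ℕ.+ a)) (allFin h)
  c<2+a : Adj (a , b) (c , d) → c ℕ.< 2 ℕ.+ a
  c<2+a e = ℕ.s≤s (begin
    c                    ≤⟨ ℕ.m≤n+∣n-m∣ c a ⟩
    a ℕ.+ ∣ a - c ∣      ≤⟨ ℕ.+-monoʳ-≤ a (dist²≡1⇒∣-∣≤1 ∣ a - c ∣ _ e) ⟩
    a ℕ.+ 1              ≡⟨ ℕ.+-comm a 1 ⟩
    suc a                ∎)
    where open ℕ.≤-Reasoning

neighbours-unique : (v : Vertex h) → Unique (neighbours v)
neighbours-unique {h} v = Unique.filter⁺ (adj? v)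
  (Unique.cartesianProduct⁺ (Unique.upTo⁺ (2 ℕ.+ proj₁ v)) (Unique.allFin⁺ h))

------------------------------------------------------------------------
-- A walk with n edges is the vector of its n + 1 vertices, most
-- recent first: the head is the current endpoint, the last entry the start.

Walk : ℕ → ℕ → Set
Walk h n = Vec (Vertex h) (suc n)

Trapped : Walk h n → Set
Trapped W = ∀ u → Adj (head W) u → u Vec.∈ W

record IsGSAW (v : Vertex h) (W : Walk h n) : Set where
  field
    starts   : last W ≡ v
    walk     : Linked Adj W
    avoiding : Vec.Unique W
    trapped  : Trapped W

displacement : Walk h n → ℕ
displacement W = foldr₁ _⊔_ xs ∸ foldr₁ _⊓_ xs
  where xs = Vec.map proj₁ W

------------------------------------------------------------------------

_∈ᵥ?_ : (u : Vertex h) (vs : Vec (Vertex h) n) → Dec (u Vec.∈ vs)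
u ∈ᵥ? vs = DecVecMember._∈?_ _≟ᵥ_ u vs

unvisited : Walk h n → List (Vertex h)
unvisited W = filter (λ u → ¬? (u ∈ᵥ? W)) (neighbours (head W))

visitedNeighbours : Walk h n → Vertex h → List (Vertex h)
visitedNeighbours W w = filter (λ u → u ∈ᵥ? W ×-dec ¬? (u ≟ᵥ head W)) (neighbours w)

energy : Walk h n → Vertex h → ℤ[C]
energy W w = C^ length (visitedNeighbours W w)

totalEnergy : Walk h n → ℤ[C]
totalEnergy W = sumₚ (List.map (energy W) (unvisited W))

-- Nonvanishing of totalEnergy is checked by evaluation at C = 1.
eval₁ : ℤ[C] → ℤ
eval₁ = foldr ℤ._+_ 0ℤ

eval₁-+ₚ : ∀ p q → eval₁ (p +ₚ q) ≡ eval₁ p ℤ.+ eval₁ q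
eval₁-+ₚ []      q       = sym (ℤ.+-identityˡ _)
eval₁-+ₚ (a ∷ p) []      = sym (ℤ.+-identityʳ _)
eval₁-+ₚ (a ∷ p) (b ∷ q) = begin
  a ℤ.+ b ℤ.+ eval₁ (p +ₚ q)            ≡⟨ cong (ℤ._+_ (a ℤ.+ b)) (eval₁-+ₚ p q) ⟩
  a ℤ.+ b ℤ.+ (eval₁ p ℤ.+ eval₁ q)     ≡⟨ ℤ.+-assoc a b _ ⟩
  a ℤ.+ (b ℤ.+ (eval₁ p ℤ.+ eval₁ q))   ≡⟨ cong (ℤ._+_ a) (ℤ.+-assoc b _ _) ⟨
  a ℤ.+ (b ℤ.+ eval₁ p ℤ.+ eval₁ q)     ≡⟨ cong (λ t → a ℤ.+ (t ℤ.+ eval₁ q)) (ℤ.+-comm b _) ⟩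
  a ℤ.+ (eval₁ p ℤ.+ b ℤ.+ eval₁ q)     ≡⟨ cong (ℤ._+_ a) (ℤ.+-assoc (eval₁ p) b _) ⟩
  a ℤ.+ (eval₁ p ℤ.+ (b ℤ.+ eval₁ q))   ≡⟨ ℤ.+-assoc a _ _ ⟨
  a ℤ.+ eval₁ p ℤ.+ (b ℤ.+ eval₁ q)     ∎
  where open ≡-Reasoning

eval₁-C^ : ∀ k → eval₁ (C^ k) ≡ 1ℤ
eval₁-C^ zero    = refl
eval₁-C^ (suc k) = trans (ℤ.+-identityˡ _) (eval₁-C^ k)

eval₁-≈0 : ∀ p → p ≈ 0ₚ → eval₁ p ≡ 0ℤ
eval₁-≈0 []      _   = refl
eval₁-≈0 (a ∷ p) p≈0 = cong₂ ℤ._+_ (p≈0 zero) (eval₁-≈0 p (p≈0 ∘ suc))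

eval₁-energies : (W : Walk h n) (us : List (Vertex h)) →
                 eval₁ (sumₚ (List.map (energy W) us)) ≡ ℤ.+ length us
eval₁-energies W []       = refl
eval₁-energies W (u ∷ us) = trans (eval₁-+ₚ (energy W u) _)
  (cong₂ ℤ._+_ (eval₁-C^ (length (visitedNeighbours W u))) (eval₁-energies W us))

totalEnergy≉0 : (W : Walk h n) {w : Vertex h} → w ∈ unvisited W → ¬ totalEnergy W ≈ 0ₚ
totalEnergy≉0 W w∈ eq = go (unvisited W) w∈
  (trans (sym (eval₁-energies W (unvisited W))) (eval₁-≈0 (totalEnergy W) eq))
  where
  go : ∀ us {w} → w ∈ us → ¬ ℤ.+ length us ≡ 0ℤ
  go (_ ∷ _) _ ()

-- Zero unless w is an unvisited neighbour of the endpoint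
stepProb : Walk h n → Vertex h → ℚ⟨C⟩
stepProb W w with DecMember._∈?_ _≟ᵥ_ w (unvisited W)
... | yes w∈ = frac (energy W w) (totalEnergy W) (totalEnergy≉0 W w∈)
... | no  _  = 0#

prob : Walk h n → ℚ⟨C⟩
prob (v ∷ [])       = 1#
prob (w ∷ v ∷ past) = prob (v ∷ past) * stepProb (v ∷ past) w

------------------------------------------------------------------------
-- By ∈-gsaws and gsaws-unique, gsaws v n d lists each GSAW from v of length n
-- and displacement d exactly once.

walks : Vertex h → ∀ n → List (Walk h n)
walks v zero    = (v ∷ []) ∷ []
walks v (suc n) = concatMap (λ W → List.map (_∷ W) (neighbours (head W))) (walks v n)

trapped? : (W : Walk h n) → Dec (Trapped W)
trapped? W = map′
  (λ all u e → All.lookup all (Equivalence.from (∈-neighbours (head W) u) e))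
  (λ t → All.tabulate (λ {u} m → t u (Equivalence.to (∈-neighbours (head W) u) m)))
  (All.all? (_∈ᵥ? W) (neighbours (head W)))

isGSAW? : (v : Vertex h) (W : Walk h n) → Dec (IsGSAW v W)
isGSAW? v W = map′
  (λ { (s , l , a , t) → record { starts = s ; walk = l ; avoiding = a ; trapped = t } })
  (λ g → let open IsGSAW g in starts , walk , avoiding , trapped)
  (last W ≟ᵥ v ×-dec Linked.linked? adj? W
    ×-dec VecAllPairs.allPairs? (λ u w → ¬? (u ≟ᵥ w)) W ×-dec trapped? W)

gsaws : Vertex h → ∀ n → ℕ → List (Walk h n)
gsaws v n d = filter (λ W → isGSAW? v W ×-dec displacement W ℕ.≟ d) (walks v n)

adj-sym : (v w : Vertex h) → Adj v w → Adj w v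
adj-sym (a , b) (c , d) = trans (cong₂ (λ s t → s ℕ.^ 2 ℕ.+ t ℕ.^ 2)
  (ℕ.∣-∣-comm c a) (ℕ.∣-∣-comm (toℕ d) (toℕ b)))

∈-walks : (v : Vertex h) (W : Walk h n) → last W ≡ v → Linked Adj W → W ∈ walks v n
∈-walks v (_ ∷ [])     refl _       = here refl
∈-walks v (w ∷ u ∷ us) eq   (e ∷ l) = ∈-concatMap⁺ _ (lose (∈-walks v (u ∷ us) eq l)
  (∈-map⁺ (_∷ u ∷ us) (Equivalence.from (∈-neighbours u w) (adj-sym w u e))))

∈-gsaws : (v : Vertex h) (W : Walk h n) (d : ℕ) →
          W ∈ gsaws v n d ⇔ (IsGSAW v W × displacement W ≡ d)
∈-gsaws {n = n} v W d = mk⇔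
  (λ m → proj₂ (∈-filter⁻ P? {xs = walks v n} m))
  (λ { (g , e) → ∈-filter⁺ P? (∈-walks v W (IsGSAW.starts g) (IsGSAW.walk g)) (g , e) })
  where
  P? = λ W → isGSAW? v W ×-dec displacement W ℕ.≟ d

walks-unique : (v : Vertex h) (n : ℕ) → Unique (walks v n)
walks-unique v zero    = All.[] ∷ []
walks-unique {h} v (suc n) = Unique.concat⁺
  (All.map⁺ (All.universal (λ W → Unique.map⁺ (proj₁ ∘ Vec.∷-injective) (neighbours-unique (head W))) (walks v n)))
  (AllPairs.map⁺ (AllPairs.map disjoint (walks-unique v n)))
  where
  extend : Walk h n → List (Walk h (suc n))
  extend W = List.map (_∷ W) (neighbours (head W))
  disjoint : {W W′ : Walk h n} → ¬ W ≡ W′ → Disjoint (extend W) (extend W′)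
  disjoint {W} {W′} W≢W′ (m , m′) with ∈-map⁻ (_∷ W) m | ∈-map⁻ (_∷ W′) m′
  ... | _ , _ , refl | _ , _ , eq = W≢W′ (proj₂ (Vec.∷-injective eq))

gsaws-unique : (v : Vertex h) (n d : ℕ) → Unique (gsaws v n d)
gsaws-unique v n d = Unique.filter⁺ _ (walks-unique v n)

-- Σ_W prob W · x^|W| y^‖W‖ over the GSAWs W from v
genFun : Vertex h → Series
genFun v n d = sum (List.map prob (gsaws v n d))

-- A walk in the half-infinite strip is cut into its restrictions to the windows
-- of 7 consecutive columns, each recorded as the word of the visited vertices in
-- order of time. The word of a walk is the merge of its first window with the
-- word of the columns from 1 on: the walk cannot jump over the common columns, so
-- the order of the remaining letters is forced. Being self-avoiding, connected
-- and trapped can be checked window by window, and the factor of a step only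
-- depends on the visited vertices within distance 2 of its source, hence on one
-- window. Up to translation there are finitely many windows, so the generating
-- functions of the words with a given first window satisfy a finite linear system
--   G s = x^(k s) w s (final s + y Σ_t [t follows s] G t),
-- which division-free Gaussian elimination solves by quotients of polynomials:
-- no pivot vanishes, since all coefficients on the right are divisible by y.

module Submission where

open import Algebra.Bundles using (CommutativeMonoid; CommutativeRing)
open import Data.Bool using (Bool; true; false; if_then_else_; _∧_; not)
open import Data.List as List
  using (List; []; _∷_; _++_; allFin; applyUpTo; cartesianProduct; cartesianProductWith; concatMap; filter; length; map;
         replicate; upTo)
import Data.List.Properties as List
open import Data.List.Membership.Propositional using (_∈_; _∉_; find; lose)
open import Data.List.Relation.Binary.Permutation.Propositional as ↭ using (_↭_)
open import Data.List.Relation.Unary.Any as Any using (Any; here; there)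
open import Data.Nat as ℕ using (ℕ; zero; suc; NonZero; _∸_; _≤_; _<_; _≤?_; _≤ᵇ_; _⊔_; _⊓_; ∣_-_∣; z≤n; s≤s)
import Data.Nat.Properties as ℕ
open import Data.Product using (∃; ∃₂; Σ-syntax; _×_; _,_; proj₁; proj₂)
open import Data.Sum as Sum using (_⊎_; inj₁; inj₂; [_,_]′)
open import Defs using (coeff)
open import Function using (id; _∘_; Equivalence; _⇔_; mk⇔)
open import Level using (0ℓ)
open import Relation.Binary.PropositionalEquality as ≡ using (_≡_)
import Relation.Binary.Reasoning.Setoid as ≈-Reasoning
open import Relation.Nullary using (¬_; Dec; yes; no; does; contradiction; ¬?; _×-dec_; _⊎-dec_; _→-dec_)
open import Relation.Unary using (Decidable)

-- A vertical cut may be crossed many times, and the probability of a step depends on what has been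
-- visited by then, so the set of visited vertices is not enough as a state: the chronological order
-- is needed. An excursion out of a window leaves and returns through the same boundary column, so
-- it shows as a jump between two letters of that column, and such jumps are allowed along open
-- sides only. Every window is open on the right. The first one is closed on the left; this bit
-- belongs to the state, because only there the given start is prescribed and the steps into columns
-- 0, 1 and 2 are counted. Each step must be charged to exactly one window, although it lies in
-- several: after the first window, it is charged to the one with its target in the middle column.
-- The walk starts in column 0, so its displacement is its last column. Passing to the next window
-- lowers this column by one, which gives the factor y and the recursion behind the enumeration of
-- the words.

module FractionIdentities {c ℓ} (R : CommutativeRing c ℓ) where
  open CommutativeRing R
  open import Algebra.Properties.Ring ring using (-‿distribˡ-*)
  open import Algebra.Solver.Ring.NaturalCoefficients.Default commutativeSemiring using (solve; _:+_; _:*_; _:=_; con)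
  open ≈-Reasoning setoid

  -- These identities become the field laws of `ℚ⟨C⟩`, with numerators and denominators for the
  -- variables; `u` stands for the denominator `1ₚ`.
  swap-right : ∀ x y z → x * y * z ≈ x * z * y
  swap-right = solve 3 (λ x y z → x :* y :* z := x :* z :* y) refl

  *-interchange : ∀ x y z w → x * y * (z * w) ≈ x * z * (y * w)
  *-interchange = solve 4 (λ x y z w → x :* y :* (z :* w) := x :* z :* (y :* w)) refl

  +-cong-left : ∀ a b a′ b′ d d′ → (a * b′ + a′ * b) * (d * d′) ≈ a * d * (b′ * d′) + a′ * d′ * (b * d)
  +-cong-left = solve 6 (λ a b a′ b′ d d′ → (a :* b′ :+ a′ :* b) :* (d :* d′) :=
    a :* d :* (b′ :* d′) :+ a′ :* d′ :* (b :* d)) refl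

  +-cong-right : ∀ c d c′ d′ b b′ → c * b * (b′ * d′) + c′ * b′ * (b * d) ≈ (c * d′ + c′ * d) * (b * b′)
  +-cong-right = solve 6 (λ c d c′ d′ b b′ → c :* b :* (b′ :* d′) :+ c′ :* b′ :* (b :* d) :=
    (c :* d′ :+ c′ :* d) :* (b :* b′)) refl

  frac-+-assoc : ∀ a b c d e f →
    ((a * d + c * b) * f + e * (b * d)) * (b * (d * f)) ≈ (a * (d * f) + (c * f + e * d) * b) * (b * d * f)
  frac-+-assoc = solve 6 (λ a b c d e f →
    ((a :* d :+ c :* b) :* f :+ e :* (b :* d)) :* (b :* (d :* f)) :=
    (a :* (d :* f) :+ (c :* f :+ e :* d) :* b) :* (b :* d :* f)) refl

  frac-+-comm : ∀ a b c d → (a * d + c * b) * (d * b) ≈ (c * b + a * d) * (b * d)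
  frac-+-comm = solve 4 (λ a b c d → (a :* d :+ c :* b) :* (d :* b) := (c :* b :+ a :* d) :* (b :* d)) refl

  frac-+-identityˡ : ∀ u a b → (0# * b + a * u) * b ≈ a * (u * b)
  frac-+-identityˡ = solve 3 (λ u a b → (con 0 :* b :+ a :* u) :* b := a :* (u :* b)) refl

  frac-*-assoc : ∀ a b c d e f → a * c * e * (b * (d * f)) ≈ a * (c * e) * (b * d * f)
  frac-*-assoc = solve 6 (λ a b c d e f → a :* c :* e :* (b :* (d :* f)) := a :* (c :* e) :* (b :* d :* f)) refl

  frac-*-comm : ∀ a b c d → a * c * (d * b) ≈ c * a * (b * d)
  frac-*-comm = solve 4 (λ a b c d → a :* c :* (d :* b) := c :* a :* (b :* d)) refl

  frac-*-identityˡ : ∀ u a b → u * a * b ≈ a * (u * b)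
  frac-*-identityˡ = solve 3 (λ u a b → u :* a :* b := a :* (u :* b)) refl

  frac-distribˡ : ∀ a b c d e f →
    a * (c * f + e * d) * (b * d * (b * f)) ≈ (a * c * (b * f) + a * e * (b * d)) * (b * (d * f))
  frac-distribˡ = solve 6 (λ a b c d e f → a :* (c :* f :+ e :* d) :* (b :* d :* (b :* f)) :=
    (a :* c :* (b :* f) :+ a :* e :* (b :* d)) :* (b :* (d :* f))) refl

  frac-homo-+ : ∀ u p q → (p + q) * (u * u) ≈ (p * u + q * u) * u
  frac-homo-+ = solve 3 (λ u p q → (p :+ q) :* (u :* u) := (p :* u :+ q :* u) :* u) refl

  frac-den-* : ∀ u a b → b * a * u ≈ a * (u * b)
  frac-den-* = solve 3 (λ u a b → b :* a :* u := a :* (u :* b)) refl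

  neg-cong : ∀ a d → - a * d ≈ - (a * d)
  neg-cong a d = sym (-‿distribˡ-* a d)

  frac-neg-inverseˡ : ∀ a b → (- a * b + a * b) * 1# ≈ 0# * (b * b)
  frac-neg-inverseˡ a b = begin
    (- a * b + a * b) * 1#    ≈⟨ *-identityʳ _ ⟩
    - a * b + a * b           ≈⟨ distribʳ b (- a) a ⟨
    (- a + a) * b             ≈⟨ *-congʳ (-‿inverseˡ a) ⟩
    0# * b                    ≈⟨ zeroˡ b ⟩
    0#                        ≈⟨ zeroˡ (b * b) ⟨
    0# * (b * b)              ∎

  cancel-left : ∀ x y z → (x + - y) * z ≈ x * z + - (y * z)
  cancel-left x y z = trans (distribʳ z x (- y)) (+-congˡ (neg-cong y z))

  add-back : ∀ x y → x ≈ x + - y + y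
  add-back x y = begin
    x                ≈⟨ +-identityʳ x ⟨
    x + 0#           ≈⟨ +-congˡ (-‿inverseˡ y) ⟨
    x + (- y + y)    ≈⟨ +-assoc x (- y) y ⟨
    x + - y + y      ∎

-- Finite sums over lists in a commutative ring

module ListSum (K : CommutativeRing 0ℓ 0ℓ) where
  open CommutativeRing K
  open import Algebra.Properties.CommutativeSemigroup
    (CommutativeMonoid.commutativeSemigroup +-commutativeMonoid) using (interchange; x∙yz≈y∙xz)

  private variable A B : Set

  ∑ : List A → (A → Carrier) → Carrier
  ∑ xs f = List.foldr _+_ 0# (List.map f xs)

  ∑-cong : ∀ (xs : List A) {f g} → (∀ {x} → x ∈ xs → f x ≈ g x) → ∑ xs f ≈ ∑ xs g
  ∑-cong []       e = refl
  ∑-cong (x ∷ xs) e = +-cong (e (here ≡.refl)) (∑-cong xs (e ∘ there))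

  ∑-zero : ∀ (xs : List A) {f} → (∀ x → f x ≈ 0#) → ∑ xs f ≈ 0#
  ∑-zero []       e = refl
  ∑-zero (x ∷ xs) e = trans (+-cong (e x) (∑-zero xs e)) (+-identityˡ 0#)

  ∑-+ : ∀ (xs : List A) f g → ∑ xs (λ x → f x + g x) ≈ ∑ xs f + ∑ xs g
  ∑-+ []       f g = sym (+-identityˡ 0#)
  ∑-+ (x ∷ xs) f g = trans (+-congˡ (∑-+ xs f g)) (interchange (f x) (g x) (∑ xs f) (∑ xs g))

  ∑-*ˡ : ∀ (xs : List A) r f → r * ∑ xs f ≈ ∑ xs (λ x → r * f x)
  ∑-*ˡ []       r f = zeroʳ r
  ∑-*ˡ (x ∷ xs) r f = trans (distribˡ r (f x) (∑ xs f)) (+-congˡ (∑-*ˡ xs r f))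

  ∑-++ : ∀ (xs ys : List A) f → ∑ (xs ++ ys) f ≈ ∑ xs f + ∑ ys f
  ∑-++ []       ys f = sym (+-identityˡ _)
  ∑-++ (x ∷ xs) ys f = trans (+-congˡ (∑-++ xs ys f)) (sym (+-assoc (f x) (∑ xs f) (∑ ys f)))

  ∑-map : ∀ (h : A → B) xs f → ∑ (List.map h xs) f ≈ ∑ xs (f ∘ h)
  ∑-map h []       f = refl
  ∑-map h (x ∷ xs) f = +-congˡ (∑-map h xs f)

  ∑-concatMap : ∀ (h : A → List B) xs f → ∑ (List.concatMap h xs) f ≈ ∑ xs (λ x → ∑ (h x) f)
  ∑-concatMap h []       f = refl
  ∑-concatMap h (x ∷ xs) f = trans (∑-++ (h x) (List.concatMap h xs) f) (+-congˡ (∑-concatMap h xs f))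

  ∑-filter : ∀ {P : A → Set} (P? : Decidable P) xs {f} →
    (∀ {x} → x ∈ xs → ¬ P x → f x ≈ 0#) → ∑ (List.filter P? xs) f ≈ ∑ xs f
  ∑-filter P? []       z = refl
  ∑-filter P? (x ∷ xs) z with P? x
  ... | yes _  = +-congˡ (∑-filter P? xs (z ∘ there))
  ... | no ¬Px = trans (∑-filter P? xs (z ∘ there)) (sym (trans (+-congʳ (z (here ≡.refl) ¬Px)) (+-identityˡ _)))

  ∑-↭ : ∀ {xs ys : List A} f → xs ↭ ys → ∑ xs f ≈ ∑ ys f
  ∑-↭ f ↭.refl         = refl
  ∑-↭ f (↭.prep x p)   = +-congˡ (∑-↭ f p)
  ∑-↭ f (↭.swap x y p) = trans (x∙yz≈y∙xz (f x) (f y) _) (+-congˡ (+-congˡ (∑-↭ f p)))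
  ∑-↭ f (↭.trans p q)  = trans (∑-↭ f p) (∑-↭ f q)

  ∑-comm : ∀ (xs : List A) (ys : List B) (f : A → B → Carrier) → ∑ xs (λ x → ∑ ys (f x)) ≈ ∑ ys (λ y → ∑ xs (λ x → f x y))
  ∑-comm []       ys f = sym (∑-zero ys (λ _ → refl))
  ∑-comm (x ∷ xs) ys f = trans (+-congˡ (∑-comm xs ys f)) (sym (∑-+ ys (f x) (λ y → ∑ xs (λ x → f x y))))

  ∑-upTo-suc : ∀ n f → ∑ (upTo (suc n)) f ≈ f 0 + ∑ (upTo n) (f ∘ suc)
  ∑-upTo-suc n f = +-congˡ (reflexive (≡.cong (List.foldr _+_ 0#) (begin
    List.map f (List.applyUpTo suc n)   ≡⟨ List.map-applyUpTo suc f n ⟩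
    List.applyUpTo (f ∘ suc) n          ≡⟨ List.map-upTo (f ∘ suc) n ⟨
    List.map (f ∘ suc) (upTo n)         ∎)))
    where open ≡.≡-Reasoning

-- `K` is a field of fractions of `Z`. Ring laws are asked for only after applying `ι`, because
-- propositional equality on coefficient lists distinguishes trailing zeros. The two identity laws
-- for `0ᶻ` hold on the nose, as required for reading off coefficients past the end of a list.
record CoefficientRing (K : CommutativeRing 0ℓ 0ℓ) : Set₁ where
  open CommutativeRing K
  field
    Z             : Set
    _+ᶻ_ _*ᶻ_     : Z → Z → Z
    -ᶻ_           : Z → Z
    0ᶻ 1ᶻ         : Z
    ι             : Z → Carrier
    +ᶻ-identityˡ  : ∀ a → 0ᶻ +ᶻ a ≡ a
    +ᶻ-identityʳ  : ∀ a → a +ᶻ 0ᶻ ≡ a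
    ι-+           : ∀ a b → ι (a +ᶻ b) ≈ ι a + ι b
    ι-*           : ∀ a b → ι (a *ᶻ b) ≈ ι a * ι b
    ι-neg         : ∀ a → ι a + ι (-ᶻ a) ≈ 0#
    ι-0           : ι 0ᶻ ≈ 0#
    ι-1           : ι 1ᶻ ≈ 1#
    numᶻ denᶻ     : Carrier → Z
    ι-den         : ∀ a → ι (denᶻ a) * a ≈ ι (numᶻ a)
    den-nonzero   : ∀ a → ¬ ι (denᶻ a) ≈ 0#
    zero-product  : ∀ a b → a * b ≈ 0# → a ≈ 0# ⊎ b ≈ 0#

-- Linear systems for power series with polynomial coefficients

module Elimination (K : CommutativeRing 0ℓ 0ℓ) (R : CoefficientRing K) where
  open CommutativeRing K
  open CoefficientRing R
  open ListSum K
  open import Algebra.Properties.CommutativeSemigroup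
    (CommutativeMonoid.commutativeSemigroup +-commutativeMonoid) using ()
    renaming (interchange to +-interchange; x∙yz≈y∙xz to +-swap)
  open import Algebra.Properties.CommutativeSemigroup
    (CommutativeMonoid.commutativeSemigroup *-commutativeMonoid) using ()
    renaming (x∙yz≈y∙xz to *-swap)

  private variable A : Set

  Series : Set
  Series = ℕ → ℕ → Carrier

  -- Polynomials as operators on power series

  -- Coefficient of t^n in t^i · Σ_k g k t^k
  shift : ℕ → ℕ → (ℕ → Carrier) → Carrier
  shift zero    n       g = g n
  shift (suc i) zero    g = 0#
  shift (suc i) (suc n) g = shift i n g

  shift-cong : ∀ i n {g h} → (∀ k → g k ≈ h k) → shift i n g ≈ shift i n h
  shift-cong zero    n       e = e n
  shift-cong (suc i) zero    e = refl
  shift-cong (suc i) (suc n) e = shift-cong i n e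

  shift-0 : ∀ i n → shift i n (λ _ → 0#) ≈ 0#
  shift-0 zero    n       = refl
  shift-0 (suc i) zero    = refl
  shift-0 (suc i) (suc n) = shift-0 i n

  shift-+ : ∀ i n g h → shift i n (λ k → g k + h k) ≈ shift i n g + shift i n h
  shift-+ zero    n       g h = refl
  shift-+ (suc i) zero    g h = sym (+-identityˡ 0#)
  shift-+ (suc i) (suc n) g h = shift-+ i n g h

  shift-*ˡ : ∀ i n r g → shift i n (λ k → r * g k) ≈ r * shift i n g
  shift-*ˡ zero    n       r g = refl
  shift-*ˡ (suc i) zero    r g = sym (zeroʳ r)
  shift-*ˡ (suc i) (suc n) r g = shift-*ˡ i n r g

  shift-∑ : ∀ i n (xs : List A) (f : ℕ → A → Carrier) →
    shift i n (λ k → ∑ xs (f k)) ≈ ∑ xs (λ x → shift i n (λ k → f k x))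
  shift-∑ i n []       f = shift-0 i n
  shift-∑ i n (x ∷ xs) f = trans (shift-+ i n (λ k → f k x) (λ k → ∑ xs (f k))) (+-congˡ (shift-∑ i n xs f))

  shift-shift : ∀ i j n g → shift (i ℕ.+ j) n g ≡ shift i n (λ k → shift j k g)
  shift-shift zero    j n       g = ≡.refl
  shift-shift (suc i) j zero    g = ≡.refl
  shift-shift (suc i) j (suc n) g = shift-shift i j n g

  shift-swap : ∀ i n j m (f : Series) →
    shift i n (λ a → shift j m (f a)) ≈ shift j m (λ b → shift i n (λ a → f a b))
  shift-swap zero    n       j m f = refl
  shift-swap (suc i) zero    j m f = sym (shift-0 j m)
  shift-swap (suc i) (suc n) j m f = shift-swap i n j m f

  record Monomial : Set where
    constructor _x^_y^_
    field
      coefficient : Z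
      degˣ degʸ   : ℕ

  Poly : Set
  Poly = List Monomial

  act₁ : Monomial → Series → Series
  act₁ (c x^ i y^ j) f n m = ι c * shift i n (λ a → shift j m (f a))

  -- Multiplication by a polynomial as a sum of scaled shifts. In the elimination, composition of
  -- these operators takes the place of convolution, and commutativity reduces to the fact that
  -- shifts commute.
  act : Poly → Series → Series
  act p f n m = ∑ p (λ μ → act₁ μ f n m)

  infix 4 _≐_
  _≐_ : Series → Series → Set
  f ≐ g = ∀ n m → f n m ≈ g n m

  act₁-cong : ∀ μ {f g} → f ≐ g → act₁ μ f ≐ act₁ μ g
  act₁-cong (c x^ i y^ j) e n m = *-congˡ (shift-cong i n (λ a → shift-cong j m (e a)))

  act₁-+ : ∀ μ f g → act₁ μ (λ a b → f a b + g a b) ≐ λ n m → act₁ μ f n m + act₁ μ g n m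
  act₁-+ (c x^ i y^ j) f g n m = trans
    (*-congˡ (trans (shift-cong i n (λ a → shift-+ j m (f a) (g a)))
      (shift-+ i n (λ a → shift j m (f a)) (λ a → shift j m (g a)))))
    (distribˡ (ι c) _ _)

  act₁-0 : ∀ μ → act₁ μ (λ _ _ → 0#) ≐ λ _ _ → 0#
  act₁-0 (c x^ i y^ j) n m =
    trans (*-congˡ (trans (shift-cong i n (λ a → shift-0 j m)) (shift-0 i n))) (zeroʳ (ι c))

  act-cong : ∀ p {f g} → f ≐ g → act p f ≐ act p g
  act-cong p e n m = ∑-cong p (λ {μ} _ → act₁-cong μ e n m)

  act-+ : ∀ p f g → act p (λ a b → f a b + g a b) ≐ λ n m → act p f n m + act p g n m
  act-+ p f g n m = trans (∑-cong p (λ {μ} _ → act₁-+ μ f g n m))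
    (∑-+ p (λ μ → act₁ μ f n m) (λ μ → act₁ μ g n m))

  act-∑ : ∀ p (xs : List A) (f : A → Series) →
    act p (λ a b → ∑ xs (λ x → f x a b)) ≐ λ n m → ∑ xs (λ x → act p (f x) n m)
  act-∑ p []       f n m = ∑-zero p (λ μ → act₁-0 μ n m)
  act-∑ p (x ∷ xs) f n m = trans (act-+ p (f x) (λ a b → ∑ xs (λ x → f x a b)) n m)
    (+-congˡ (act-∑ p xs f n m))

  act-++ : ∀ p q f → act (p ++ q) f ≐ λ n m → act p f n m + act q f n m
  act-++ p q f n m = ∑-++ p q (λ μ → act₁ μ f n m)

  infixl 7 _·₁_ _·_
  _·₁_ : Monomial → Monomial → Monomial
  (c x^ i y^ j) ·₁ (c′ x^ i′ y^ j′) = (c *ᶻ c′) x^ (i ℕ.+ i′) y^ (j ℕ.+ j′)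

  _·_ : Poly → Poly → Poly
  p · q = List.concatMap (λ μ → List.map (μ ·₁_) q) p

  act₁-· : ∀ μ ν f → act₁ (μ ·₁ ν) f ≐ act₁ μ (act₁ ν f)
  act₁-· (c x^ i y^ j) (c′ x^ i′ y^ j′) f n m = begin
    ι (c *ᶻ c′) * shift (i ℕ.+ i′) n (λ a → shift (j ℕ.+ j′) m (f a))
      ≈⟨ *-cong (ι-* c c′) (reflexive (shift-shift i i′ n (λ a → shift (j ℕ.+ j′) m (f a)))) ⟩
    ι c * ι c′ * shift i n (λ k → shift i′ k (λ a → shift (j ℕ.+ j′) m (f a)))
      ≈⟨ *-congˡ (shift-cong i n λ k → trans
           (shift-cong i′ k λ a → reflexive (shift-shift j j′ m (f a)))
           (shift-swap i′ k j m (λ a b → shift j′ b (f a)))) ⟩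
    ι c * ι c′ * shift i n (λ k → shift j m (λ b → shift i′ k (λ a → shift j′ b (f a))))
      ≈⟨ *-assoc _ _ _ ⟩
    ι c * (ι c′ * shift i n (λ k → shift j m (λ b → shift i′ k (λ a → shift j′ b (f a)))))
      ≈⟨ *-congˡ (shift-*ˡ i n (ι c′) _) ⟨
    ι c * shift i n (λ k → ι c′ * shift j m (λ b → shift i′ k (λ a → shift j′ b (f a))))
      ≈⟨ *-congˡ (shift-cong i n λ k → shift-*ˡ j m (ι c′) _) ⟨
    ι c * shift i n (λ k → shift j m (λ b → ι c′ * shift i′ k (λ a → shift j′ b (f a))))
      ∎
    where open ≈-Reasoning setoid

  act₁-comm : ∀ μ ν f → act₁ μ (act₁ ν f) ≐ act₁ ν (act₁ μ f)
  act₁-comm μ@(c x^ i y^ j) ν@(c′ x^ i′ y^ j′) f n m = begin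
    act₁ μ (act₁ ν f) n m    ≈⟨ act₁-· μ ν f n m ⟨
    act₁ (μ ·₁ ν) f n m      ≈⟨ *-cong (trans (ι-* c c′) (trans (*-comm (ι c) (ι c′)) (sym (ι-* c′ c)))) (reflexive
                                  (≡.cong₂ (λ i j → shift i n (λ a → shift j m (f a)))
                                    (ℕ.+-comm i i′) (ℕ.+-comm j j′))) ⟩
    act₁ (ν ·₁ μ) f n m      ≈⟨ act₁-· ν μ f n m ⟩
    act₁ ν (act₁ μ f) n m    ∎
    where open ≈-Reasoning setoid

  act₁-act : ∀ μ q f → act₁ μ (act q f) ≐ λ n m → ∑ q (λ ν → act₁ μ (act₁ ν f) n m)
  act₁-act μ []      f n m = act₁-0 μ n m
  act₁-act μ (ν ∷ q) f n m = trans (act₁-+ μ (act₁ ν f) (act q f) n m) (+-congˡ (act₁-act μ q f n m))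

  act-· : ∀ p q f → act (p · q) f ≐ act p (act q f)
  act-· p q f n m = begin
    ∑ (p · q) (λ μ → act₁ μ f n m)                        ≈⟨ ∑-concatMap (λ μ → List.map (μ ·₁_) q) p _ ⟩
    ∑ p (λ μ → ∑ (List.map (μ ·₁_) q) (λ μ → act₁ μ f n m))  ≈⟨ ∑-cong p (λ {μ} _ → trans (∑-map (μ ·₁_) q _)
                                                             (∑-cong q (λ {ν} _ → act₁-· μ ν f n m))) ⟩
    ∑ p (λ μ → ∑ q (λ ν → act₁ μ (act₁ ν f) n m))         ≈⟨ ∑-cong p (λ {μ} _ → act₁-act μ q f n m) ⟨
    ∑ p (λ μ → act₁ μ (act q f) n m)                      ∎
    where open ≈-Reasoning setoid

  act-comm : ∀ p q f → act p (act q f) ≐ act q (act p f)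
  act-comm p q f n m = begin
    act p (act q f) n m                                   ≈⟨ ∑-cong p (λ {μ} _ → act₁-act μ q f n m) ⟩
    ∑ p (λ μ → ∑ q (λ ν → act₁ μ (act₁ ν f) n m))         ≈⟨ ∑-comm p q _ ⟩
    ∑ q (λ ν → ∑ p (λ μ → act₁ μ (act₁ ν f) n m))         ≈⟨ ∑-cong q (λ {ν} _ → ∑-cong p (λ {μ} _ → act₁-comm μ ν f n m)) ⟩
    ∑ q (λ ν → ∑ p (λ μ → act₁ ν (act₁ μ f) n m))         ≈⟨ ∑-cong q (λ {ν} _ → act₁-act ν p f n m) ⟨
    act q (act p f) n m                                   ∎
    where open ≈-Reasoning setoid

  neg₁ : Monomial → Monomial
  neg₁ (c x^ i y^ j) = (-ᶻ c) x^ i y^ j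

  act-neg : ∀ p f n m → act p f n m + act (List.map neg₁ p) f n m ≈ 0#
  act-neg []                    f n m = +-identityˡ 0#
  act-neg (μ@(c x^ i y^ j) ∷ p) f n m = begin
    (act₁ μ f n m + act p f n m) + (act₁ (neg₁ μ) f n m + act (List.map neg₁ p) f n m)
      ≈⟨ +-interchange (act₁ μ f n m) _ _ _ ⟩
    (act₁ μ f n m + act₁ (neg₁ μ) f n m) + (act p f n m + act (List.map neg₁ p) f n m)
      ≈⟨ +-cong cancel (act-neg p f n m) ⟩
    0# + 0#
      ≈⟨ +-identityˡ 0# ⟩
    0# ∎
    where
    open ≈-Reasoning setoid
    s = shift i n (λ a → shift j m (f a))
    cancel : act₁ μ f n m + act₁ (neg₁ μ) f n m ≈ 0#
    cancel = begin
      ι c * s + ι (-ᶻ c) * s     ≈⟨ distribʳ s (ι c) (ι (-ᶻ c)) ⟨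
      (ι c + ι (-ᶻ c)) * s       ≈⟨ *-congʳ (ι-neg c) ⟩
      0# * s                     ≈⟨ zeroˡ s ⟩
      0#                         ∎

  -- Constant terms and quotients

  δ₁ : ℕ → Carrier
  δ₁ zero    = 1#
  δ₁ (suc _) = 0#

  shift-same : ∀ n → shift n n δ₁ ≈ 1#
  shift-same zero    = refl
  shift-same (suc n) = shift-same n

  shift-different : ∀ {k n} → ¬ k ≡ n → shift k n δ₁ ≈ 0#
  shift-different {zero}  {zero}  k≢n = contradiction ≡.refl k≢n
  shift-different {zero}  {suc n} k≢n = refl
  shift-different {suc k} {zero}  k≢n = refl
  shift-different {suc k} {suc n} k≢n = shift-different (k≢n ∘ ≡.cong suc)

  -- The power series 1, so that `act p δ` is the polynomial `p` read as a series.
  δ : Series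
  δ n m = δ₁ n * δ₁ m

  constantTerm : Poly → Carrier
  constantTerm p = act p δ 0 0

  -- Only monomials of degree (0,0) reach the coefficient at (0,0). Hence constant terms are
  -- multiplicative, which keeps the left sides nonzero under elimination.
  act-00 : ∀ p f → act p f 0 0 ≈ constantTerm p * f 0 0
  act-00 p f = begin
    ∑ p (λ μ → act₁ μ f 0 0)                 ≈⟨ ∑-cong p (λ {μ} _ → monomial μ) ⟩
    ∑ p (λ μ → f 0 0 * act₁ μ δ 0 0)         ≈⟨ ∑-*ˡ p (f 0 0) (λ μ → act₁ μ δ 0 0) ⟨
    f 0 0 * constantTerm p                   ≈⟨ *-comm (f 0 0) _ ⟩
    constantTerm p * f 0 0                   ∎
    where
    open ≈-Reasoning setoid
    corner : ∀ i j (f : Series) → shift i 0 (λ a → shift j 0 (f a)) ≈ f 0 0 * shift i 0 (λ a → shift j 0 (δ a))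
    corner zero    zero    f = trans (sym (*-identityʳ (f 0 0))) (*-congˡ (sym (*-identityˡ 1#)))
    corner zero    (suc j) f = sym (zeroʳ (f 0 0))
    corner (suc i) j       f = sym (zeroʳ (f 0 0))
    monomial : ∀ μ → act₁ μ f 0 0 ≈ f 0 0 * act₁ μ δ 0 0
    monomial (c x^ i y^ j) = trans (*-congˡ (corner i j f)) (*-swap (ι c) (f 0 0) _)

  constantTerm-· : ∀ p q → constantTerm (p · q) ≈ constantTerm p * constantTerm q
  constantTerm-· p q = trans (act-· p q δ 0 0) (act-00 p (act q δ))

  constantTerm-++ : ∀ p q → constantTerm (p ++ q) ≈ constantTerm p + constantTerm q
  constantTerm-++ p q = act-++ p q δ 0 0

  nonzero-* : ∀ {a b} → ¬ a ≈ 0# → ¬ b ≈ 0# → ¬ a * b ≈ 0#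
  nonzero-* {a} {b} a≉0 b≉0 e = [ a≉0 , b≉0 ]′ (zero-product a b e)

  -- A nonzero constant term is a stronger demand on `Q` than `Q ≠ 0`, but one that is checked at a
  -- single coefficient and passes to products.
  Quotient : Series → Set
  Quotient T = Σ[ P ∈ Poly ] Σ[ Q ∈ Poly ] ¬ constantTerm Q ≈ 0# × act Q T ≐ act P δ

  -- Gaussian elimination

  module _ {S : Set} (G : S → Series) where

    -- The equation  lhs · T = inhomogeneity + Σₛ (rhs s) · G s
    record Equation : Set where
      constructor equation
      field
        lhs           : Poly
        inhomogeneity : Poly
        rhs           : S → Poly
        lhs-constant  : ¬ constantTerm lhs ≈ 0#
    open Equation

    rhs-value : List S → Equation → Series
    rhs-value ss E n m = act (inhomogeneity E) δ n m + ∑ ss (λ s → act (rhs E s) (G s) n m)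

    Satisfies : List S → Equation → Series → Set
    Satisfies ss E T = act (lhs E) T ≐ rhs-value ss E

    -- The only consequence of divisibility by y that enters: it is preserved by `eliminate` and
    -- gives a pivot the same constant term as its left side.
    NoConstant : Equation → Set
    NoConstant E = ∀ s → constantTerm (rhs E s) ≈ 0#

    -- Division-free Gaussian elimination of the unknown G s₀
    module Pivot (s₀ : S) (P : Equation) (P-noConstant : NoConstant P) where

      -- The pivot: the coefficient of `G s₀` after its term on the right of `P` has been moved to
      -- the left.
      D : Poly
      D = lhs P ++ List.map neg₁ (rhs P s₀)

      D-constant : constantTerm D ≈ constantTerm (lhs P)
      D-constant = begin
        constantTerm D                                               ≈⟨ constantTerm-++ (lhs P) N ⟩
        constantTerm (lhs P) + constantTerm N                        ≈⟨ +-congˡ (+-identityˡ _) ⟨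
        constantTerm (lhs P) + (0# + constantTerm N)                 ≈⟨ +-congˡ (+-congʳ (P-noConstant s₀)) ⟨
        constantTerm (lhs P) + (constantTerm (rhs P s₀) + constantTerm N)
          ≈⟨ +-congˡ (act-neg (rhs P s₀) δ 0 0) ⟩
        constantTerm (lhs P) + 0#                                    ≈⟨ +-identityʳ _ ⟩
        constantTerm (lhs P)                                         ∎
        where
        open ≈-Reasoning setoid
        N = List.map neg₁ (rhs P s₀)

      solve-pivot : ∀ {ss} → Satisfies (s₀ ∷ ss) P (G s₀) → act D (G s₀) ≐ rhs-value ss P
      solve-pivot {ss} sat n m = begin
        act D (G s₀) n m                            ≈⟨ act-++ (lhs P) N (G s₀) n m ⟩
        act (lhs P) (G s₀) n m + −p                 ≈⟨ +-congʳ (sat n m) ⟩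
        b + (p + r) + −p                            ≈⟨ +-congʳ (+-swap b p r) ⟩
        p + (b + r) + −p                            ≈⟨ +-congʳ (+-comm p (b + r)) ⟩
        (b + r) + p + −p                            ≈⟨ +-assoc (b + r) p −p ⟩
        (b + r) + (p + −p)                          ≈⟨ +-congˡ (act-neg (rhs P s₀) (G s₀) n m) ⟩
        (b + r) + 0#                                ≈⟨ +-identityʳ _ ⟩
        b + r                                       ∎
        where
        open ≈-Reasoning setoid
        N = List.map neg₁ (rhs P s₀)
        p = act (rhs P s₀) (G s₀) n m
        −p = act N (G s₀) n m
        b = act (inhomogeneity P) δ n m
        r = ∑ ss (λ s → act (rhs P s) (G s) n m)

      -- `E` is multiplied by `D`; then `D · G s₀` can be replaced by the remaining right side of
      -- `P`, which enters with the factor `rhs E s₀`.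
      eliminate : Equation → Equation
      eliminate E = record
        { lhs           = D · lhs E
        ; inhomogeneity = D · inhomogeneity E ++ rhs E s₀ · inhomogeneity P
        ; rhs           = λ s → D · rhs E s ++ rhs E s₀ · rhs P s
        ; lhs-constant  = λ e → nonzero-* (λ d → lhs-constant P (trans (sym D-constant) d)) (lhs-constant E)
                                  (trans (sym (constantTerm-· D (lhs E))) e)
        }

      eliminate-noConstant : ∀ E → NoConstant E → NoConstant (eliminate E)
      eliminate-noConstant E E-noConstant s = begin
        constantTerm (D · rhs E s ++ rhs E s₀ · rhs P s)
          ≈⟨ constantTerm-++ (D · rhs E s) _ ⟩
        constantTerm (D · rhs E s) + constantTerm (rhs E s₀ · rhs P s)
          ≈⟨ +-cong (constantTerm-· D (rhs E s)) (constantTerm-· (rhs E s₀) (rhs P s)) ⟩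
        constantTerm D * constantTerm (rhs E s) + constantTerm (rhs E s₀) * constantTerm (rhs P s)
          ≈⟨ +-cong (*-congˡ (E-noConstant s)) (*-congˡ (P-noConstant s)) ⟩
        constantTerm D * 0# + constantTerm (rhs E s₀) * 0#
          ≈⟨ +-cong (zeroʳ _) (zeroʳ _) ⟩
        0# + 0#
          ≈⟨ +-identityˡ 0# ⟩
        0# ∎
        where open ≈-Reasoning setoid

      act-rhs : ∀ p ss E → act p (rhs-value ss E) ≐ λ n m →
        act (p · inhomogeneity E) δ n m + ∑ ss (λ s → act (p · rhs E s) (G s) n m)
      act-rhs p ss E n m = begin
        act p (rhs-value ss E) n m
          ≈⟨ act-+ p (act (inhomogeneity E) δ) (λ n m → ∑ ss (λ s → act (rhs E s) (G s) n m)) n m ⟩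
        act p (act (inhomogeneity E) δ) n m + act p (λ n m → ∑ ss (λ s → act (rhs E s) (G s) n m)) n m
          ≈⟨ +-cong (sym (act-· p (inhomogeneity E) δ n m)) (trans (act-∑ p ss (λ s → act (rhs E s) (G s)) n m)
               (∑-cong ss (λ {s} _ → sym (act-· p (rhs E s) (G s) n m)))) ⟩
        act (p · inhomogeneity E) δ n m + ∑ ss (λ s → act (p · rhs E s) (G s) n m) ∎
        where open ≈-Reasoning setoid

      eliminate-satisfies : ∀ {ss} → Satisfies (s₀ ∷ ss) P (G s₀) →
        ∀ E {T} → Satisfies (s₀ ∷ ss) E T → Satisfies ss (eliminate E) T
      eliminate-satisfies {ss} satP E {T} satE n m = begin
        act (D · lhs E) T n m
          ≈⟨ act-· D (lhs E) T n m ⟩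
        act D (act (lhs E) T) n m
          ≈⟨ act-cong D satE n m ⟩
        act D (rhs-value (s₀ ∷ ss) E) n m
          ≈⟨ act-rhs D (s₀ ∷ ss) E n m ⟩
        b + (act (D · e) (G s₀) n m + r)
          ≈⟨ +-congˡ (+-congʳ pivot) ⟩
        b + ((b′ + r′) + r)
          ≈⟨ +-congˡ (+-assoc b′ r′ r) ⟩
        b + (b′ + (r′ + r))
          ≈⟨ +-assoc b b′ (r′ + r) ⟨
        (b + b′) + (r′ + r)
          ≈⟨ +-cong (sym (act-++ (D · inhomogeneity E) (e · inhomogeneity P) δ n m)) (+-comm r′ r) ⟩
        act (D · inhomogeneity E ++ e · inhomogeneity P) δ n m + (r + r′)
          ≈⟨ +-congˡ (∑-+ ss _ _) ⟨
        act (D · inhomogeneity E ++ e · inhomogeneity P) δ n m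
          + ∑ ss (λ s → act (D · rhs E s) (G s) n m + act (e · rhs P s) (G s) n m)
          ≈⟨ +-congˡ (∑-cong ss (λ {s} _ → sym (act-++ (D · rhs E s) (e · rhs P s) (G s) n m))) ⟩
        rhs-value ss (eliminate E) n m ∎
        where
        open ≈-Reasoning setoid
        e = rhs E s₀
        b = act (D · inhomogeneity E) δ n m
        r = ∑ ss (λ s → act (D · rhs E s) (G s) n m)
        b′ = act (e · inhomogeneity P) δ n m
        r′ = ∑ ss (λ s → act (e · rhs P s) (G s) n m)
        pivot : act (D · e) (G s₀) n m ≈ b′ + r′
        pivot = begin
          act (D · e) (G s₀) n m           ≈⟨ act-· D e (G s₀) n m ⟩
          act D (act e (G s₀)) n m         ≈⟨ act-comm D e (G s₀) n m ⟩
          act e (act D (G s₀)) n m         ≈⟨ act-cong e (solve-pivot {ss} satP) n m ⟩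
          act e (rhs-value ss P) n m       ≈⟨ act-rhs e ss P n m ⟩
          b′ + r′                          ∎

    -- The equation `E` for the target `T` is carried through every elimination. Once no unknown is
    -- left, it expresses `T` as a quotient.
    solve-system : ∀ ss (system : S → Equation) → (∀ s → NoConstant (system s)) →
      (∀ {s} → s ∈ ss → Satisfies ss (system s) (G s)) →
      ∀ E {T} → Satisfies ss E T → Quotient T
    solve-system []       system _ _   E satE = inhomogeneity E , lhs E , lhs-constant E ,
      λ n m → trans (satE n m) (+-identityʳ _)
    solve-system (s₀ ∷ ss) system noConstant sat E satE =
      solve-system ss (λ s → eliminate (system s)) (λ s → eliminate-noConstant (system s) (noConstant s))
        (λ {s} s∈ → eliminate-satisfies {ss} (sat (here ≡.refl)) (system s) (sat (there s∈)))
        (eliminate E) (eliminate-satisfies {ss} (sat (here ≡.refl)) E satE)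
      where open Pivot s₀ (system s₀) (noConstant s₀)

  -- The linear system of the generating functions
  --   G s = xᵏ⁽ˢ⁾ w s (final s + y Σₜ [next s t] G t).
  module TransferSystem {S : Set} (states : List S) (G : S → Series)
    (w : S → Carrier) (k : S → ℕ) (final : S → Bool) (next : S → S → Bool)
    (G-zero : ∀ {s} → s ∈ states → ∀ n → G s n 0 ≈ (if final s then w s * shift (k s) n δ₁ else 0#))
    (G-suc : ∀ {s} → s ∈ states → ∀ n d → G s n (suc d) ≈
      ∑ states (λ t → if next s t then w s * shift (k s) n (λ a → G t a d) else 0#))
    where

    open Equation

    -- Multiplication by the denominator of `w s` makes the coefficients polynomial. The exponent in
    -- `y^1` matches the passage from `d` to `suc d` in `G-suc`.
    transfer : S → Equation G
    transfer s = record
      { lhs           = (denᶻ (w s) x^ 0 y^ 0) ∷ []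
      ; inhomogeneity = if final s then (numᶻ (w s) x^ k s y^ 0) ∷ [] else []
      ; rhs           = λ t → if next s t then (numᶻ (w s) x^ k s y^ 1) ∷ [] else []
      ; lhs-constant  = λ e → den-nonzero (w s) (begin
          ι (denᶻ (w s))                     ≈⟨ *-identityʳ _ ⟨
          ι (denᶻ (w s)) * 1#                ≈⟨ *-congˡ (*-identityʳ 1#) ⟨
          ι (denᶻ (w s)) * (1# * 1#)         ≈⟨ +-identityʳ _ ⟨
          ι (denᶻ (w s)) * (1# * 1#) + 0#    ≈⟨ e ⟩
          0#                                 ∎)
      }
      where open ≈-Reasoning setoid

    transfer-noConstant : ∀ s → NoConstant G (transfer s)
    transfer-noConstant s t with next s t
    ... | false = refl
    ... | true  = trans (+-identityʳ _) (trans (*-congˡ (shift-0 (k s) 0)) (zeroʳ _))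

    clear-denominator : ∀ s z → ι (denᶻ (w s)) * (w s * z) ≈ ι (numᶻ (w s)) * z
    clear-denominator s z = trans (sym (*-assoc _ _ _)) (*-congʳ (ι-den (w s)))

    transfer-satisfies : ∀ {s} → s ∈ states → Satisfies G states (transfer s) (G s)
    transfer-satisfies {s} s∈ n m = trans (+-identityʳ _) (trans (lhs-value m)
      (sym (+-cong (b-value (final s) m) (∑-cong states λ {t} _ → r-value (next s t) m t))))
      where
      open ≈-Reasoning setoid
      D = ι (denᶻ (w s))
      N = ι (numᶻ (w s))
      b : Bool → ℕ → Carrier
      b c zero    = if c then N * shift (k s) n δ₁ else 0#
      b c (suc m) = 0#
      b-value : ∀ c m → act (if c then (numᶻ (w s) x^ k s y^ 0) ∷ [] else []) δ n m ≈ b c m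
      b-value false zero    = refl
      b-value false (suc m) = refl
      b-value true  zero    = trans (+-identityʳ _) (*-congˡ (shift-cong (k s) n λ a → *-identityʳ (δ₁ a)))
      b-value true  (suc m) = trans (+-identityʳ _)
        (trans (*-congˡ (trans (shift-cong (k s) n λ a → zeroʳ (δ₁ a)) (shift-0 (k s) n))) (zeroʳ N))
      r : Bool → ℕ → S → Carrier
      r c zero    t = 0#
      r c (suc m) t = if c then N * shift (k s) n (λ a → G t a m) else 0#
      r-value : ∀ c m t → act (if c then (numᶻ (w s) x^ k s y^ 1) ∷ [] else []) (G t) n m ≈ r c m t
      r-value false zero    t = refl
      r-value false (suc m) t = refl
      r-value true  zero    t = trans (+-identityʳ _) (trans (*-congˡ (shift-0 (k s) n)) (zeroʳ N))
      r-value true  (suc m) t = +-identityʳ _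
      lhs-value : ∀ m → D * G s n m ≈ b (final s) m + ∑ states (λ t → r (next s t) m t)
      lhs-value zero = begin
        D * G s n 0                                                  ≈⟨ *-congˡ (G-zero s∈ n) ⟩
        D * (if final s then w s * shift (k s) n δ₁ else 0#)         ≈⟨ if-* (final s) ⟩
        b (final s) 0                                                          ≈⟨ +-identityʳ _ ⟨
        b (final s) 0 + 0#                                                     ≈⟨ +-congˡ (∑-zero states (λ _ → refl)) ⟨
        b (final s) 0 + ∑ states (λ t → 0#)                                                    ∎
        where
        if-* : ∀ c → D * (if c then w s * shift (k s) n δ₁ else 0#) ≈ (if c then N * shift (k s) n δ₁ else 0#)
        if-* false = zeroʳ D
        if-* true  = clear-denominator s _
      lhs-value (suc m) = begin
        D * G s n (suc m)                                            ≈⟨ *-congˡ (G-suc s∈ n m) ⟩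
        D * ∑ states (λ t → if next s t then w s * g t else 0#)      ≈⟨ ∑-*ˡ states D _ ⟩
        ∑ states (λ t → D * (if next s t then w s * g t else 0#))    ≈⟨ ∑-cong states (λ {t} _ → if-* (next s t) (g t)) ⟩
        ∑ states (λ t → r (next s t) (suc m) t)                                                    ≈⟨ +-identityˡ _ ⟨
        0# + ∑ states (λ t → r (next s t) (suc m) t)                                               ∎
        where
        g : S → Carrier
        g t = shift (k s) n (λ a → G t a m)
        if-* : ∀ c z → D * (if c then w s * z else 0#) ≈ (if c then N * z else 0#)
        if-* false z = zeroʳ D
        if-* true  z = clear-denominator s z

    -- The sum is treated as one more equation with left side 1. Its right side does have constant
    -- terms, which is harmless because it never serves as a pivot.
    sum-quotient : ∀ (initial : S → Bool) {T} →
      (∀ n m → T n m ≈ ∑ states (λ s → if initial s then G s n m else 0#)) → Quotient T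
    sum-quotient initial {T} T≐ = solve-system G states transfer transfer-noConstant transfer-satisfies E satE
      where
      open ≈-Reasoning setoid
      one : Poly
      one = (1ᶻ x^ 0 y^ 0) ∷ []
      one-* : ∀ f n m → act one f n m ≈ f n m
      one-* f n m = trans (+-identityʳ _) (trans (*-congʳ ι-1) (*-identityˡ _))
      E : Equation G
      E = record
        { lhs           = one
        ; inhomogeneity = []
        ; rhs           = λ s → if initial s then one else []
        -- The constant term is 1. If 1 vanished in `K`, so would the denominator of `1#`.
        ; lhs-constant  = λ e → den-nonzero 1# (begin
            ι (denᶻ 1#)         ≈⟨ *-identityʳ _ ⟨
            ι (denᶻ 1#) * 1#    ≈⟨ *-congˡ (trans (sym (trans (one-* δ 0 0) (*-identityˡ 1#))) e) ⟩
            ι (denᶻ 1#) * 0#    ≈⟨ zeroʳ _ ⟩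
            0#                  ∎)
        }
      initial-value : ∀ s n m → act (rhs E s) (G s) n m ≈ (if initial s then G s n m else 0#)
      initial-value s n m with initial s
      ... | false = refl
      ... | true  = one-* (G s) n m
      satE : Satisfies G states E T
      satE n m = begin
        act one T n m                                            ≈⟨ one-* T n m ⟩
        T n m                                                    ≈⟨ T≐ n m ⟩
        ∑ states (λ s → if initial s then G s n m else 0#)       ≈⟨ ∑-cong states (λ {s} _ → sym (initial-value s n m)) ⟩
        ∑ states (λ s → act (rhs E s) (G s) n m)                 ≈⟨ +-identityˡ _ ⟨
        rhs-value G states E n m                                 ∎

  -- From operators back to products of series and nested coefficient lists

  infixl 7 _⊛_
  _⊛_ : Series → Series → Series
  (f ⊛ g) n m = ∑ (upTo (suc n)) (λ i → ∑ (upTo (suc m)) (λ j → f i j * g (n ∸ i) (m ∸ j)))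

  convolve-monomial : ∀ i n (g : ℕ → Carrier) → ∑ (upTo (suc n)) (λ a → shift i a δ₁ * g (n ∸ a)) ≈ shift i n g
  convolve-monomial zero    n       g = begin
    ∑ (upTo (suc n)) (λ a → δ₁ a * g (n ∸ a))                   ≈⟨ ∑-upTo-suc n _ ⟩
    1# * g n + ∑ (upTo n) (λ a → 0# * g (n ∸ suc a))            ≈⟨ +-cong (*-identityˡ (g n)) (∑-zero (upTo n) (λ a → zeroˡ _)) ⟩
    g n + 0#                                                    ≈⟨ +-identityʳ (g n) ⟩
    g n                                                         ∎
    where open ≈-Reasoning setoid
  convolve-monomial (suc i) zero    g = trans (+-identityʳ _) (zeroˡ (g 0))
  convolve-monomial (suc i) (suc n) g = begin
    ∑ (upTo (2 ℕ.+ n)) (λ a → shift (suc i) a δ₁ * g (suc n ∸ a))                  ≈⟨ ∑-upTo-suc (suc n) _ ⟩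
    0# * g (suc n) + ∑ (upTo (suc n)) (λ a → shift i a δ₁ * g (n ∸ a))             ≈⟨ +-cong (zeroˡ _) (convolve-monomial i n g) ⟩
    0# + shift i n g                                                               ≈⟨ +-identityˡ _ ⟩
    shift i n g                                                                    ∎
    where open ≈-Reasoning setoid

  shift-δ : ∀ i j n m → shift i n (λ a → shift j m (δ a)) ≈ shift i n δ₁ * shift j m δ₁
  shift-δ i j n m = begin
    shift i n (λ a → shift j m (δ a))             ≈⟨ shift-cong i n (λ a → trans (shift-*ˡ j m (δ₁ a) δ₁) (*-comm _ _)) ⟩
    shift i n (λ a → shift j m δ₁ * δ₁ a)         ≈⟨ shift-*ˡ i n (shift j m δ₁) δ₁ ⟩
    shift j m δ₁ * shift i n δ₁                   ≈⟨ *-comm _ _ ⟩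
    shift i n δ₁ * shift j m δ₁                   ∎
    where open ≈-Reasoning setoid

  act₁-⊛ : ∀ μ f → act₁ μ δ ⊛ f ≐ act₁ μ f
  act₁-⊛ (c x^ i y^ j) f n m = begin
    ∑ (upTo (suc n)) (λ a → ∑ (upTo (suc m)) (λ b → ι c * shift i a (λ a → shift j b (δ a)) * f (n ∸ a) (m ∸ b)))
      ≈⟨ ∑-cong (upTo (suc n)) (λ {a} _ → ∑-cong (upTo (suc m)) (λ {b} _ → factor a b)) ⟩
    ∑ (upTo (suc n)) (λ a → ∑ (upTo (suc m)) (λ b → ι c * shift i a δ₁ * (shift j b δ₁ * f (n ∸ a) (m ∸ b))))
      ≈⟨ ∑-cong (upTo (suc n)) (λ {a} _ → ∑-*ˡ (upTo (suc m)) (ι c * shift i a δ₁) _) ⟨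
    ∑ (upTo (suc n)) (λ a → ι c * shift i a δ₁ * ∑ (upTo (suc m)) (λ b → shift j b δ₁ * f (n ∸ a) (m ∸ b)))
      ≈⟨ ∑-cong (upTo (suc n)) (λ {a} _ → trans (*-congˡ (convolve-monomial j m (f (n ∸ a)))) (*-assoc _ _ _)) ⟩
    ∑ (upTo (suc n)) (λ a → ι c * (shift i a δ₁ * shift j m (f (n ∸ a))))
      ≈⟨ ∑-*ˡ (upTo (suc n)) (ι c) _ ⟨
    ι c * ∑ (upTo (suc n)) (λ a → shift i a δ₁ * shift j m (f (n ∸ a)))
      ≈⟨ *-congˡ (convolve-monomial i n (λ a → shift j m (f a))) ⟩
    ι c * shift i n (λ a → shift j m (f a)) ∎
    where
    open ≈-Reasoning setoid
    factor : ∀ a b → ι c * shift i a (λ a → shift j b (δ a)) * f (n ∸ a) (m ∸ b) ≈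
                     ι c * shift i a δ₁ * (shift j b δ₁ * f (n ∸ a) (m ∸ b))
    factor a b = begin
      ι c * shift i a (λ a → shift j b (δ a)) * f (n ∸ a) (m ∸ b)          ≈⟨ *-congʳ (*-congˡ (shift-δ i j a b)) ⟩
      ι c * (shift i a δ₁ * shift j b δ₁) * f (n ∸ a) (m ∸ b)              ≈⟨ *-congʳ (*-assoc _ _ _) ⟨
      ι c * shift i a δ₁ * shift j b δ₁ * f (n ∸ a) (m ∸ b)                ≈⟨ *-assoc _ _ _ ⟩
      ι c * shift i a δ₁ * (shift j b δ₁ * f (n ∸ a) (m ∸ b))              ∎

  ⊛-cong : ∀ {f g} h → f ≐ g → f ⊛ h ≐ g ⊛ h
  ⊛-cong h e n m = ∑-cong (upTo (suc n)) (λ {i} _ → ∑-cong (upTo (suc m)) (λ {j} _ → *-congʳ (e i j)))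

  ⊛-distribʳ : ∀ f g h → (λ n m → f n m + g n m) ⊛ h ≐ λ n m → (f ⊛ h) n m + (g ⊛ h) n m
  ⊛-distribʳ f g h n m = trans
    (∑-cong (upTo (suc n)) (λ {i} _ → trans
      (∑-cong (upTo (suc m)) (λ {j} _ → distribʳ (h (n ∸ i) (m ∸ j)) (f i j) (g i j)))
      (∑-+ (upTo (suc m)) _ _)))
    (∑-+ (upTo (suc n)) _ _)

  -- Links the operators to the product in the definition of rationality. By additivity only
  -- monomials have to be compared, for which the convolution collapses to a shift.
  act-⊛ : ∀ p f → act p δ ⊛ f ≐ act p f
  act-⊛ []      f n m = ∑-zero (upTo (suc n)) (λ i → ∑-zero (upTo (suc m)) (λ j → zeroˡ _))
  act-⊛ (μ ∷ p) f n m = trans (⊛-distribʳ (act₁ μ δ) (act p δ) f n m) (+-cong (act₁-⊛ μ f n m) (act-⊛ p f n m))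

  add : {A : Set} → (A → A → A) → List A → List A → List A
  add _⊕_ []       bs       = bs
  add _⊕_ (a ∷ as) []       = a ∷ as
  add _⊕_ (a ∷ as) (b ∷ bs) = (a ⊕ b) ∷ add _⊕_ as bs

  coeff-add : ∀ {A : Set} (_⊕_ : A → A → A) (e : A) → (∀ a → e ⊕ a ≡ a) → (∀ a → a ⊕ e ≡ a) →
    ∀ as bs k → coeff e (add _⊕_ as bs) k ≡ coeff e as k ⊕ coeff e bs k
  coeff-add _⊕_ e idˡ idʳ []       bs       k       = ≡.sym (idˡ (coeff e bs k))
  coeff-add _⊕_ e idˡ idʳ (a ∷ as) []       k       = ≡.sym (idʳ (coeff e (a ∷ as) k))
  coeff-add _⊕_ e idˡ idʳ (a ∷ as) (b ∷ bs) zero    = ≡.refl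
  coeff-add _⊕_ e idˡ idʳ (a ∷ as) (b ∷ bs) (suc k) = coeff-add _⊕_ e idˡ idʳ as bs k

  add-identityʳ : ∀ {A : Set} (_⊕_ : A → A → A) as → add _⊕_ as [] ≡ as
  add-identityʳ _⊕_ []       = ≡.refl
  add-identityʳ _⊕_ (a ∷ as) = ≡.refl

  nested₁ : Monomial → List (List Z)
  nested₁ (c x^ i y^ j) = replicate i [] ++ (replicate j 0ᶻ ++ c ∷ []) ∷ []

  nested : Poly → List (List Z)
  nested = List.foldr (λ μ → add (add _+ᶻ_) (nested₁ μ)) []

  entry : List (List Z) → Series
  entry P n m = ι (coeff 0ᶻ (coeff [] P n) m)

  entry-nested₁ : ∀ μ → entry (nested₁ μ) ≐ act₁ μ δ
  entry-nested₁ (c x^ i y^ j) n m = trans (x-part i n m) (*-congˡ (sym (shift-δ i j n m)))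
    where
    y-part : ∀ j m → ι (coeff 0ᶻ (replicate j 0ᶻ ++ c ∷ []) m) ≈ ι c * shift j m δ₁
    y-part zero    zero    = sym (*-identityʳ (ι c))
    y-part zero    (suc m) = trans ι-0 (sym (zeroʳ (ι c)))
    y-part (suc j) zero    = trans ι-0 (sym (zeroʳ (ι c)))
    y-part (suc j) (suc m) = y-part j m
    vanishing : ∀ m → ι (coeff 0ᶻ [] m) ≈ ι c * (0# * shift j m δ₁)
    vanishing m = trans ι-0 (sym (trans (*-congˡ (zeroˡ _)) (zeroʳ (ι c))))
    x-part : ∀ i n m → entry (nested₁ (c x^ i y^ j)) n m ≈ ι c * (shift i n δ₁ * shift j m δ₁)
    x-part zero    zero    m = trans (y-part j m) (*-congˡ (sym (*-identityˡ _)))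
    x-part zero    (suc n) m = vanishing m
    x-part (suc i) zero    m = vanishing m
    x-part (suc i) (suc n) m = x-part i n m

  entry-nested : ∀ p → entry (nested p) ≐ act p δ
  entry-nested []      n m = ι-0
  entry-nested (μ ∷ p) n m = begin
    ι (coeff 0ᶻ (coeff [] (add (add _+ᶻ_) (nested₁ μ) (nested p)) n) m)
      ≡⟨ ≡.cong (λ q → ι (coeff 0ᶻ q m))
           (coeff-add (add _+ᶻ_) [] (λ _ → ≡.refl) (add-identityʳ _+ᶻ_) (nested₁ μ) (nested p) n) ⟩
    ι (coeff 0ᶻ (add _+ᶻ_ (coeff [] (nested₁ μ) n) (coeff [] (nested p) n)) m)
      ≡⟨ ≡.cong ι (coeff-add _+ᶻ_ 0ᶻ +ᶻ-identityˡ +ᶻ-identityʳ (coeff [] (nested₁ μ) n) (coeff [] (nested p) n) m) ⟩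
    ι (coeff 0ᶻ (coeff [] (nested₁ μ) n) m +ᶻ coeff 0ᶻ (coeff [] (nested p) n) m)
      ≈⟨ ι-+ _ _ ⟩
    entry (nested₁ μ) n m + entry (nested p) n m
      ≈⟨ +-cong (entry-nested₁ μ n m) (entry-nested p n m) ⟩
    act₁ μ δ n m + act p δ n m ∎
    where open ≈-Reasoning setoid

  Rational : Series → Set
  Rational f = Σ[ P ∈ List (List Z) ] Σ[ Q ∈ List (List Z) ]
    ¬ (∀ i j → entry Q i j ≈ 0#) × entry Q ⊛ f ≐ entry P

  quotient⇒rational : ∀ {f} → Quotient f → Rational f
  quotient⇒rational {f} (P , Q , Q-constant , e) = nested P , nested Q ,
    (λ Q≈0 → Q-constant (trans (sym (entry-nested Q 0 0)) (Q≈0 0 0))) ,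
    λ n m → begin
      (entry (nested Q) ⊛ f) n m     ≈⟨ ⊛-cong f (entry-nested Q) n m ⟩
      (act Q δ ⊛ f) n m              ≈⟨ act-⊛ Q f n m ⟩
      act Q f n m                    ≈⟨ e n m ⟩
      act P δ n m                    ≈⟨ entry-nested P n m ⟨
      entry (nested P) n m           ∎
    where open ≈-Reasoning setoid

open import Defs
import Data.Bool.Properties as Bool
open import Data.Fin using (Fin; fromℕ)
open import Data.Integer as ℤ using (ℤ; 0ℤ; 1ℤ) renaming (-_ to neg)
import Data.Integer.Properties as ℤ
import Data.List.Membership.DecPropositional as DecMember
open import Data.List.Membership.Propositional.Properties
open import Data.List.Membership.Propositional.Properties.WithK using (unique∧set⇒bag)
open import Data.List.Relation.Binary.BagAndSetEquality using (∼bag⇒↭)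
open import Data.List.Relation.Unary.All as All using (All; []; _∷_)
import Data.List.Relation.Unary.All.Properties as All
open import Data.List.Relation.Unary.AllPairs using ([]; _∷_)
open import Data.List.Relation.Unary.Unique.DecPropositional using (unique?)
open import Data.List.Relation.Unary.Unique.Propositional using (Unique)
import Data.List.Relation.Unary.Unique.Propositional.Properties as Unique
open import Data.Unit using (⊤; tt)
open import Data.Vec as Vec using (Vec; []; _∷_; foldr₁; fromList; head; last; toList)
import Data.Vec.Membership.Propositional as Vec
import Data.Vec.Membership.Propositional.Properties as Vec
import Data.Vec.Properties as Vec
import Data.Vec.Relation.Unary.All.Properties as VecAll
import Data.Vec.Relation.Unary.AllPairs as VecAllPairs
open import Data.Vec.Relation.Unary.Linked using (Linked; [-]; _∷_)
import Data.Vec.Relation.Unary.Unique.Propositional as Vec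
open import Relation.Binary.Bundles using (Setoid)
open import Relation.Binary.PropositionalEquality hiding (_≗_; [_]; setoid)
open import Relation.Nullary.Decidable using (map′)

private variable
  A B   : Set
  h m n : ℕ

-- The ring ℤ[C]

coeff-map : ∀ (f : ℤ → ℤ) → f 0ℤ ≡ 0ℤ → ∀ q k → coeff 0ℤ (List.map f q) k ≡ f (coeff 0ℤ q k)
coeff-map f f0 []      k       = sym f0
coeff-map f f0 (b ∷ q) zero    = refl
coeff-map f f0 (b ∷ q) (suc k) = coeff-map f f0 q k

-- A wrapper around _≈_, which unfolds to a family of equations from which the
-- polynomials cannot be inferred.
infix 4 _≋_
record _≋_ (p q : ℤ[C]) : Set where
  constructor mk≋
  field coeffwise : p ≈ q
open _≋_ public

ℤ[C]-setoid : Setoid 0ℓ 0ℓ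
ℤ[C]-setoid = record
  { _≈_           = _≋_
  ; isEquivalence = record
    { refl  = mk≋ λ _ → refl
    ; sym   = λ e → mk≋ λ k → sym (coeffwise e k)
    ; trans = λ e f → mk≋ λ k → trans (coeffwise e k) (coeffwise f k)
    }
  }

open Setoid ℤ[C]-setoid using () renaming (refl to ≋-refl; sym to ≋-sym; trans to ≋-trans)

scale : ℤ → ℤ[C] → ℤ[C]
scale a = List.map (a ℤ.*_)

coeff-scale : ∀ a q k → coeff 0ℤ (scale a q) k ≡ a ℤ.* coeff 0ℤ q k
coeff-scale a = coeff-map (a ℤ.*_) (ℤ.*-zeroʳ a)

-ₚ_ : ℤ[C] → ℤ[C]
-ₚ_ = List.map neg

+ₚ-cong : ∀ {p p′ q q′} → p ≋ p′ → q ≋ q′ → p +ₚ q ≋ p′ +ₚ q′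
coeffwise (+ₚ-cong {p} {p′} {q} {q′} e f) k = begin
  coeff 0ℤ (p +ₚ q) k                  ≡⟨ coeff-+ₚ p q k ⟩
  coeff 0ℤ p k ℤ.+ coeff 0ℤ q k        ≡⟨ cong₂ ℤ._+_ (coeffwise e k) (coeffwise f k) ⟩
  coeff 0ℤ p′ k ℤ.+ coeff 0ℤ q′ k      ≡⟨ coeff-+ₚ p′ q′ k ⟨
  coeff 0ℤ (p′ +ₚ q′) k                ∎
  where open ≡-Reasoning

+ₚ-comm : ∀ p q → p +ₚ q ≋ q +ₚ p
coeffwise (+ₚ-comm p q) k = begin
  coeff 0ℤ (p +ₚ q) k                  ≡⟨ coeff-+ₚ p q k ⟩
  coeff 0ℤ p k ℤ.+ coeff 0ℤ q k        ≡⟨ ℤ.+-comm (coeff 0ℤ p k) _ ⟩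
  coeff 0ℤ q k ℤ.+ coeff 0ℤ p k        ≡⟨ coeff-+ₚ q p k ⟨
  coeff 0ℤ (q +ₚ p) k                  ∎
  where open ≡-Reasoning

+ₚ-assoc : ∀ p q r → (p +ₚ q) +ₚ r ≋ p +ₚ (q +ₚ r)
coeffwise (+ₚ-assoc p q r) k = begin
  coeff 0ℤ (p +ₚ q +ₚ r) k                             ≡⟨ coeff-+ₚ (p +ₚ q) r k ⟩
  coeff 0ℤ (p +ₚ q) k ℤ.+ coeff 0ℤ r k                 ≡⟨ cong (ℤ._+ coeff 0ℤ r k) (coeff-+ₚ p q k) ⟩
  coeff 0ℤ p k ℤ.+ coeff 0ℤ q k ℤ.+ coeff 0ℤ r k       ≡⟨ ℤ.+-assoc (coeff 0ℤ p k) _ _ ⟩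
  coeff 0ℤ p k ℤ.+ (coeff 0ℤ q k ℤ.+ coeff 0ℤ r k)     ≡⟨ cong (ℤ._+_ (coeff 0ℤ p k)) (coeff-+ₚ q r k) ⟨
  coeff 0ℤ p k ℤ.+ coeff 0ℤ (q +ₚ r) k                 ≡⟨ coeff-+ₚ p (q +ₚ r) k ⟨
  coeff 0ℤ (p +ₚ (q +ₚ r)) k                           ∎
  where open ≡-Reasoning

+ₚ-identityʳ : ∀ p → p +ₚ 0ₚ ≡ p
+ₚ-identityʳ []      = refl
+ₚ-identityʳ (a ∷ p) = refl

-ₚ-inverseˡ : ∀ p → (-ₚ p) +ₚ p ≋ 0ₚ
coeffwise (-ₚ-inverseˡ p) k = begin
  coeff 0ℤ ((-ₚ p) +ₚ p) k                   ≡⟨ coeff-+ₚ (-ₚ p) p k ⟩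
  coeff 0ℤ (-ₚ p) k ℤ.+ coeff 0ℤ p k         ≡⟨ cong (ℤ._+ coeff 0ℤ p k) (coeff-map neg refl p k) ⟩
  neg (coeff 0ℤ p k) ℤ.+ coeff 0ℤ p k          ≡⟨ ℤ.+-inverseˡ (coeff 0ℤ p k) ⟩
  0ℤ                                         ∎
  where open ≡-Reasoning

-ₚ-cong : ∀ {p q} → p ≋ q → -ₚ p ≋ -ₚ q
coeffwise (-ₚ-cong {p} {q} e) k =
  trans (coeff-map neg refl p k) (trans (cong neg (coeffwise e k)) (sym (coeff-map neg refl q k)))

∷-cong : ∀ {a b p q} → a ≡ b → p ≋ q → a ∷ p ≋ b ∷ q
coeffwise (∷-cong a≡b p≋q) zero    = a≡b
coeffwise (∷-cong a≡b p≋q) (suc k) = coeffwise p≋q k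

scale-cong : ∀ {a b p q} → a ≡ b → p ≋ q → scale a p ≋ scale b q
coeffwise (scale-cong {a} {b} {p} {q} a≡b e) k =
  trans (coeff-scale a p k) (trans (cong₂ ℤ._*_ a≡b (coeffwise e k)) (sym (coeff-scale b q k)))

scale-+ₚ : ∀ a p q → scale a (p +ₚ q) ≋ scale a p +ₚ scale a q
coeffwise (scale-+ₚ a p q) k = begin
  coeff 0ℤ (scale a (p +ₚ q)) k                         ≡⟨ coeff-scale a (p +ₚ q) k ⟩
  a ℤ.* coeff 0ℤ (p +ₚ q) k                             ≡⟨ cong (a ℤ.*_) (coeff-+ₚ p q k) ⟩
  a ℤ.* (coeff 0ℤ p k ℤ.+ coeff 0ℤ q k)                 ≡⟨ ℤ.*-distribˡ-+ a (coeff 0ℤ p k) _ ⟩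
  a ℤ.* coeff 0ℤ p k ℤ.+ a ℤ.* coeff 0ℤ q k             ≡⟨ cong₂ ℤ._+_ (coeff-scale a p k) (coeff-scale a q k) ⟨
  coeff 0ℤ (scale a p) k ℤ.+ coeff 0ℤ (scale a q) k     ≡⟨ coeff-+ₚ (scale a p) (scale a q) k ⟨
  coeff 0ℤ (scale a p +ₚ scale a q) k                   ∎
  where open ≡-Reasoning

scale-scale : ∀ a b p → scale (a ℤ.* b) p ≋ scale a (scale b p)
coeffwise (scale-scale a b p) k = begin
  coeff 0ℤ (scale (a ℤ.* b) p) k     ≡⟨ coeff-scale (a ℤ.* b) p k ⟩
  a ℤ.* b ℤ.* coeff 0ℤ p k           ≡⟨ ℤ.*-assoc a b _ ⟩
  a ℤ.* (b ℤ.* coeff 0ℤ p k)         ≡⟨ cong (a ℤ.*_) (coeff-scale b p k) ⟨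
  a ℤ.* coeff 0ℤ (scale b p) k       ≡⟨ coeff-scale a (scale b p) k ⟨
  coeff 0ℤ (scale a (scale b p)) k   ∎
  where open ≡-Reasoning

+ₚ-commutativeMonoid : CommutativeMonoid 0ℓ 0ℓ
+ₚ-commutativeMonoid = record
  { Carrier = ℤ[C]
  ; _≈_     = _≋_
  ; _∙_     = _+ₚ_
  ; ε       = 0ₚ
  ; isCommutativeMonoid = record
    { isMonoid = record
      { isSemigroup = record
        { isMagma = record { isEquivalence = Setoid.isEquivalence ℤ[C]-setoid ; ∙-cong = +ₚ-cong }
        ; assoc   = +ₚ-assoc
        }
      ; identity = (λ p → ≋-refl) , λ p → mk≋ λ k → cong (λ q → coeff 0ℤ q k) (+ₚ-identityʳ p)
      }
    ; comm = +ₚ-comm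
    }
  }

open import Algebra.Properties.CommutativeSemigroup
  (CommutativeMonoid.commutativeSemigroup +ₚ-commutativeMonoid) using ()
  renaming (interchange to +ₚ-interchange; x∙yz≈y∙xz to +ₚ-swap)

*ₚ-congʳ : ∀ p {q q′} → q ≋ q′ → p *ₚ q ≋ p *ₚ q′
*ₚ-congʳ []      e = ≋-refl
*ₚ-congʳ (a ∷ p) e = +ₚ-cong (scale-cong {a} refl e) (∷-cong refl (*ₚ-congʳ p e))

*ₚ-zeroʳ : ∀ p → p *ₚ [] ≋ []
*ₚ-zeroʳ []      = ≋-refl
*ₚ-zeroʳ (a ∷ p) = mk≋ (0∷≈0 (coeffwise (*ₚ-zeroʳ p)))

-- The mirror image of the defining clause of `*ₚ`, which recurses on the left factor; it carries
-- the induction for commutativity.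
*ₚ-∷ : ∀ p b q → p *ₚ (b ∷ q) ≋ scale b p +ₚ (0ℤ ∷ (p *ₚ q))
*ₚ-∷ []      b q = mk≋ λ { zero → refl ; (suc k) → refl }
*ₚ-∷ (a ∷ p) b q = ∷-cong (cong (ℤ._+ 0ℤ) (ℤ.*-comm a b)) (begin
  scale a q +ₚ p *ₚ (b ∷ q)                      ≈⟨ +ₚ-cong ≋-refl (*ₚ-∷ p b q) ⟩
  scale a q +ₚ (scale b p +ₚ (0ℤ ∷ (p *ₚ q)))    ≈⟨ +ₚ-swap (scale a q) (scale b p) _ ⟩
  scale b p +ₚ (scale a q +ₚ (0ℤ ∷ (p *ₚ q)))    ∎)
  where open ≈-Reasoning ℤ[C]-setoid

*ₚ-comm : ∀ p q → p *ₚ q ≋ q *ₚ p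
*ₚ-comm []      q = ≋-sym (*ₚ-zeroʳ q)
*ₚ-comm (a ∷ p) q = ≋-sym (≋-trans (*ₚ-∷ q a p) (+ₚ-cong ≋-refl (∷-cong refl (*ₚ-comm q p))))

-- Equal left factors may be lists of different lengths, which obstructs a parallel recursion.
-- Commutativity moves them to the right, where `*ₚ-congʳ` recurses on the other factor.
*ₚ-cong : ∀ {p p′ q q′} → p ≋ p′ → q ≋ q′ → p *ₚ q ≋ p′ *ₚ q′
*ₚ-cong {p} {p′} {q} {q′} e f = begin
  p *ₚ q      ≈⟨ *ₚ-congʳ p f ⟩
  p *ₚ q′     ≈⟨ *ₚ-comm p q′ ⟩
  q′ *ₚ p     ≈⟨ *ₚ-congʳ q′ e ⟩
  q′ *ₚ p′    ≈⟨ *ₚ-comm q′ p′ ⟩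
  p′ *ₚ q′    ∎
  where open ≈-Reasoning ℤ[C]-setoid

*ₚ-distribˡ : ∀ p q r → p *ₚ (q +ₚ r) ≋ p *ₚ q +ₚ p *ₚ r
*ₚ-distribˡ []      q r = ≋-refl
*ₚ-distribˡ (a ∷ p) q r = begin
  scale a (q +ₚ r) +ₚ (0ℤ ∷ (p *ₚ (q +ₚ r)))
    ≈⟨ +ₚ-cong (scale-+ₚ a q r) (∷-cong refl (*ₚ-distribˡ p q r)) ⟩
  (scale a q +ₚ scale a r) +ₚ ((0ℤ ∷ (p *ₚ q)) +ₚ (0ℤ ∷ (p *ₚ r)))         ≈⟨ +ₚ-interchange (scale a q) (scale a r) _ _ ⟩
  (scale a q +ₚ (0ℤ ∷ (p *ₚ q))) +ₚ (scale a r +ₚ (0ℤ ∷ (p *ₚ r)))         ∎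
  where open ≈-Reasoning ℤ[C]-setoid

*ₚ-distribʳ : ∀ r p q → (p +ₚ q) *ₚ r ≋ p *ₚ r +ₚ q *ₚ r
*ₚ-distribʳ r p q = begin
  (p +ₚ q) *ₚ r         ≈⟨ *ₚ-comm (p +ₚ q) r ⟩
  r *ₚ (p +ₚ q)         ≈⟨ *ₚ-distribˡ r p q ⟩
  r *ₚ p +ₚ r *ₚ q      ≈⟨ +ₚ-cong (*ₚ-comm r p) (*ₚ-comm r q) ⟩
  p *ₚ r +ₚ q *ₚ r      ∎
  where open ≈-Reasoning ℤ[C]-setoid

scale-*ₚ : ∀ a p q → scale a p *ₚ q ≋ scale a (p *ₚ q)
scale-*ₚ a []      q = ≋-refl
scale-*ₚ a (b ∷ p) q = begin
  scale (a ℤ.* b) q +ₚ (0ℤ ∷ (scale a p *ₚ q))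
    ≈⟨ +ₚ-cong (scale-scale a b q) (∷-cong (sym (ℤ.*-zeroʳ a)) (scale-*ₚ a p q)) ⟩
  scale a (scale b q) +ₚ scale a (0ℤ ∷ (p *ₚ q))         ≈⟨ scale-+ₚ a (scale b q) _ ⟨
  scale a (scale b q +ₚ (0ℤ ∷ (p *ₚ q)))                 ∎
  where open ≈-Reasoning ℤ[C]-setoid

0∷-*ₚ : ∀ p q → (0ℤ ∷ p) *ₚ q ≋ 0ℤ ∷ (p *ₚ q)
0∷-*ₚ p q = +ₚ-cong {p′ = []} {q = 0ℤ ∷ (p *ₚ q)} (mk≋ (coeff-map0 q)) ≋-refl

*ₚ-assoc : ∀ p q r → (p *ₚ q) *ₚ r ≋ p *ₚ (q *ₚ r)
*ₚ-assoc []      q r = ≋-refl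
*ₚ-assoc (a ∷ p) q r = begin
  (scale a q +ₚ (0ℤ ∷ (p *ₚ q))) *ₚ r            ≈⟨ *ₚ-distribʳ r (scale a q) _ ⟩
  scale a q *ₚ r +ₚ (0ℤ ∷ (p *ₚ q)) *ₚ r
    ≈⟨ +ₚ-cong (scale-*ₚ a q r) (≋-trans (0∷-*ₚ (p *ₚ q) r) (∷-cong refl (*ₚ-assoc p q r))) ⟩
  scale a (q *ₚ r) +ₚ (0ℤ ∷ (p *ₚ (q *ₚ r)))     ∎
  where open ≈-Reasoning ℤ[C]-setoid

*ₚ-identityˡ : ∀ p → 1ₚ *ₚ p ≋ p
*ₚ-identityˡ p = begin
  scale 1ℤ p +ₚ (0ℤ ∷ [])
    ≈⟨ +ₚ-cong {p′ = p} {q = 0ℤ ∷ []} {q′ = []}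
         (mk≋ λ k → trans (coeff-scale 1ℤ p k) (ℤ.*-identityˡ _)) (mk≋ (0∷≈0 (λ _ → refl))) ⟩
  p +ₚ []                   ≡⟨ +ₚ-identityʳ p ⟩
  p                         ∎
  where open ≈-Reasoning ℤ[C]-setoid

ℤ[C]-commutativeRing : CommutativeRing 0ℓ 0ℓ
ℤ[C]-commutativeRing = record
  { Carrier = ℤ[C]
  ; _≈_     = _≋_
  ; _+_     = _+ₚ_
  ; _*_     = _*ₚ_
  ; -_      = -ₚ_
  ; 0#      = 0ₚ
  ; 1#      = 1ₚ
  ; isCommutativeRing = record
    { isRing = record
      { +-isAbelianGroup = record
        { isGroup = record
          { isMonoid = CommutativeMonoid.isMonoid +ₚ-commutativeMonoid
          ; inverse  = -ₚ-inverseˡ , λ p → ≋-trans (+ₚ-comm p (-ₚ p)) (-ₚ-inverseˡ p)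
          ; ⁻¹-cong  = -ₚ-cong
          }
        ; comm = +ₚ-comm
        }
      ; *-cong     = *ₚ-cong
      ; *-assoc    = *ₚ-assoc
      ; *-identity = *ₚ-identityˡ , λ p → ≋-trans (*ₚ-comm p 1ₚ) (*ₚ-identityˡ p)
      ; distrib    = *ₚ-distribˡ , *ₚ-distribʳ
      }
    ; *-comm = *ₚ-comm
    }
  }

-- The field of fractions of ℤ[C]

open FractionIdentities ℤ[C]-commutativeRing
module ℤC = CommutativeRing ℤ[C]-commutativeRing

*ₚ-cancelʳ : ∀ p q r → ¬ r ≈ 0ₚ → p *ₚ r ≋ q *ₚ r → p ≋ q
*ₚ-cancelʳ p q r r≉0 e = [ mk≋-0 , (λ r≈0 → contradiction r≈0 r≉0) ]′
  (*ₚ-zero-product (p +ₚ (-ₚ q)) r (coeffwise (begin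
    (p +ₚ (-ₚ q)) *ₚ r             ≈⟨ cancel-left p q r ⟩
    p *ₚ r +ₚ (-ₚ (q *ₚ r))        ≈⟨ ℤC.+-congʳ e ⟩
    q *ₚ r +ₚ (-ₚ (q *ₚ r))        ≈⟨ ℤC.-‿inverseʳ (q *ₚ r) ⟩
    0ₚ                             ∎)))
  where
  open ≈-Reasoning ℤ[C]-setoid
  mk≋-0 : p +ₚ (-ₚ q) ≈ 0ₚ → p ≋ q
  mk≋-0 e = begin
    p                      ≈⟨ add-back p q ⟩
    p +ₚ (-ₚ q) +ₚ q       ≈⟨ ℤC.+-congʳ {q} {p +ₚ (-ₚ q)} {0ₚ} (mk≋ e) ⟩
    0ₚ +ₚ q                ∎

infix 4 _≗_
record _≗_ (r s : ℚ⟨C⟩) : Set where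
  constructor mk≗
  field crossMultiplied : num r *ₚ den s ≋ num s *ₚ den r
open _≗_ public

≗⇒≃ : ∀ {r s} → r ≗ s → r ≃ s
≗⇒≃ e = coeffwise (crossMultiplied e)

-- The middle denominator has to be cancelled; this is where the absence of zero divisors in `ℤ[C]`
-- enters.
≗-trans : ∀ {r s t} → r ≗ s → s ≗ t → r ≗ t
≗-trans {r} {s} {t} (mk≗ e) (mk≗ f) = mk≗ (*ₚ-cancelʳ _ _ (den s) (den≉0 s) (begin
  num r *ₚ den t *ₚ den s     ≈⟨ swap-right (num r) _ _ ⟩
  num r *ₚ den s *ₚ den t     ≈⟨ ℤC.*-congʳ e ⟩
  num s *ₚ den r *ₚ den t     ≈⟨ swap-right (num s) _ _ ⟩
  num s *ₚ den t *ₚ den r     ≈⟨ ℤC.*-congʳ f ⟩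
  num t *ₚ den s *ₚ den r     ≈⟨ swap-right (num t) _ _ ⟩
  num t *ₚ den r *ₚ den s     ∎))
  where open ≈-Reasoning ℤ[C]-setoid

+-cong : ∀ {r r′ s s′} → r ≗ r′ → s ≗ s′ → r + s ≗ r′ + s′
+-cong {r} {r′} {s} {s′} (mk≗ e) (mk≗ f) = mk≗ (begin
  (num r *ₚ den s +ₚ num s *ₚ den r) *ₚ (den r′ *ₚ den s′)
    ≈⟨ +-cong-left (num r) (den r) (num s) (den s) (den r′) (den s′) ⟩
  num r *ₚ den r′ *ₚ (den s *ₚ den s′) +ₚ num s *ₚ den s′ *ₚ (den r *ₚ den r′)  ≈⟨ ℤC.+-cong (ℤC.*-congʳ e) (ℤC.*-congʳ f) ⟩
  num r′ *ₚ den r *ₚ (den s *ₚ den s′) +ₚ num s′ *ₚ den s *ₚ (den r *ₚ den r′)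
    ≈⟨ +-cong-right (num r′) (den r′) (num s′) (den s′) (den r) (den s) ⟩
  (num r′ *ₚ den s′ +ₚ num s′ *ₚ den r′) *ₚ (den r *ₚ den s)                    ∎)
  where open ≈-Reasoning ℤ[C]-setoid

*-cong : ∀ {r r′ s s′} → r ≗ r′ → s ≗ s′ → r * s ≗ r′ * s′
*-cong {r} {r′} {s} {s′} (mk≗ e) (mk≗ f) = mk≗ (begin
  num r *ₚ num s *ₚ (den r′ *ₚ den s′)       ≈⟨ *-interchange (num r) _ _ _ ⟩
  num r *ₚ den r′ *ₚ (num s *ₚ den s′)       ≈⟨ ℤC.*-cong e f ⟩
  num r′ *ₚ den r *ₚ (num s′ *ₚ den s)       ≈⟨ *-interchange (num r′) _ _ _ ⟩
  num r′ *ₚ num s′ *ₚ (den r *ₚ den s)       ∎)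
  where open ≈-Reasoning ℤ[C]-setoid

negate : ℚ⟨C⟩ → ℚ⟨C⟩
negate r = frac (-ₚ num r) (den r) (den≉0 r)

negate-cong : ∀ {r s} → r ≗ s → negate r ≗ negate s
negate-cong {r} {s} (mk≗ e) = mk≗ (begin
  (-ₚ num r) *ₚ den s      ≈⟨ neg-cong (num r) _ ⟩
  -ₚ (num r *ₚ den s)      ≈⟨ ℤC.-‿cong e ⟩
  -ₚ (num s *ₚ den r)      ≈⟨ neg-cong (num s) _ ⟨
  (-ₚ num s) *ₚ den r      ∎)
  where open ≈-Reasoning ℤ[C]-setoid

+-comm : ∀ r s → r + s ≗ s + r
+-comm r s = mk≗ (frac-+-comm (num r) (den r) (num s) (den s))

*-comm : ∀ r s → r * s ≗ s * r
*-comm r s = mk≗ (frac-*-comm (num r) (den r) (num s) (den s))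

+-identityˡ : ∀ r → 0# + r ≗ r
+-identityˡ r = mk≗ (frac-+-identityˡ 1ₚ (num r) (den r))

*-identityˡ : ∀ r → 1# * r ≗ r
*-identityˡ r = mk≗ (frac-*-identityˡ 1ₚ (num r) (den r))

negate-inverseˡ : ∀ r → negate r + r ≗ 0#
negate-inverseˡ r = mk≗ (frac-neg-inverseˡ (num r) (den r))

*-distribˡ-+ : ∀ r s t → r * (s + t) ≗ r * s + r * t
*-distribˡ-+ r s t = mk≗ (frac-distribˡ (num r) (den r) (num s) (den s) (num t) (den t))

ℚ⟨C⟩-commutativeRing : CommutativeRing 0ℓ 0ℓ
ℚ⟨C⟩-commutativeRing = record
  { Carrier = ℚ⟨C⟩
  ; _≈_     = _≗_
  ; _+_     = _+_
  ; _*_     = _*_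
  ; -_      = negate
  ; 0#      = 0#
  ; 1#      = 1#
  ; isCommutativeRing = record
    { isRing = record
      { +-isAbelianGroup = record
        { isGroup = record
          { isMonoid = record
            { isSemigroup = record
              { isMagma = record
                { isEquivalence = record
                  { refl  = mk≗ ℤC.refl
                  ; sym   = λ (mk≗ e) → mk≗ (ℤC.sym e)
                  ; trans = ≗-trans
                  }
                ; ∙-cong = +-cong
                }
              ; assoc = λ r s t → mk≗ (frac-+-assoc (num r) (den r) (num s) (den s) (num t) (den t))
              }
            ; identity = +-identityˡ , λ r → ≗-trans (+-comm r 0#) (+-identityˡ r)
            }
          ; inverse = negate-inverseˡ , λ r → ≗-trans (+-comm r (negate r)) (negate-inverseˡ r)
          ; ⁻¹-cong = negate-cong
          }
        ; comm = +-comm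
        }
      ; *-cong     = *-cong
      ; *-assoc    = λ r s t → mk≗ (frac-*-assoc (num r) (den r) (num s) (den s) (num t) (den t))
      ; *-identity = *-identityˡ , λ r → ≗-trans (*-comm r 1#) (*-identityˡ r)
      ; distrib    = *-distribˡ-+ , λ t r s → ≗-trans (*-comm (r + s) t)
          (≗-trans (*-distribˡ-+ t r s) (+-cong (*-comm t r) (*-comm t s)))
      }
    ; *-comm = *-comm
    }
  }

fromPoly-cong : ∀ {p q} → p ≋ q → fromPoly p ≗ fromPoly q
fromPoly-cong e = mk≗ (ℤC.*-congʳ e)

fromPoly-+ₚ : ∀ p q → fromPoly (p +ₚ q) ≗ fromPoly p + fromPoly q
fromPoly-+ₚ p q = mk≗ (frac-homo-+ 1ₚ p q)

fromPoly-*ₚ : ∀ p q → fromPoly (p *ₚ q) ≗ fromPoly p * fromPoly q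
fromPoly-*ₚ p q = mk≗ (ℤC.*-congˡ {p *ₚ q} (ℤC.*-identityˡ 1ₚ))

fromPoly-den : ∀ r → fromPoly (den r) * r ≗ fromPoly (num r)
fromPoly-den r = mk≗ (frac-den-* 1ₚ (num r) (den r))

module K = CommutativeRing ℚ⟨C⟩-commutativeRing

num≈0⇒≗0 : ∀ {r} → num r ≈ 0ₚ → r ≗ 0#
num≈0⇒≗0 {r} e = mk≗ (ℤC.*-congʳ {1ₚ} {num r} {0ₚ} (mk≋ e))

≗0⇒num≈0 : ∀ {r} → r ≗ 0# → num r ≈ 0ₚ
≗0⇒num≈0 {r} (mk≗ e) = coeffwise (ℤC.trans (ℤC.sym (ℤC.*-identityʳ (num r))) e)

coefficientRing : CoefficientRing ℚ⟨C⟩-commutativeRing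
coefficientRing = record
  { Z = ℤ[C] ; _+ᶻ_ = _+ₚ_ ; _*ᶻ_ = _*ₚ_ ; -ᶻ_ = -ₚ_ ; 0ᶻ = 0ₚ ; 1ᶻ = 1ₚ
  ; ι            = fromPoly
  ; +ᶻ-identityˡ = λ _ → refl
  ; +ᶻ-identityʳ = +ₚ-identityʳ
  ; ι-+          = fromPoly-+ₚ
  ; ι-*          = fromPoly-*ₚ
  ; ι-neg        = λ a → K.trans (K.sym (fromPoly-+ₚ a (-ₚ a))) (fromPoly-cong (ℤC.-‿inverseʳ a))
  ; ι-0          = K.refl
  ; ι-1          = K.refl
  ; numᶻ         = num
  ; denᶻ         = den
  ; ι-den        = fromPoly-den
  ; den-nonzero  = λ a e → den≉0 a (≗0⇒num≈0 {fromPoly (den a)} e)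
  ; zero-product = λ a b e → Sum.map (num≈0⇒≗0 {a}) (num≈0⇒≗0 {b})
                     (*ₚ-zero-product (num a) (num b) (≗0⇒num≈0 {a * b} e))
  }

open ListSum ℚ⟨C⟩-commutativeRing
open Elimination ℚ⟨C⟩-commutativeRing coefficientRing
  using (Rational; quotient⇒rational; module TransferSystem; shift; δ₁; shift-cong; shift-*ˡ; shift-shift; shift-∑;
         shift-same; shift-different)

rational⇒IsRational : ∀ f → Rational f → IsRational f
rational⇒IsRational f (P , Q , Q≢0 , e) =
  P , Q , (λ Q-zero → Q≢0 λ i j → num≈0⇒≗0 {fromPoly (coeffₓᵧ Q i j)} (Q-zero i j)) , λ i j → ≗⇒≃ (e i j)

-- Words and windows

col : Vertex h → ℕ
col = proj₁

shiftRight : Vertex h → Vertex h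
shiftRight (c , y) = suc c , y

adj-col : ∀ (a b : Vertex h) → Adj a b → col a ≤ suc (col b)
adj-col (a , _) (b , _) e = begin
  a                  ≤⟨ ℕ.m≤n+∣m-n∣ a b ⟩
  b ℕ.+ ∣ a - b ∣    ≤⟨ ℕ.+-monoʳ-≤ b (dist²≡1⇒∣-∣≤1 ∣ a - b ∣ _ e) ⟩
  b ℕ.+ 1            ≡⟨ ℕ.+-comm b 1 ⟩
  suc b              ∎
  where open ℕ.≤-Reasoning

adj-col′ : ∀ (a b : Vertex h) → Adj a b → col b ≤ suc (col a)
adj-col′ a b e = adj-col b a (adj-sym a b e)

-- As in Walk, the most recent vertex comes first.
Word : ℕ → Set
Word h = List (Vertex h)

next : Word h → Word h
next []                  = []
next ((zero  , y) ∷ R) = next R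
next ((suc c , y) ∷ R) = (c , y) ∷ next R

-- `win 6` is a window of 7 columns. The 6 columns that it shares with the following window are
-- `next` of the former and `win 5` of the latter.
win : ℕ → Word h → Word h
win k = filter (λ a → col a ≤? k)

win-in : ∀ {k} {a : Vertex h} {R} → col a ≤ k → win k (a ∷ R) ≡ a ∷ win k R
win-in {k = k} = List.filter-accept (λ a → col a ≤? k)

win-out : ∀ {k} {a : Vertex h} {R} → ¬ col a ≤ k → win k (a ∷ R) ≡ win k R
win-out {k = k} = List.filter-reject (λ a → col a ≤? k)

∈-win⁺ : ∀ {k} {a : Vertex h} {R} → a ∈ R → col a ≤ k → a ∈ win k R
∈-win⁺ {k = k} = ∈-filter⁺ (λ a → col a ≤? k)

∈-win⁻ : ∀ {k} {a : Vertex h} {R} → a ∈ win k R → a ∈ R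
∈-win⁻ {k = k} {R = R} a∈ = proj₁ (∈-filter⁻ (λ a → col a ≤? k) {xs = R} a∈)

win-cols : ∀ k (R : Word h) → All (λ a → col a ≤ k) (win k R)
win-cols k R = All.all-filter (λ a → col a ≤? k) R

∈-next⁺ : ∀ {a : Vertex h} {R} → shiftRight a ∈ R → a ∈ next R
∈-next⁺ {R = (zero  , _) ∷ R} (there a∈)  = ∈-next⁺ a∈
∈-next⁺ {R = (suc c , _) ∷ R} (here refl) = here refl
∈-next⁺ {R = (suc c , _) ∷ R} (there a∈)  = there (∈-next⁺ a∈)

∈-next⁻ : ∀ {a : Vertex h} {R} → a ∈ next R → shiftRight a ∈ R
∈-next⁻ {R = (zero  , _) ∷ R} a∈          = there (∈-next⁻ a∈)
∈-next⁻ {R = (suc c , _) ∷ R} (here refl) = here refl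
∈-next⁻ {R = (suc c , _) ∷ R} (there a∈)  = there (∈-next⁻ a∈)

next-win : ∀ k (R : Word h) → next (win (suc k) R) ≡ win k (next R)
next-win k []                = refl
next-win k ((zero  , y) ∷ R) = next-win k R
next-win k ((suc c , y) ∷ R) with c ≤? k
... | yes c≤k = begin
  next (win (suc k) ((suc c , y) ∷ R))     ≡⟨ cong next (win-in {a = suc c , y} {R} (s≤s c≤k)) ⟩
  (c , y) ∷ next (win (suc k) R)           ≡⟨ cong ((c , y) ∷_) (next-win k R) ⟩
  (c , y) ∷ win k (next R)                 ≡⟨ win-in {a = c , y} {next R} c≤k ⟨
  win k ((c , y) ∷ next R)                 ∎
  where open ≡-Reasoning
... | no  c≰k = begin
  next (win (suc k) ((suc c , y) ∷ R))     ≡⟨ cong next (win-out {a = suc c , y} {R} (c≰k ∘ ℕ.s≤s⁻¹)) ⟩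
  next (win (suc k) R)                     ≡⟨ next-win k R ⟩
  win k (next R)                           ≡⟨ win-out {a = c , y} {next R} c≰k ⟨
  win k ((c , y) ∷ next R)                 ∎
  where open ≡-Reasoning

win-win : ∀ j (R : Word h) → win j (win (suc j) R) ≡ win j R
win-win j []      = refl
win-win j (a ∷ R) with col a ≤? j
... | yes a≤j = begin
  win j (win (suc j) (a ∷ R))     ≡⟨ cong (win j) (win-in {a = a} {R} (ℕ.m≤n⇒m≤1+n a≤j)) ⟩
  win j (a ∷ win (suc j) R)       ≡⟨ win-in {a = a} {win (suc j) R} a≤j ⟩
  a ∷ win j (win (suc j) R)       ≡⟨ cong (a ∷_) (win-win j R) ⟩
  a ∷ win j R                     ≡⟨ win-in {a = a} {R} a≤j ⟨
  win j (a ∷ R)                   ∎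
  where open ≡-Reasoning
... | no  a≰j with col a ≤? suc j
...   | yes a≤1+j = trans (cong (win j) (win-in {a = a} {R} a≤1+j))
                    (trans (win-out {a = a} {win (suc j) R} a≰j) (trans (win-win j R) (sym (win-out {a = a} {R} a≰j))))
...   | no  a≰1+j = trans (cong (win j) (win-out {a = a} {R} a≰1+j)) (trans (win-win j R) (sym (win-out {a = a} {R} a≰j)))

-- The letters of column 0 only occur in the first word, those of column 6 or
-- more (after the shift) only in the second one; the former are put first.
merge : Word h → Word h → Word h
merge []                  R       = map shiftRight R
merge ((zero  , y) ∷ τ) R         = (zero , y) ∷ merge τ R
-- A default value: if `next τ ≡ win 5 R`, every letter outside column 0 has its counterpart in `R`.
-- For the same reason the head of `R` in the clause below equals the head of the window when it
-- lies in a common column.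
merge ((suc c , y) ∷ τ) []        = []
merge ((suc c , y) ∷ τ) (b ∷ R) with col b ≤? 5
... | yes _ = (suc c , y) ∷ merge τ R
... | no  _ = shiftRight b ∷ merge ((suc c , y) ∷ τ) R

next-map-shiftRight : ∀ (R : Word h) → next (map shiftRight R) ≡ R
next-map-shiftRight []      = refl
next-map-shiftRight (a ∷ R) = cong (a ∷_) (next-map-shiftRight R)

next-merge : ∀ (τ R : Word h) → next τ ≡ win 5 R → next (merge τ R) ≡ R
next-merge []                  R       e = next-map-shiftRight R
next-merge ((zero  , y) ∷ τ) R         e = next-merge τ R e
next-merge ((suc c , y) ∷ τ) (b ∷ R) e with col b ≤? 5
... | no  b≰5 = cong (b ∷_) (next-merge ((suc c , y) ∷ τ) R (trans e (win-out {a = b} {R} b≰5)))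
... | yes b≤5 = cong₂ _∷_ (List.∷-injectiveˡ e′) (next-merge τ R (List.∷-injectiveʳ e′))
  where e′ = trans e (win-in {a = b} {R} b≤5)

win-merge : ∀ (τ R : Word h) → All (λ a → col a ≤ 6) τ → next τ ≡ win 5 R → win 6 (merge τ R) ≡ τ
win-merge []                  []      _            e = refl
win-merge []                  (b ∷ R) _            e with col b ≤? 5
... | no b≰5 = trans (win-out {a = shiftRight b} {map shiftRight R} (b≰5 ∘ ℕ.s≤s⁻¹))
    (win-merge [] R [] (trans e (win-out {a = b} {R} b≰5)))
... | yes b≤5 with () ← trans e (win-in {a = b} {R} b≤5)
win-merge ((zero  , y) ∷ τ) R         (_   ∷ τ≤6) e = cong ((zero , y) ∷_) (win-merge τ R τ≤6 e)
win-merge ((suc c , y) ∷ τ) (b ∷ R) (c≤6 ∷ τ≤6) e with col b ≤? 5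
... | no b≰5 = trans (win-out {a = shiftRight b} {merge ((suc c , y) ∷ τ) R} (b≰5 ∘ ℕ.s≤s⁻¹))
    (win-merge ((suc c , y) ∷ τ) R (c≤6 ∷ τ≤6) (trans e (win-out {a = b} {R} b≰5)))
... | yes b≤5 = trans (win-in {a = suc c , y} {merge τ R} c≤6)
                  (cong ((suc c , y) ∷_) (win-merge τ R τ≤6 (List.∷-injectiveʳ (trans e (win-in {a = b} {R} b≤5)))))

-- Validity of words, checked window by window

module _ (y₀ : Fin h) where

  -- A word stands for a part of a walk that may leave through the left side of
  -- column 0 if l, and through the right side of column 6 if r.
  Step : Bool → Bool → Vertex h → Vertex h → Set
  Step l r a b = Adj a b ⊎ (l ≡ true × col a ≡ 0 × col b ≡ 0) ⊎ (r ≡ true × col a ≡ 6 × col b ≡ 6)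

  -- When the left side is open, the true start lies in a removed column, and the earliest remaining
  -- letter is the first entry of the walk into column 0, anywhere in it.
  Start : Bool → Vertex h → Set
  Start l a = col a ≡ 0 × (l ≡ false → a ≡ (0 , y₀))

  data Path (l r : Bool) : Word h → Set where
    []  : Path l r []
    [_] : ∀ {a} → Start l a → Path l r (a ∷ [])
    _∷_ : ∀ {a b p} → Step l r a b → Path l r (b ∷ p) → Path l r (a ∷ b ∷ p)

  tail-path : ∀ {l r a p} → Path l r (a ∷ p) → Path l r p
  tail-path [ _ ]   = []
  tail-path (_ ∷ P) = P

  -- The first letter is the endpoint of the walk unless it lies next to an open side.
  Trap : Bool → Bool → Word h → Set
  Trap l r []      = ⊤
  Trap l r (a ∷ p) = (l ≡ true → 1 ≤ col a) → (r ≡ true → col a ≤ 5) → ∀ u → Adj a u → u ∈ a ∷ p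

  record Valid (l r : Bool) (R : Word h) : Set where
    constructor valid
    field
      path   : Path l r R
      unique : Unique R
      trap   : Trap l r R

  -- Back in time from a letter beyond column 6, the walk must cross column 6, since it starts in
  -- column 0 and changes its column by at most one in each step.
  far-head : ∀ {l a p} → Path l false (a ∷ p) → ¬ col a ≤ 6 →
    ∃₂ λ b q → win 6 (a ∷ p) ≡ b ∷ q × col b ≡ 6
  far-head {a = a} [ s , _ ] a≰6 = contradiction (subst (_≤ 6) (sym s) z≤n) a≰6
  far-head {a = a} (_∷_ {b = b} {p = p} s P) a≰6 with col b ≤? 6 | s
  ... | yes b≤6 | inj₁ e = b , win 6 p , trans (win-out {a = a} {b ∷ p} a≰6) (win-in {a = b} {p} b≤6) ,
    ℕ.≤-antisym b≤6 (ℕ.s≤s⁻¹ (ℕ.≤-trans (ℕ.≰⇒> a≰6) (adj-col a b e)))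
  ... | no  b≰6 | inj₁ e with far-head P b≰6
  ...   | c , q , eq , c≡6 = c , q , trans (win-out {a = a} {b ∷ p} a≰6) eq , c≡6
  far-head (_∷_ s P) a≰6 | _ | inj₂ (inj₁ (_ , a≡0 , _)) = contradiction (subst (_≤ 6) (sym a≡0) z≤n) a≰6

  -- The counterpart of `far-head` on the left: back in time, a run in column 0 either reaches the
  -- start or is entered from column 1.
  near-head : ∀ {l a p} → Path l false (a ∷ p) → col a ≡ 0 →
    next (a ∷ p) ≡ [] ⊎ ∃₂ λ b q → next (a ∷ p) ≡ b ∷ q × col b ≡ 0
  near-head {a = zero , _} [ _ ] refl = inj₁ refl
  near-head {a = zero , _} (_∷_ {b = zero        , _} _                P) refl = near-head P refl
  near-head {a = zero , _} (_∷_ {b = suc zero    , y} {p} _            P) refl = inj₂ ((0 , y) , next p , refl , refl)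
  near-head {a = zero , z} (_∷_ {b = suc (suc c) , y} (inj₁ e)         P) refl
    with s≤s () ← adj-col′ (zero , z) (suc (suc c) , y) e
  near-head {a = zero , z} (_∷_ {b = suc (suc c) , y} (inj₂ (inj₁ (_ , _ , ()))) P) refl

  private
    not-true : {A : Set} → true ≡ false → A
    not-true ()

  win-path : ∀ {l R} → Path l false R → Path l true (win 6 R)
  win-path []        = []
  win-path {R = (zero , y) ∷ []} [ s ]     = [ s ]
  win-path {R = a ∷ b ∷ p} (s ∷ P) with col a ≤? 6 | col b ≤? 6
  ... | no  a≰6 | _       = subst (Path _ true) (sym (win-out {a = a} {b ∷ p} a≰6)) (win-path P)
  ... | yes a≤6 | yes b≤6 = subst (Path _ true) (sym (trans (win-in {a = a} {b ∷ p} a≤6) (cong (a ∷_) (win-in {a = b} {p} b≤6))))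
    (step s ∷ subst (Path _ true) (win-in {a = b} {p} b≤6) (win-path P))
    where
    step : ∀ {l} → Step l false a b → Step l true a b
    step (inj₁ e)        = inj₁ e
    step (inj₂ (inj₁ e)) = inj₂ (inj₁ e)
  ... | yes a≤6 | no  b≰6 with far-head P b≰6
  ...   | c , q , eq , c≡6 = subst (Path _ true) (sym (trans (win-in {a = a} {b ∷ p} a≤6) (cong (a ∷_) eq)))
    (step s ∷ subst (Path _ true) eq (win-path P))
    where
    step : ∀ {l} → Step l false a b → Step l true a c
    step (inj₁ e) = inj₂ (inj₂ (refl ,
      ℕ.≤-antisym a≤6 (ℕ.s≤s⁻¹ (ℕ.≤-trans (ℕ.≰⇒> b≰6) (adj-col′ a b e))) , c≡6))
    step (inj₂ (inj₁ (_ , _ , b≡0))) = contradiction (subst (_≤ 6) (sym b≡0) z≤n) b≰6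

  next-path : ∀ {l R} → Path l false R → Path true false (next R)
  next-path [] = []
  next-path {R = (zero  , _) ∷ []} [ _ ] = []
  next-path {R = (zero  , _) ∷ b ∷ p} (s ∷ P) = next-path P
  next-path {R = (suc c , _) ∷ (suc d , _) ∷ p} (inj₁ e ∷ P) = inj₁ e ∷ next-path P
  next-path {R = a@(suc zero , _) ∷ b@(zero , _) ∷ p} (inj₁ e ∷ P) with near-head P refl
  -- No earlier letter lies outside column 0, so this one becomes the earliest letter of `next R`;
  -- with an open left side it need not be the given start.
  ... | inj₁ eq               = subst (λ q → Path true false (_ ∷ q)) (sym eq) [ refl , not-true ]
  ... | inj₂ (d , q , eq , d≡0) = subst (λ q → Path true false (_ ∷ q)) (sym eq)
    (inj₂ (inj₁ (refl , refl , d≡0)) ∷ subst (Path true false) eq (next-path P))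
  next-path {R = a@(suc (suc c) , _) ∷ b@(zero , _) ∷ p} (inj₁ e ∷ P)
    with s≤s () ← adj-col a b e
  next-path {R = (suc _ , _) ∷ (suc _  , _) ∷ p} (inj₂ (inj₁ (_ , () , _)) ∷ P)
  next-path {R = (suc _ , _) ∷ (zero  , _) ∷ p} (inj₂ (inj₁ (_ , () , _)) ∷ P)

  -- A step outside column 0 is read off from `next R`. If it is a jump along the open left side
  -- there, both letters lie in column 1, and the window, which has jumps in columns 0 and 6 only,
  -- shows that they are adjacent. Steps that touch column 0 are read off from the window;
  -- `far-head` and `near-head` exclude that they lead out of it.
  glue-path : ∀ {l R} → Path l true (win 6 R) → Path true false (next R) → Path l false R
  glue-path {R = []} _ _ = []
  glue-path {R = (zero   , _) ∷ []} [ s ] N            = [ s ]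
  glue-path {R = (suc .0 , _) ∷ []} [ s ] [ refl , _ ] = [ s ]
  glue-path {l} {R = a ∷ R@(b ∷ p)} W N =
    let P = glue-path {R = R} (win-tail a R W) (next-tail a R N) in step a b W N P ∷ P
    where
    next-tail : ∀ a (R : Word h) → Path true false (next (a ∷ R)) → Path true false (next R)
    next-tail (zero  , _) R N = N
    next-tail (suc c , _) R N = tail-path N

    win-tail : ∀ a (R : Word h) → Path l true (win 6 (a ∷ R)) → Path l true (win 6 R)
    win-tail a R W with col a ≤? 6
    ... | yes a≤6 = tail-path (subst (Path l true) (win-in {a = a} {R} a≤6) W)
    ... | no  a≰6 = subst (Path l true) (win-out {a = a} {R} a≰6) W

    first-step : ∀ {r c d q} → Path l r (c ∷ d ∷ q) → Step l r c d
    first-step (s ∷ _) = s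

    window-step : ∀ a b → Path l true (win 6 (a ∷ b ∷ p)) → col a ≤ 6 → col b ≤ 6 → Step l true a b
    window-step a b W a≤6 b≤6 = first-step
      (subst (Path l true) (trans (win-in {a = a} {b ∷ p} a≤6) (cong (a ∷_) (win-in {a = b} {p} b≤6))) W)

    step : ∀ a b → Path l true (win 6 (a ∷ b ∷ p)) → Path true false (next (a ∷ b ∷ p)) →
      Path l false (b ∷ p) → Step l false a b
    step a@(zero , _) b W N P with col b ≤? 6
    ... | yes b≤6 with window-step a b W z≤n b≤6
    ...   | inj₁ e        = inj₁ e
    ...   | inj₂ (inj₁ e) = inj₂ (inj₁ e)
    step a@(zero , _) b W N P | no b≰6 with far-head P b≰6
    ... | c , q , eq , c≡6 with first-step (subst (Path l true) (trans (win-in {a = a} {b ∷ p} z≤n) (cong (a ∷_) eq)) W)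
    ...   | inj₁ e                    = contradiction (subst (_≤ 1) c≡6 (adj-col′ a c e)) λ { (s≤s ()) }
    ...   | inj₂ (inj₁ (_ , _ , c≡0)) = contradiction (trans (sym c≡6) c≡0) λ ()
    step (suc c , y) (suc d , z) W N P with N
    ... | inj₁ e ∷ _ = inj₁ e
    ... | inj₂ (inj₁ (_ , refl , refl)) ∷ _ with window-step (1 , y) (1 , z) W (s≤s z≤n) (s≤s z≤n)
    ...   | inj₁ e = inj₁ e
    ...   | inj₂ (inj₁ (_ , () , _))
    ...   | inj₂ (inj₂ (_ , () , _))
    step a@(suc c , _) b@(zero , _) W N P with suc c ≤? 6
    ... | yes a≤6 with window-step a b W a≤6 z≤n
    ...   | inj₁ e = inj₁ e
    ...   | inj₂ (inj₁ (_ , () , _))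
    ...   | inj₂ (inj₂ (_ , _ , ()))
    step a@(suc c , _) b@(zero , _) W N P | no a≰6 with near-head P refl
    ... | inj₁ eq with subst (λ q → Path true false (_ ∷ q)) eq N
    ...   | [ refl , _ ] = contradiction (s≤s z≤n) a≰6
    step a@(suc c , y) b@(zero , _) W N P | no a≰6 | inj₂ (d , q , eq , d≡0)
      with subst (λ q → Path true false (_ ∷ q)) eq N
    ... | inj₁ e ∷ _ = contradiction (s≤s (ℕ.≤-trans (subst (λ n → c ≤ suc n) d≡0 (adj-col (c , y) d e)) (s≤s z≤n))) a≰6
    ... | inj₂ (inj₁ (_ , refl , _)) ∷ _ = contradiction (s≤s z≤n) a≰6

  next-unique : ∀ {R : Word h} → Unique R → Unique (next R)
  next-unique {[]}              U       = []
  next-unique {(zero  , y) ∷ R} (_ ∷ U) = next-unique U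
  next-unique {(suc c , y) ∷ R} (n ∷ U) =
    All.¬Any⇒All¬ (next R) (All.All¬⇒¬Any n ∘ ∈-next⁻) ∷ next-unique U

  -- A repeated letter is repeated in the window if it lies in column 0, and in `next R` otherwise.
  glue-unique : ∀ {R : Word h} → Unique (win 6 R) → Unique (next R) → Unique R
  glue-unique {[]}              _ _ = []
  glue-unique {(zero  , y) ∷ R} (n ∷ U) V =
    All.¬Any⇒All¬ R (λ a∈ → All.All¬⇒¬Any n (∈-win⁺ a∈ z≤n)) ∷ glue-unique U V
  glue-unique {(suc c , y) ∷ R} U (n ∷ V) =
    All.¬Any⇒All¬ R (λ a∈ → All.All¬⇒¬Any n (∈-next⁺ a∈)) ∷ glue-unique (win-tail U) V
    where
    win-tail : Unique (win 6 ((suc c , y) ∷ R)) → Unique (win 6 R)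
    win-tail U with suc c ≤? 6
    ... | yes a≤6 with subst Unique (win-in {a = suc c , y} {R} a≤6) U
    ...   | _ ∷ U′ = U′
    win-tail U | no  a≰6 = subst Unique (win-out {a = suc c , y} {R} a≰6) U

  win-trap : ∀ {l R} → Path l false R → Trap l false R → Trap l true (win 6 R)
  win-trap {R = []}    P T = tt
  win-trap {l} {R = a ∷ p} P T with col a ≤? 6
  ... | yes a≤6 = subst (Trap l true) (sym (win-in {a = a} {p} a≤6))
    λ lc rc u e → subst (u ∈_) (win-in {a = a} {p} a≤6)
      (∈-win⁺ (T lc (λ ()) u e) (ℕ.≤-trans (adj-col′ a u e) (s≤s (rc refl))))
  ... | no  a≰6 with far-head P a≰6
  ...   | c , q , eq , c≡6 = subst (Trap l true) (sym eq)
    λ lc rc u e → contradiction (subst (_≤ 5) c≡6 (rc refl)) λ { (s≤s (s≤s (s≤s (s≤s (s≤s ()))))) }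

  next-trap : ∀ {l R} → Path l false R → Trap l false R → Trap true false (next R)
  next-trap {R = []} P T = tt
  next-trap {R = (zero  , y) ∷ p} P T with near-head P refl
  ... | inj₁ eq                 = subst (Trap true false) (sym eq) tt
  ... | inj₂ (b , q , eq , b≡0) = subst (Trap true false) (sym eq)
    λ lc rc u e → contradiction (subst (1 ≤_) b≡0 (lc refl)) λ ()
  next-trap {R = (suc c , y) ∷ p} P T lc rc u e =
    ∈-next⁺ {R = (suc c , y) ∷ p} (T (λ _ → s≤s z≤n) (λ ()) (shiftRight u) e)

  -- An endpoint in column at most 5 has all its neighbours in the window. The neighbours of any
  -- other endpoint avoid column 0 and are seen in `next R`.
  glue-trap : ∀ {l R} → Trap l true (win 6 R) → Trap true false (next R) → Trap l false R
  glue-trap {R = []} _ _ = tt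
  glue-trap {l} {R = a ∷ p} W N lc rc u e with col a ≤? 5
  ... | yes a≤5 = ∈-win⁻ {k = 6} (subst (u ∈_) (sym eq) (subst (Trap l true) eq W lc (λ _ → a≤5) u e))
    where eq = win-in {a = a} {p} (ℕ.m≤n⇒m≤1+n a≤5)
  glue-trap {R = (zero , _) ∷ p} W N lc rc u e | no a≰5 = contradiction z≤n a≰5
  glue-trap {R = a@(suc c , y) ∷ p} W N lc rc (zero , z) e | no a≰5 =
    contradiction (ℕ.≤-trans (adj-col a (zero , z) e) (s≤s z≤n)) a≰5
  glue-trap {R = a@(suc c , y) ∷ p} W N lc rc u@(suc d , z) e | no a≰5 =
    ∈-next⁻ {R = a ∷ p} (N (λ _ → ℕ.≤-trans (s≤s z≤n) (ℕ.s≤s⁻¹ (ℕ.≰⇒> a≰5))) (λ ()) (d , z) e)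

  split-valid : ∀ {l R} → Valid l false R → Valid l true (win 6 R) × Valid true false (next R)
  split-valid {R = R} (valid P U T) =
    valid (win-path P) (Unique.filter⁺ (λ a → col a ≤? 6) U) (win-trap P T) ,
    valid (next-path P) (next-unique U) (next-trap P T)

  glue-valid : ∀ {l R} → Valid l true (win 6 R) → Valid true false (next R) → Valid l false R
  glue-valid (valid P U T) (valid P′ U′ T′) = valid (glue-path P P′) (glue-unique U U′) (glue-trap T T′)

  -- `merge` could only go wrong when a letter beyond column 6 competes with one of column 0. By
  -- `far-head`, if the former comes first in `R`, the window begins with a letter of column 6, and
  -- `merge` takes the far letter.
  merge-split : ∀ {l R} → Path l false R → merge (win 6 R) (next R) ≡ R
  merge-split {R = []} P = refl
  merge-split {R = (zero  , y) ∷ R} P = cong ((zero , y) ∷_) (merge-split (tail-path P))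
  merge-split {R = a@(suc c , y) ∷ R} P with suc c ≤? 6
  ... | yes a≤6 = begin
    merge (win 6 (a ∷ R)) ((c , y) ∷ next R)     ≡⟨ cong (λ τ → merge τ ((c , y) ∷ next R)) (win-in {a = a} {R} a≤6) ⟩
    merge (a ∷ win 6 R) ((c , y) ∷ next R)       ≡⟨ near (win 6 R) (next R) (ℕ.s≤s⁻¹ a≤6) ⟩
    a ∷ merge (win 6 R) (next R)                 ≡⟨ cong (a ∷_) (merge-split (tail-path P)) ⟩
    a ∷ R                                        ∎
    where
    open ≡-Reasoning
    near : ∀ τ R → c ≤ 5 → merge (a ∷ τ) ((c , y) ∷ R) ≡ a ∷ merge τ R
    near τ R c≤5 with c ≤? 5
    ... | yes _   = refl
    ... | no  c≰5 = contradiction c≤5 c≰5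
  ... | no  a≰6 with far-head P a≰6
  ...   | (suc d , z) , q , eq , d≡6 = begin
    merge (win 6 (a ∷ R)) ((c , y) ∷ next R)     ≡⟨ cong (λ τ → merge τ ((c , y) ∷ next R)) eq ⟩
    merge ((suc d , z) ∷ q) ((c , y) ∷ next R)   ≡⟨ far (a≰6 ∘ s≤s) ⟩
    a ∷ merge ((suc d , z) ∷ q) (next R)
      ≡⟨ cong (λ τ → a ∷ merge τ (next R)) (trans (sym eq) (win-out {a = a} {R} a≰6)) ⟩
    a ∷ merge (win 6 R) (next R)                 ≡⟨ cong (a ∷_) (merge-split (tail-path P)) ⟩
    a ∷ R                                        ∎
    where
    open ≡-Reasoning
    far : ∀ {R} → ¬ c ≤ 5 → merge ((suc d , z) ∷ q) ((c , y) ∷ R) ≡ a ∷ merge ((suc d , z) ∷ q) R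
    far c≰5 with c ≤? 5
    ... | yes c≤5 = contradiction c≤5 c≰5
    ... | no  _   = refl

-- Words with a given first window

-- Pigeonhole: a word without repetitions is no longer than its alphabet. This bound makes the
-- windows a finite list.
unique-length : ∀ {xs ys : List A} → Unique xs → (∀ {x} → x ∈ xs → x ∈ ys) → length xs ≤ length ys
unique-length {xs = []}              _       xs⊆ys = z≤n
unique-length {xs = x ∷ xs} {ys} (x∉ ∷ U) xs⊆ys with ∈-∃++ (xs⊆ys (here refl))
... | as , bs , refl = begin
  suc (length xs)                  ≤⟨ s≤s (unique-length U xs⊆) ⟩
  suc (length (as ++ bs))          ≡⟨ cong suc (List.length-++ as) ⟩
  suc (length as ℕ.+ length bs)    ≡⟨ ℕ.+-suc (length as) (length bs) ⟨
  length as ℕ.+ length (x ∷ bs)    ≡⟨ List.length-++ as ⟨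
  length (as ++ x ∷ bs)            ∎
  where
  open ℕ.≤-Reasoning
  xs⊆ : ∀ {y} → y ∈ xs → y ∈ as ++ bs
  xs⊆ y∈ with ∈-++⁻ as (xs⊆ys (there y∈))
  ... | inj₁ y∈as         = ∈-++⁺ˡ y∈as
  ... | inj₂ (here refl)  = contradiction y∈ (All.All¬⇒¬Any x∉)
  ... | inj₂ (there y∈bs) = ∈-++⁺ʳ as y∈bs

lists≤ : List A → ℕ → List (List A)
lists≤ xs zero    = [] ∷ []
lists≤ xs (suc n) = [] ∷ cartesianProductWith _∷_ xs (lists≤ xs n)

∈-lists≤ : ∀ {xs : List A} {n as} → All (_∈ xs) as → length as ≤ n → as ∈ lists≤ xs n
∈-lists≤ {n = zero}  []         _       = here refl
∈-lists≤ {n = suc n} []         _       = here refl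
∈-lists≤ {n = suc n} (a∈ ∷ as∈) (s≤s ≤n) = there (∈-cartesianProductWith⁺ _∷_ a∈ (∈-lists≤ as∈ ≤n))

∈-lists≤⁻ : ∀ {xs : List A} n {as} → as ∈ lists≤ xs n → All (_∈ xs) as
∈-lists≤⁻ zero    (here refl) = []
∈-lists≤⁻ (suc n) (here refl) = []
∈-lists≤⁻ {xs = xs} (suc n) (there as∈) with ∈-cartesianProductWith⁻ _∷_ xs (lists≤ xs n) as∈
... | a , as , a∈ , as∈′ , refl = a∈ ∷ ∈-lists≤⁻ n as∈′

lists≤-unique : ∀ {xs : List A} n → Unique xs → Unique (lists≤ xs n)
lists≤-unique zero              U = [] ∷ []
lists≤-unique {xs = xs} (suc n) U = All.¬Any⇒All¬ _ nonempty ∷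
  Unique.cartesianProductWith⁺ _∷_ (λ { refl → refl , refl }) U (lists≤-unique n U)
  where
  nonempty : [] ∉ cartesianProductWith _∷_ xs (lists≤ xs n)
  nonempty []∈ with () ← proj₂ (proj₂ (proj₂ (proj₂ (∈-cartesianProductWith⁻ _∷_ xs (lists≤ xs n) []∈))))

-- The key recovers the summand x from any element of f x.
concatMap-unique : ∀ (f : A → List B) (key : B → A) {xs} → Unique xs →
  (∀ {x} → x ∈ xs → Unique (f x)) → (∀ {x y} → x ∈ xs → y ∈ f x → x ≡ key y) →
  Unique (concatMap f xs)
concatMap-unique f key {[]}     U Uf k = []
concatMap-unique f key {x ∷ xs} (x∉ ∷ U) Uf k = Unique.++⁺ (Uf (here refl))
  (concatMap-unique f key U (Uf ∘ there) (k ∘ there))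
  λ (y∈ , y∈′) → let z , z∈ , y∈fz = find (∈-concatMap⁻ f y∈′) in
    All.All¬⇒¬Any x∉ (subst (_∈ xs) (trans (k (there z∈) y∈fz) (sym (k (here refl) y∈))) z∈)

-- States and the enumeration of words by their windows

module _ {h : ℕ} (y₀ : Fin h) where

  step? : ∀ l r (a b : Vertex h) → Dec (Step y₀ l r a b)
  step? l r a b = adj? a b
    ⊎-dec ((l Bool.≟ true) ×-dec (col a ℕ.≟ 0) ×-dec (col b ℕ.≟ 0))
    ⊎-dec ((r Bool.≟ true) ×-dec (col a ℕ.≟ 6) ×-dec (col b ℕ.≟ 6))

  path? : ∀ l r (R : Word h) → Dec (Path y₀ l r R)
  path? l r []          = yes []
  path? l r (a ∷ [])    = map′ [_] (λ { [ s ] → s })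
    ((col a ℕ.≟ 0) ×-dec ((l Bool.≟ false) →-dec (a ≟ᵥ (0 , y₀))))
  path? l r (a ∷ b ∷ p) = map′ (λ (s , P) → s ∷ P) (λ { (s ∷ P) → s , P })
    (step? l r a b ×-dec path? l r (b ∷ p))

  trap? : ∀ l r (R : Word h) → Dec (Trap y₀ l r R)
  trap? l r []      = yes tt
  trap? l r (a ∷ p) = ((l Bool.≟ true) →-dec (1 ≤? col a)) →-dec ((r Bool.≟ true) →-dec (col a ≤? 5)) →-dec
    map′ (λ all u e → All.lookup all (Equivalence.from (∈-neighbours a u) e))
         (λ t → All.tabulate λ {u} u∈ → t u (Equivalence.to (∈-neighbours a u) u∈))
         (All.all? (λ u → DecMember._∈?_ _≟ᵥ_ u (a ∷ p)) (neighbours a))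

  valid? : ∀ l r (R : Word h) → Dec (Valid y₀ l r R)
  valid? l r R = map′ (λ (P , U , T) → valid P U T) (λ (valid P U T) → P , U , T)
    (path? l r R ×-dec unique? _≟ᵥ_ R ×-dec trap? l r R)

  _≟ʷ_ : (σ τ : Word h) → Dec (σ ≡ τ)
  _≟ʷ_ = List.≡-dec _≟ᵥ_

  letters : List (Vertex h)
  letters = cartesianProduct (upTo 7) (allFin h)

  ∈-letters : ∀ {a} → col a ≤ 6 → a ∈ letters
  ∈-letters {_ , y} a≤6 = ∈-cartesianProduct⁺ (∈-upTo⁺ (s≤s a≤6)) (∈-allFin y)

  ∈-letters⁻ : ∀ {a} → a ∈ letters → col a ≤ 6
  ∈-letters⁻ a∈ = ℕ.s≤s⁻¹ (∈-upTo⁻ (proj₁ (∈-cartesianProduct⁻ (upTo 7) (allFin h) a∈)))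

  -- Whether a window may be left through its left side, and its word.
  State : Set
  State = Bool × Word h

  -- An empty window could be appended to a word that has already ended. Excluding it ties the
  -- number of windows to the last column.
  IsWindow : State → Set
  IsWindow (l , τ) = Valid y₀ l true τ × τ ≢ []

  isWindow? : ∀ s → Dec (IsWindow s)
  isWindow? (l , τ) = valid? l true τ ×-dec ¬? (τ ≟ʷ [])

  states : List State
  states = filter isWindow? (cartesianProduct (true ∷ false ∷ []) (lists≤ letters (length letters)))

  states-unique : Unique states
  states-unique = Unique.filter⁺ isWindow? (Unique.cartesianProduct⁺ (((λ ()) ∷ []) ∷ [] ∷ [])
    (lists≤-unique (length letters) (Unique.cartesianProduct⁺ (Unique.upTo⁺ 7) (Unique.allFin⁺ h))))

  ∈-states⁺ : ∀ {l τ} → IsWindow (l , τ) → All (λ a → col a ≤ 6) τ → (l , τ) ∈ states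
  ∈-states⁺ {l} {τ} w τ≤6 = ∈-filter⁺ isWindow? (∈-cartesianProduct⁺ (l∈ l)
    (∈-lists≤ (All.map ∈-letters τ≤6) (unique-length (Valid.unique (proj₁ w)) (λ a∈ → ∈-letters (All.lookup τ≤6 a∈))))) w
    where
    l∈ : ∀ l → l ∈ true ∷ false ∷ []
    l∈ true  = here refl
    l∈ false = there (here refl)

  ∈-states⁻ : ∀ {l τ} → (l , τ) ∈ states → IsWindow (l , τ) × All (λ a → col a ≤ 6) τ
  ∈-states⁻ s∈ with ∈-filter⁻ isWindow? {xs = cartesianProduct (true ∷ false ∷ []) (lists≤ letters (length letters))} s∈
  ... | s∈′ , w = w , All.map ∈-letters⁻ (∈-lists≤⁻ (length letters)
                        (proj₂ (∈-cartesianProduct⁻ (true ∷ false ∷ []) (lists≤ letters (length letters)) s∈′)))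

  -- Only the first window can be closed on the left, hence `l ∧`.
  follows : Word h → State → Bool
  follows τ (l , τ′) = l ∧ does (next τ ≟ʷ win 5 τ′)

  inFirstColumn? : (τ : Word h) → Dec (All (λ a → col a ≡ 0) τ)
  inFirstColumn? = All.all? (λ a → col a ℕ.≟ 0)

  -- The words that end in column d and have τ as their first window
  rightWords : ℕ → Word h → List (Word h)
  extensions : ℕ → Word h → State → List (Word h)
  rightWords zero    τ = if does (inFirstColumn? τ) then τ ∷ [] else []
  rightWords (suc d) τ = concatMap (extensions d τ) states
  extensions d τ t = if follows τ t then map (merge τ) (rightWords d (proj₂ t)) else []

  LastColumn : ℕ → Word h → Set
  LastColumn d R = All (λ a → col a ≤ d) R × Any (λ a → col a ≡ d) R

  lastColumn-next⁺ : ∀ {d R} → LastColumn (suc d) R → LastColumn d (next R)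
  lastColumn-next⁺ (R≤ , R∋) =
    All.tabulate (λ a∈ → ℕ.s≤s⁻¹ (All.lookup R≤ (∈-next⁻ a∈))) , any R∋
    where
    any : ∀ {d R} → Any (λ a → col a ≡ suc d) R → Any (λ a → col a ≡ d) (next R)
    any R∋ with find R∋
    ... | (suc c , y) , a∈ , refl = lose (∈-next⁺ a∈) refl

  lastColumn-next⁻ : ∀ {d R} → LastColumn d (next R) → LastColumn (suc d) R
  lastColumn-next⁻ {d} {R} (R≤ , R∋) = All.tabulate bound , any
    where
    bound : ∀ {a} → a ∈ R → col a ≤ suc d
    bound {zero  , y} a∈ = z≤n
    bound {suc c , y} a∈ = s≤s (All.lookup R≤ (∈-next⁺ a∈))
    any : Any (λ a → col a ≡ suc d) R
    any with find R∋
    ... | (c , y) , a∈ , refl = lose (∈-next⁻ a∈) refl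

  record Extends (l : Bool) (d : ℕ) (τ R : Word h) : Set where
    constructor extends
    field
      isValid    : Valid y₀ l false R
      window     : win 6 R ≡ τ
      lastColumn : LastColumn d R
  open Extends

  first-column-next : ∀ {R : Word h} → All (λ a → col a ≡ 0) R → next R ≡ []
  first-column-next {[]}             []       = refl
  first-column-next {(zero , y) ∷ R} (_ ∷ R0) = first-column-next R0

  first-column-win : ∀ {R : Word h} → All (λ a → col a ≡ 0) R → win 6 R ≡ R
  first-column-win R0 = List.filter-all (λ a → col a ≤? 6) (All.map (λ { refl → z≤n }) R0)

  valid-[] : ∀ {l r} → Valid y₀ l r []
  valid-[] = valid [] [] tt

  ∈-extensions⁻ : ∀ {d τ t R} → R ∈ extensions d τ t →
    proj₁ t ≡ true × next τ ≡ win 5 (proj₂ t) × Σ[ R′ ∈ Word h ] R′ ∈ rightWords d (proj₂ t) × R ≡ merge τ R′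
  ∈-extensions⁻ {τ = τ} {true , τ′} R∈ with next τ ≟ʷ win 5 τ′
  ... | yes e = refl , e , ∈-map⁻ (merge τ) R∈

  rightWords-sound : ∀ {l τ} d → (l , τ) ∈ states → ∀ {R} → R ∈ rightWords d τ → Extends l d τ R
  -- The last component recovers the following state from `R`; it makes the extensions through
  -- different states disjoint.
  extension-sound : ∀ {l τ} d → (l , τ) ∈ states → ∀ {t} → t ∈ states → ∀ {R} → R ∈ extensions d τ t →
    Extends l (suc d) τ R × Extends true d (proj₂ t) (next R) × t ≡ (true , win 6 (next R))

  rightWords-sound {l} {τ} zero s∈ R∈ with inFirstColumn? τ
  rightWords-sound {l} {[]}     zero s∈ (here refl) | yes τ0 = contradiction refl (proj₂ (proj₁ (∈-states⁻ s∈)))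
  rightWords-sound {l} {a ∷ τ} zero s∈ (here refl) | yes τ0 = extends
    (glue-valid y₀ (subst (Valid y₀ l true) (sym (first-column-win τ0)) (proj₁ (proj₁ (∈-states⁻ s∈))))
                (subst (Valid y₀ true false) (sym (first-column-next τ0)) valid-[]))
    (first-column-win τ0)
    (All.map ℕ.≤-reflexive τ0 , here (All.head τ0))
  rightWords-sound {τ = τ} (suc d) s∈ R∈ with find (∈-concatMap⁻ (extensions d τ) R∈)
  ... | t , t∈ , R∈′ = proj₁ (extension-sound d s∈ t∈ R∈′)

  extension-sound {l} {τ} d s∈ {true , τ′} t∈ R∈ with ∈-extensions⁻ {d} {τ} {true , τ′} R∈
  ... | refl , e , R′ , R′∈ , refl =
    extends (glue-valid y₀ (subst (Valid y₀ l true) (sym win≡) (proj₁ (proj₁ (∈-states⁻ s∈))))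
                        (subst (Valid y₀ true false) (sym next≡) (isValid E)))
            win≡ (lastColumn-next⁻ (subst (LastColumn d) (sym next≡) (lastColumn E))) ,
    subst (Extends true d τ′) (sym next≡) E ,
    cong (true ,_) (trans (sym (window E)) (cong (win 6) (sym next≡)))
    where
    E : Extends true d τ′ R′
    E = rightWords-sound d t∈ R′∈
    -- `follows` compares `τ` with the window of `R′` only, but both have the same columns up to 5.
    compatible : next τ ≡ win 5 R′
    compatible = trans e (trans (cong (win 5) (sym (window E))) (win-win 5 R′))
    win≡ : win 6 (merge τ R′) ≡ τ
    win≡ = win-merge τ R′ (proj₂ (∈-states⁻ s∈)) compatible
    next≡ : next (merge τ R′) ≡ R′
    next≡ = next-merge τ R′ compatible
  extension-sound {l} {τ} d s∈ {false , τ′} t∈ R∈ with ∈-extensions⁻ {d} {τ} {false , τ′} R∈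
  ... | () , _

  window-nonempty : ∀ {l R} → Path y₀ l false R → R ≢ [] → win 6 R ≢ []
  window-nonempty {R = []}    P R≢[] = contradiction refl R≢[]
  window-nonempty {R = a ∷ R} P _ e with col a ≤? 6
  ... | yes a≤6 with () ← trans (sym e) (win-in {a = a} {R} a≤6)
  ... | no  a≰6 with far-head y₀ P a≰6
  ...   | b , q , eq , _ with () ← trans (sym e) eq

  window-state : ∀ {l d R} → Valid y₀ l false R → LastColumn d R → (l , win 6 R) ∈ states
  window-state {R = R} V (_ , R∋) = ∈-states⁺
    (proj₁ (split-valid y₀ V) , window-nonempty (Valid.path V) λ { refl → contradiction R∋ λ () })
    (win-cols 6 R)

  rightWords-complete : ∀ {l} d {R} → Valid y₀ l false R → LastColumn d R → R ∈ rightWords d (win 6 R)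
  rightWords-complete zero {R} V (R≤ , _) with inFirstColumn? (win 6 R)
  ... | yes _  = here (sym (first-column-win (All.map ℕ.n≤0⇒n≡0 R≤)))
  ... | no  ¬0 = contradiction (subst (All _) (sym (first-column-win R0)) R0) ¬0
    where R0 = All.map ℕ.n≤0⇒n≡0 R≤
  rightWords-complete (suc d) {R} V L = ∈-concatMap⁺ (extensions d (win 6 R))
    (lose (window-state V′ L′)
      (subst (_∈ extensions d (win 6 R) (true , win 6 (next R))) (merge-split y₀ (Valid.path V)) merged))
    where
    V′ = proj₂ (split-valid y₀ V)
    L′ = lastColumn-next⁺ L
    merged : merge (win 6 R) (next R) ∈ extensions d (win 6 R) (true , win 6 (next R))
    merged with next (win 6 R) ≟ʷ win 5 (win 6 (next R))
    ... | yes _ = ∈-map⁺ (merge (win 6 R)) (rightWords-complete d V′ L′)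
    ... | no ¬e = contradiction (trans (next-win 5 R) (sym (win-win 5 (next R)))) ¬e

  next-merge-rightWord : ∀ {d τ t} → t ∈ states → next τ ≡ win 5 (proj₂ t) →
    ∀ {R′} → R′ ∈ rightWords d (proj₂ t) → next (merge τ R′) ≡ R′
  next-merge-rightWord {d} {τ} t∈ e {R′} R′∈ = next-merge τ R′
    (trans e (trans (cong (win 5) (sym (window (rightWords-sound d t∈ R′∈)))) (win-win 5 R′)))

  rightWords-unique : ∀ d {l τ} → (l , τ) ∈ states → Unique (rightWords d τ)
  rightWords-unique zero {τ = τ} s∈ with inFirstColumn? τ
  ... | yes _ = [] ∷ []
  ... | no  _ = []
  rightWords-unique (suc d) {τ = τ} s∈ = concatMap-unique (extensions d τ) (λ R → true , win 6 (next R)) states-unique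
    extensions-unique (λ t∈ R∈ → proj₂ (proj₂ (extension-sound d s∈ t∈ R∈)))
    where
    extensions-unique : ∀ {t} → t ∈ states → Unique (extensions d τ t)
    extensions-unique {false , τ′} t∈ = []
    extensions-unique {true  , τ′} t∈ with next τ ≟ʷ win 5 τ′
    ... | no  _ = []
    -- On these words `next` undoes `merge τ`, so uniqueness is inherited from the words that were
    -- merged.
    ... | yes e = Unique.map⁻ {f = next} (subst Unique (sym (trans (sym (List.map-∘ (rightWords d τ′)))
      (List.map-id-local (All.tabulate (next-merge-rightWord {d} {τ} t∈ e))))) (rightWords-unique d t∈))

  walkWords : ℕ → List (Word h)
  walkWords d = concatMap (λ s → if not (proj₁ s) then rightWords d (proj₂ s) else []) states

  ∈-walkWords⁻ : ∀ {d R} → R ∈ walkWords d → Valid y₀ false false R × LastColumn d R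
  ∈-walkWords⁻ {d} R∈ with find (∈-concatMap⁻ (λ s → if not (proj₁ s) then rightWords d (proj₂ s) else []) R∈)
  ... | (false , τ) , s∈ , R∈′ = isValid E , lastColumn E
    where E = rightWords-sound d s∈ R∈′

  ∈-walkWords⁺ : ∀ {d R} → Valid y₀ false false R → LastColumn d R → R ∈ walkWords d
  ∈-walkWords⁺ {d} V L = ∈-concatMap⁺ (λ s → if not (proj₁ s) then rightWords d (proj₂ s) else [])
    (lose (window-state V L) (rightWords-complete d V L))

  walkWords-unique : ∀ d → Unique (walkWords d)
  walkWords-unique d = concatMap-unique _ (λ R → false , win 6 R) states-unique unique key
    where
    unique : ∀ {s} → s ∈ states → Unique (if not (proj₁ s) then rightWords d (proj₂ s) else [])
    unique {true  , τ} s∈ = []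
    unique {false , τ} s∈ = rightWords-unique d s∈
    key : ∀ {s R} → s ∈ states → R ∈ (if not (proj₁ s) then rightWords d (proj₂ s) else []) → s ≡ (false , win 6 R)
    key {false , τ} s∈ R∈ = cong (false ,_) (sym (window (rightWords-sound d s∈ R∈)))

-- Step probabilities are local

filter-map-local : ∀ {P : B → Set} {Q : A → Set} (P? : Decidable P) (Q? : Decidable Q) (f : A → B) xs →
  (∀ {x} → x ∈ xs → P (f x) ⇔ Q x) → filter P? (map f xs) ≡ map f (filter Q? xs)
filter-map-local P? Q? f []       P⇔Q = refl
filter-map-local P? Q? f (x ∷ xs) P⇔Q with ih ← filter-map-local P? Q? f xs (P⇔Q ∘ there) | Q? x
... | yes Qx = trans (List.filter-accept P? (Equivalence.from (P⇔Q (here refl)) Qx)) (cong (f x ∷_) ih)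
... | no ¬Qx = trans (List.filter-reject P? (¬Qx ∘ Equivalence.to (P⇔Q (here refl)))) ih

cartesianProduct-suc : ∀ (ns : List ℕ) (ys : List (Fin h)) →
  cartesianProduct (map suc ns) ys ≡ map shiftRight (cartesianProduct ns ys)
cartesianProduct-suc []       ys = refl
cartesianProduct-suc (n ∷ ns) ys = begin
  map (suc n ,_) ys ++ cartesianProduct (map suc ns) ys
    ≡⟨ cong₂ _++_ (List.map-∘ ys) (cartesianProduct-suc ns ys) ⟩
  map shiftRight (map (n ,_) ys) ++ map shiftRight (cartesianProduct ns ys)
    ≡⟨ List.map-++ shiftRight (map (n ,_) ys) _ ⟨
  map shiftRight (map (n ,_) ys ++ cartesianProduct ns ys) ∎
  where open ≡-Reasoning

-- A vertex of column 0 would gain a neighbour on its left by the translation. The lists agree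
-- including their order, so that the filters applied to them can be compared entry by entry.
neighbours-shiftRight : ∀ (a : Vertex h) → 1 ≤ col a → neighbours (shiftRight a) ≡ map shiftRight (neighbours a)
neighbours-shiftRight {h} a@(suc c , y) _ = begin
  filter adj↑? (map (0 ,_) F ++ cartesianProduct (applyUpTo suc (3 ℕ.+ c)) F)
    ≡⟨ List.filter-++ adj↑? (map (0 ,_) F) _ ⟩
  filter adj↑? (map (0 ,_) F) ++ filter adj↑? (cartesianProduct (applyUpTo suc (3 ℕ.+ c)) F)
    ≡⟨ cong₂ _++_ (List.filter-none adj↑? (All.map⁺ (All.universal not-adjacent F)))
         (cong (λ ns → filter adj↑? (cartesianProduct ns F)) (sym (List.map-upTo suc (3 ℕ.+ c)))) ⟩
  filter adj↑? (cartesianProduct (map suc (upTo (3 ℕ.+ c))) F)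
    ≡⟨ cong (filter adj↑?) (cartesianProduct-suc (upTo (3 ℕ.+ c)) F) ⟩
  filter adj↑? (map shiftRight (cartesianProduct (upTo (3 ℕ.+ c)) F))
    ≡⟨ filter-map-local adj↑? (adj? a) shiftRight (cartesianProduct (upTo (3 ℕ.+ c)) F) (λ _ → mk⇔ id id) ⟩
  map shiftRight (neighbours a) ∎
  where
  open ≡-Reasoning
  F = allFin h
  adj↑? = adj? (shiftRight a)
  not-adjacent : ∀ z → ¬ Adj (shiftRight a) (0 , z)
  not-adjacent z e with s≤s () ← adj-col (shiftRight a) (0 , z) e

-- The step probability only depends on which vertices within distance 2 of
-- the endpoint have been visited.
module Transport (s : Vertex h → Vertex h) (s-injective : ∀ {a b} → s a ≡ s b → a ≡ b)
  (W : Walk h m) (W′ : Walk h n) (s-head : head W ≡ s (head W′))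
  (neighbours-head : neighbours (s (head W′)) ≡ map s (neighbours (head W′)))
  (neighbours-near : ∀ {u} → u ∈ neighbours (head W′) → neighbours (s u) ≡ map s (neighbours u))
  (visited-near : ∀ {u} → u ∈ neighbours (head W′) → s u Vec.∈ W ⇔ u Vec.∈ W′)
  (visited-near² : ∀ {u w} → u ∈ neighbours (head W′) → w ∈ neighbours u → s w Vec.∈ W ⇔ w Vec.∈ W′)
  where

  unvisited-transport : unvisited W ≡ map s (unvisited W′)
  unvisited-transport = trans (cong (filter (λ u → ¬? (u ∈ᵥ? W))) (trans (cong neighbours s-head) neighbours-head))
    (filter-map-local (λ u → ¬? (u ∈ᵥ? W)) (λ u → ¬? (u ∈ᵥ? W′)) s (neighbours (head W′))
      λ u∈ → mk⇔ (_∘ Equivalence.from (visited-near u∈)) (_∘ Equivalence.to (visited-near u∈)))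

  visitedNeighbours-transport : ∀ {u} → u ∈ neighbours (head W′) →
    visitedNeighbours W (s u) ≡ map s (visitedNeighbours W′ u)
  visitedNeighbours-transport {u} u∈ =
    trans (cong (filter (λ w → w ∈ᵥ? W ×-dec ¬? (w ≟ᵥ head W))) (neighbours-near u∈))
    (filter-map-local (λ w → w ∈ᵥ? W ×-dec ¬? (w ≟ᵥ head W)) (λ w → w ∈ᵥ? W′ ×-dec ¬? (w ≟ᵥ head W′)) s (neighbours u)
      λ w∈ → mk⇔
        (λ (v , ≢h) → Equivalence.to (visited-near² u∈ w∈) v , λ e → ≢h (trans (cong s e) (sym s-head)))
        (λ (v , ≢h) → Equivalence.from (visited-near² u∈ w∈) v , λ e → ≢h (s-injective (trans e s-head))))

  energy-transport : ∀ {u} → u ∈ neighbours (head W′) → energy W (s u) ≡ energy W′ u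
  energy-transport {u} u∈ =
    cong C^_ (trans (cong length (visitedNeighbours-transport u∈)) (List.length-map s (visitedNeighbours W′ u)))

  unvisited⊆neighbours : ∀ {u} → u ∈ unvisited W′ → u ∈ neighbours (head W′)
  unvisited⊆neighbours u∈ = proj₁ (∈-filter⁻ (λ u → ¬? (u ∈ᵥ? W′)) {xs = neighbours (head W′)} u∈)

  totalEnergy-transport : totalEnergy W ≡ totalEnergy W′
  totalEnergy-transport = cong sumₚ (begin
    map (energy W) (unvisited W)             ≡⟨ cong (map (energy W)) unvisited-transport ⟩
    map (energy W) (map s (unvisited W′))    ≡⟨ List.map-∘ (unvisited W′) ⟨
    map (energy W ∘ s) (unvisited W′)        ≡⟨ List.map-cong-local (All.tabulate (energy-transport ∘ unvisited⊆neighbours)) ⟩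
    map (energy W′) (unvisited W′)           ∎)
    where open ≡-Reasoning

  stepProb-transport : ∀ a → stepProb W (s a) ≗ stepProb W′ a
  stepProb-transport a with DecMember._∈?_ _≟ᵥ_ (s a) (unvisited W) | DecMember._∈?_ _≟ᵥ_ a (unvisited W′)
  ... | yes _  | yes a∈ = mk≗ (ℤC.reflexive (cong₂ _*ₚ_
     (energy-transport (unvisited⊆neighbours a∈)) (sym totalEnergy-transport)))
  ... | no  _  | no  _  = K.refl
  ... | no  a∉ | yes a∈ = contradiction (subst (s a ∈_) (sym unvisited-transport) (∈-map⁺ s a∈)) a∉
  ... | yes a∈ | no  a∉ with ∈-map⁻ s (subst (s a ∈_) unvisited-transport a∈)
  ...   | b , b∈ , e = contradiction (subst (_∈ unvisited W′) (sym (s-injective e)) b∈) a∉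

fromWord : Vertex h → (p : Word h) → Walk h (length p)
fromWord b p = b ∷ fromList p

∈-fromWord⁺ : ∀ {u b : Vertex h} {p} → u ∈ b ∷ p → u Vec.∈ fromWord b p
∈-fromWord⁺ = Vec.∈-fromList⁺

∈-fromWord⁻ : ∀ {u b : Vertex h} {p} → u Vec.∈ fromWord b p → u ∈ b ∷ p
∈-fromWord⁻ = Vec.∈-fromList⁻

neighbour-col : ∀ (a : Vertex h) {u} → u ∈ neighbours a → col u ≤ suc (col a) × col a ≤ suc (col u)
neighbour-col a {u} u∈ = adj-col′ a u e , adj-col a u e
  where e = Equivalence.to (∈-neighbours a u) u∈

-- The energies look at neighbours of neighbours of `b`. These lie in columns up to 4 + 2 = 6, the
-- last one of the window.
stepProb-win : ∀ (b : Vertex h) p a → col b ≤ 4 → stepProb (fromWord b p) a ≗ stepProb (fromWord b (win 6 p)) a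
stepProb-win b p a b≤4 = Transport.stepProb-transport id id (fromWord b p) (fromWord b (win 6 p)) refl
  (sym (List.map-id _)) (λ _ → sym (List.map-id _))
  (λ u∈ → visited (ℕ.≤-trans (proj₁ (neighbour-col b u∈)) (s≤s (ℕ.m≤n⇒m≤1+n b≤4))))
  (λ {u} u∈ w∈ → visited (ℕ.≤-trans (proj₁ (neighbour-col u w∈)) (s≤s (ℕ.≤-trans (proj₁ (neighbour-col b u∈)) (s≤s b≤4))))) a
  where
  eq : win 6 (b ∷ p) ≡ b ∷ win 6 p
  eq = win-in {a = b} {p} (ℕ.≤-trans b≤4 (s≤s (s≤s (s≤s (s≤s z≤n)))))
  visited : ∀ {u} → col u ≤ 6 → u Vec.∈ fromWord b p ⇔ u Vec.∈ fromWord b (win 6 p)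
  visited {u} u≤6 = mk⇔ (λ u∈ → ∈-fromWord⁺ (subst (u ∈_) eq (∈-win⁺ (∈-fromWord⁻ u∈) u≤6)))
                        (λ u∈ → ∈-fromWord⁺ (∈-win⁻ {k = 6} (subst (u ∈_) (sym eq) (∈-fromWord⁻ u∈))))

-- The bound 2 puts the neighbours of `b` into columns from 1 on, where their own neighbours
-- translate as well.
stepProb-next : ∀ (b : Vertex h) p a → 2 ≤ col b →
  stepProb (fromWord (shiftRight b) p) (shiftRight a) ≗ stepProb (fromWord b (next p)) a
stepProb-next b p a 2≤b = Transport.stepProb-transport shiftRight (λ { refl → refl })
  (fromWord (shiftRight b) p) (fromWord b (next p)) refl
  (neighbours-shiftRight b (ℕ.≤-trans (s≤s z≤n) 2≤b))
  (λ {u} u∈ → neighbours-shiftRight u (ℕ.s≤s⁻¹ (ℕ.≤-trans 2≤b (proj₂ (neighbour-col b u∈)))))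
  (λ _ → visited) (λ _ _ → visited) a
  where
  visited : ∀ {u} → shiftRight u Vec.∈ fromWord (shiftRight b) p ⇔ u Vec.∈ fromWord b (next p)
  visited {u} = mk⇔ (λ u∈ → ∈-fromWord⁺ (∈-next⁺ {R = shiftRight b ∷ p} (∈-fromWord⁻ u∈)))
                    (λ u∈ → ∈-fromWord⁺ (∈-next⁻ {R = shiftRight b ∷ p} (∈-fromWord⁻ u∈)))

-- A step into column c only depends on the columns from c - 3 to c + 3, so that
-- a window of 7 columns determines the probabilities of the steps into its
-- central column. The first window also has to account for columns 0, 1 and 2.
counted : Bool → ℕ → Bool
counted false _ = true
counted true  c = 3 ≤ᵇ c

central : Bool → ℕ → Bool
central l c = counted l c ∧ (c ≤ᵇ 3)

-- With values in a monoid, one decomposition serves both for the probability, a product in `ℚ⟨C⟩`,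
-- and for the length, a sum of ones in `ℕ`.
module Weight (M : CommutativeMonoid 0ℓ 0ℓ) {h : ℕ} (y₀ : Fin h)
  (φ : Word h → Vertex h → CommutativeMonoid.Carrier M)
  (φ-win : ∀ b p a → col b ≤ 4 → CommutativeMonoid._≈_ M (φ (b ∷ p) a) (φ (b ∷ win 6 p) a))
  (φ-next : ∀ b p a → 2 ≤ col b →
    CommutativeMonoid._≈_ M (φ (shiftRight b ∷ p) (shiftRight a)) (φ (b ∷ next p) a))
  where

  open CommutativeMonoid M renaming (refl to ≈-refl; sym to ≈-sym; trans to ≈-trans; reflexive to ≈-reflexive)
    using (Carrier; _∙_; ε; identityˡ; identityʳ; assoc; ∙-cong; ∙-congˡ; ∙-congʳ; setoid; commutativeSemigroup)
  open CommutativeMonoid M using () renaming (_≈_ to _≈ᴹ_)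
  open import Algebra.Properties.CommutativeSemigroup commutativeSemigroup using (interchange)

  factor : Bool → Word h → Vertex h → Carrier
  factor c p a = if c then φ p a else ε

  -- A step is attributed to the column of its target.
  weight : (ℕ → Bool) → Word h → Carrier
  weight g []          = ε
  weight g (a ∷ [])    = ε
  weight g (a ∷ b ∷ p) = factor (g (col a)) (b ∷ p) a ∙ weight g (b ∷ p)

  weight-∷ : ∀ g {a p b q} → p ≡ b ∷ q → weight g (a ∷ p) ≈ᴹ factor (g (col a)) (b ∷ q) a ∙ weight g p
  weight-∷ g refl = ≈-refl

  weight-skip : ∀ g a p → g (col a) ≡ false → weight g (a ∷ p) ≈ᴹ weight g p
  weight-skip g a []      e = ≈-refl
  weight-skip g a (b ∷ p) e = ≈-trans (∙-congʳ (≈-reflexive (cong (λ c → factor c (b ∷ p) a) e))) (identityˡ _)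

  weight-split : ∀ g k R → weight g R ≈ᴹ weight (λ c → g c ∧ (c ≤ᵇ k)) R ∙ weight (λ c → g c ∧ not (c ≤ᵇ k)) R
  weight-split g k []          = ≈-sym (identityˡ ε)
  weight-split g k (a ∷ [])    = ≈-sym (identityˡ ε)
  weight-split g k (a ∷ b ∷ p) =
    ≈-trans (∙-cong (factor-split (g (col a)) (col a ≤ᵇ k)) (weight-split g k (b ∷ p))) (interchange _ _ _ _)
    where
    factor-split : ∀ c d → factor c (b ∷ p) a ≈ᴹ factor (c ∧ d) (b ∷ p) a ∙ factor (c ∧ not d) (b ∷ p) a
    factor-split false d     = ≈-sym (identityˡ ε)
    factor-split true  true  = ≈-sym (identityʳ _)
    factor-split true  false = ≈-sym (identityˡ _)

  -- Only steps into columns up to 3 are counted. Their sources lie in columns up to 4, so source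
  -- and target stay consecutive in the window and `φ-win` applies.
  weight-win : ∀ {l} g → (∀ c → 3 < c → g c ≡ false) → ∀ {R} → Path y₀ l false R → weight g R ≈ᴹ weight g (win 6 R)
  weight-win g g≤3 {[]}             P     = ≈-refl
  weight-win g g≤3 {(zero , y) ∷ []} [ _ ] = ≈-refl
  weight-win g g≤3 {a ∷ b ∷ p} (s ∷ P) with g (col a) in ga | col a ≤? 6
  ... | false | yes a≤6 = begin
    ε ∙ weight g (b ∷ p)               ≈⟨ identityˡ _ ⟩
    weight g (b ∷ p)                   ≈⟨ weight-win g g≤3 P ⟩
    weight g (win 6 (b ∷ p))           ≈⟨ weight-skip g a (win 6 (b ∷ p)) ga ⟨
    weight g (a ∷ win 6 (b ∷ p))       ≡⟨ cong (weight g) (win-in {a = a} {b ∷ p} a≤6) ⟨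
    weight g (win 6 (a ∷ b ∷ p))       ∎
    where open ≈-Reasoning setoid
  ... | false | no  a≰6 = begin
    ε ∙ weight g (b ∷ p)               ≈⟨ identityˡ _ ⟩
    weight g (b ∷ p)                   ≈⟨ weight-win g g≤3 P ⟩
    weight g (win 6 (b ∷ p))           ≡⟨ cong (weight g) (win-out {a = a} {b ∷ p} a≰6) ⟨
    weight g (win 6 (a ∷ b ∷ p))       ∎
    where open ≈-Reasoning setoid
  ... | true  | _ = begin
    φ (b ∷ p) a ∙ weight g (b ∷ p)                                    ≈⟨ ∙-cong (φ-win b p a b≤4) (weight-win g g≤3 P) ⟩
    φ (b ∷ win 6 p) a ∙ weight g (win 6 (b ∷ p))
      ≡⟨ cong (λ c → factor c (b ∷ win 6 p) a ∙ weight g (win 6 (b ∷ p))) ga ⟨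
    factor (g (col a)) (b ∷ win 6 p) a ∙ weight g (win 6 (b ∷ p))
      ≈⟨ weight-∷ g (win-in {a = b} {p} (ℕ.≤-trans b≤4 (ℕ.m≤m+n 4 2))) ⟨
    weight g (a ∷ win 6 (b ∷ p))
      ≡⟨ cong (weight g) (win-in {a = a} {b ∷ p} (ℕ.≤-trans a≤3 (ℕ.m≤m+n 3 3))) ⟨
    weight g (win 6 (a ∷ b ∷ p))                                      ∎
    where
    open ≈-Reasoning setoid
    a≤3 : col a ≤ 3
    a≤3 with col a ≤? 3
    ... | yes a≤3 = a≤3
    ... | no  a≰3 with () ← trans (sym ga) (g≤3 (col a) (ℕ.≰⇒> a≰3))
    previous≤4 : ∀ {l} → Step y₀ l false a b → col b ≤ 4
    previous≤4 (inj₁ e)                    = ℕ.≤-trans (adj-col′ a b e) (s≤s a≤3)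
    previous≤4 (inj₂ (inj₁ (_ , _ , b≡0))) = subst (_≤ 4) (sym b≡0) z≤n
    b≤4 = previous≤4 s

  -- Only steps into columns from 4 on are counted. Their sources lie in columns from 3 on, hence
  -- survive `next` and end up in columns from 2 on, as `φ-next` demands.
  weight-next : ∀ {l} g g′ → g 0 ≡ false → (∀ c → g (suc c) ≡ g′ c) → (∀ c → c ≤ 3 → g c ≡ false) →
    ∀ {R} → Path y₀ l false R → weight g R ≈ᴹ weight g′ (next R)
  weight-next g g′ g0 g-suc g>3 {[]}             P     = ≈-refl
  weight-next g g′ g0 g-suc g>3 {(zero , y) ∷ []} [ _ ] = ≈-refl
  weight-next g g′ g0 g-suc g>3 {(zero , y) ∷ b ∷ p} (s ∷ P) =
    ≈-trans (weight-skip g (0 , y) (b ∷ p) g0) (weight-next g g′ g0 g-suc g>3 P)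
  weight-next g g′ g0 g-suc g>3 {a@(suc c , y) ∷ b ∷ p} (s ∷ P) with g (suc c) in ga
  ... | false = begin
    ε ∙ weight g (b ∷ p)                   ≈⟨ identityˡ _ ⟩
    weight g (b ∷ p)                       ≈⟨ weight-next g g′ g0 g-suc g>3 P ⟩
    weight g′ (next (b ∷ p))               ≈⟨ weight-skip g′ (c , y) (next (b ∷ p)) (trans (sym (g-suc c)) ga) ⟨
    weight g′ ((c , y) ∷ next (b ∷ p))     ∎
    where open ≈-Reasoning setoid
  ... | true  = far-step b s P
    where
    open ≈-Reasoning setoid
    3<a : 3 < suc c
    3<a with suc c ≤? 3
    ... | no  a≰3 = ℕ.≰⇒> a≰3
    ... | yes a≤3 with () ← trans (sym ga) (g>3 (suc c) a≤3)
    far-step : ∀ {l} b → Step y₀ l false a b → Path y₀ l false (b ∷ p) →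
      φ (b ∷ p) a ∙ weight g (b ∷ p) ≈ᴹ weight g′ ((c , y) ∷ next (b ∷ p))
    far-step b (inj₂ (inj₁ (_ , () , _))) P
    far-step (zero , z) (inj₁ e) P with s≤s () ← ℕ.≤-trans 3<a (adj-col a (zero , z) e)
    far-step b@(suc d , z) (inj₁ e) P = begin
      φ (b ∷ p) a ∙ weight g (b ∷ p)
        ≈⟨ ∙-cong (φ-next (d , z) p (c , y) 2≤d) (weight-next g g′ g0 g-suc g>3 P) ⟩
      φ ((d , z) ∷ next p) (c , y) ∙ weight g′ (next (b ∷ p))
        ≡⟨ cong (λ x → factor x ((d , z) ∷ next p) (c , y) ∙ weight g′ (next (b ∷ p))) (trans (sym (g-suc c)) ga) ⟨
      weight g′ ((c , y) ∷ next (b ∷ p))                  ∎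
      where
      2≤d : 2 ≤ d
      2≤d = ℕ.s≤s⁻¹ (ℕ.s≤s⁻¹ (ℕ.≤-trans 3<a (adj-col a b e)))

  -- The cut is after column 3: the columns from 4 on become by translation those from 3 on, which
  -- are exactly the columns counted for an open left side.
  weight-decompose : ∀ {l R} → Path y₀ l false R →
    weight (counted l) R ≈ᴹ weight (central l) (win 6 R) ∙ weight (counted true) (next R)
  weight-decompose {l} {R} P = ≈-trans (weight-split (counted l) 3 R)
    (∙-cong (weight-win (central l) (central-far l) P)
            (weight-next (λ c → counted l c ∧ not (c ≤ᵇ 3)) (counted true) (near l 0 z≤n) (far l) (near l) P))
    where
    central-far : ∀ l c → 3 < c → central l c ≡ false
    central-far false _ (s≤s (s≤s (s≤s (s≤s _)))) = refl
    central-far true  _ (s≤s (s≤s (s≤s (s≤s _)))) = refl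
    near : ∀ l c → c ≤ 3 → counted l c ∧ not (c ≤ᵇ 3) ≡ false
    near false _ z≤n                   = refl
    near false _ (s≤s z≤n)             = refl
    near false _ (s≤s (s≤s z≤n))       = refl
    near false _ (s≤s (s≤s (s≤s z≤n))) = refl
    near true  _ z≤n                   = refl
    near true  _ (s≤s z≤n)             = refl
    near true  _ (s≤s (s≤s z≤n))       = refl
    near true  _ (s≤s (s≤s (s≤s z≤n))) = refl
    far : ∀ l c → counted l (suc c) ∧ not (suc c ≤ᵇ 3) ≡ counted true c
    far false zero                = refl
    far false (suc zero)          = refl
    far false (suc (suc zero))    = refl
    far false (suc (suc (suc c))) = refl
    far true  zero                = refl
    far true  (suc zero)          = refl
    far true  (suc (suc zero))    = refl
    far true  (suc (suc (suc c))) = refl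

-- The linear system for the generating functions of windows

vec-unique⁺ : ∀ {A : Set} {xs : Vec A n} → Vec.Unique xs → Unique (toList xs)
vec-unique⁺ VecAllPairs.[]      = []
vec-unique⁺ (x VecAllPairs.∷ U) = VecAll.toList⁺ x ∷ vec-unique⁺ U

vec-unique⁻ : ∀ {A : Set} {xs : Vec A n} → Unique (toList xs) → Vec.Unique xs
vec-unique⁻ {xs = []}     []      = VecAllPairs.[]
vec-unique⁻ {xs = x ∷ xs} (y ∷ U) = VecAll.toList⁻ y VecAllPairs.∷ vec-unique⁻ U

-- The two vectors have different types, as their lengths are only propositionally equal. A
-- length-polymorphic `f` avoids the cast.
fromList-toList : ∀ {A B : Set} (f : ∀ {n} → Vec A n → B) (xs : Vec A n) → f (Vec.fromList (toList xs)) ≡ f xs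
fromList-toList f []       = refl
fromList-toList f (x ∷ xs) = fromList-toList (λ ys → f (x ∷ ys)) xs

lastColumn-unique : ∀ {y : Fin h} {c d R} → LastColumn y c R → LastColumn y d R → c ≡ d
lastColumn-unique (R≤c , R∋c) (R≤d , R∋d) = ℕ.≤-antisym (below R∋c R≤d) (below R∋d R≤c)
  where
  below : ∀ {c d R} → Any (λ a → col a ≡ c) R → All (λ a → col a ≤ d) R → c ≤ d
  below R∋ R≤ with find R∋
  ... | _ , a∈ , refl = All.lookup R≤ a∈

module _ (y₀ : Fin h) where

  walk-path⁺ : (W : Walk h n) → last W ≡ (0 , y₀) → Linked Adj W → Path y₀ false false (toList W)
  walk-path⁺ (a ∷ [])    refl _       = [ refl , (λ _ → refl) ]
  walk-path⁺ (a ∷ b ∷ W) e    (s ∷ L) = inj₁ s ∷ walk-path⁺ (b ∷ W) e L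

  walk-path⁻ : (W : Walk h n) → Path y₀ false false (toList W) → last W ≡ (0 , y₀) × Linked Adj W
  walk-path⁻ (a ∷ [])    [ _ , e ]    = e refl , [-]
  walk-path⁻ (a ∷ b ∷ W) (inj₁ s ∷ P) with walk-path⁻ (b ∷ W) P
  ... | e , L = e , s ∷ L
  walk-path⁻ (a ∷ b ∷ W) (inj₂ (inj₁ (() , _)) ∷ P)

  gsaw⇔valid : (W : Walk h n) → IsGSAW (0 , y₀) W ⇔ Valid y₀ false false (toList W)
  gsaw⇔valid W@(a ∷ W′) = mk⇔
    (λ G → let open IsGSAW G in valid (walk-path⁺ W starts walk) (vec-unique⁺ avoiding)
      (λ _ _ u e → Vec.∈-toList⁺ (trapped u e)))
    (λ (valid P U T) → record
      { starts   = proj₁ (walk-path⁻ W P)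
      ; walk     = proj₂ (walk-path⁻ W P)
      ; avoiding = vec-unique⁻ U
      ; trapped  = λ u e → Vec.∈-toList⁻ (T (λ ()) (λ ()) u e)
      })

  lowest-column : (W : Walk h n) → last W ≡ (0 , y₀) → foldr₁ _⊓_ (Vec.map proj₁ W) ≡ 0
  lowest-column (a ∷ [])    refl = refl
  lowest-column (a ∷ b ∷ W) e    = trans (cong (col a ⊓_) (lowest-column (b ∷ W) e)) (ℕ.⊓-zeroʳ (col a))

  highest-column : (W : Walk h n) → LastColumn y₀ (foldr₁ _⊔_ (Vec.map proj₁ W)) (toList W)
  highest-column (a ∷ [])    = ℕ.≤-refl ∷ [] , here refl
  highest-column (a ∷ b ∷ W) with foldr₁ _⊔_ (Vec.map proj₁ (b ∷ W)) | highest-column (b ∷ W)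
  ... | m | W≤ , W∋ = ℕ.m≤m⊔n (col a) m ∷ All.map (λ c≤m → ℕ.≤-trans c≤m (ℕ.m≤n⊔m (col a) m)) W≤ , any
    where
    any : Any (λ c → col c ≡ col a ⊔ m) (a ∷ b ∷ toList W)
    any with ℕ.⊔-sel (col a) m
    ... | inj₁ e = here (sym e)
    ... | inj₂ e = there (Any.map (λ c≡m → trans c≡m (sym e)) W∋)

  -- The start lies in column 0, so the smallest coordinate is 0 and the displacement is the largest
  -- one.
  displacement⇔lastColumn : ∀ (W : Walk h n) {d} → last W ≡ (0 , y₀) → displacement W ≡ d ⇔ LastColumn y₀ d (toList W)
  displacement⇔lastColumn W {d} e = mk⇔
    (λ eq → subst (λ k → LastColumn y₀ k (toList W)) (trans (sym highest) eq) (highest-column W))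
    (λ L → trans highest (lastColumn-unique {y = y₀} (highest-column W) L))
    where
    highest : displacement W ≡ foldr₁ _⊔_ (Vec.map proj₁ W)
    highest = cong (foldr₁ _⊔_ (Vec.map proj₁ W) ℕ.∸_) (lowest-column W e)

  hasLength? : ∀ n (R : Word h) → Dec (length R ≡ n)
  hasLength? n R = length R ℕ.≟ n

  -- Both lists have the same elements and no repetitions. `walkWords` fixes only the last column,
  -- so the length is selected separately: n edges make n + 1 letters.
  gsaws↭walkWords : ∀ n d → map toList (gsaws (0 , y₀) n d) ↭ filter (hasLength? (suc n)) (walkWords y₀ d)
  gsaws↭walkWords n d = ∼bag⇒↭ (unique∧set⇒bag
    (Unique.map⁺ (λ {W} {W′} → trans (sym (Vec.cast-is-id refl W)) ∘ Vec.toList-injective refl W W′)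
      (gsaws-unique (0 , y₀) n d))
    (Unique.filter⁺ (hasLength? (suc n)) (walkWords-unique y₀ d))
    (mk⇔ to from))
    where
    to : ∀ {R} → R ∈ map toList (gsaws (0 , y₀) n d) → R ∈ filter (hasLength? (suc n)) (walkWords y₀ d)
    to R∈ with ∈-map⁻ toList R∈
    ... | W , W∈ , refl with Equivalence.to (∈-gsaws (0 , y₀) W d) W∈
    ...   | G , disp = ∈-filter⁺ (hasLength? (suc n))
      (∈-walkWords⁺ y₀ (Equivalence.to (gsaw⇔valid W) G)
        (Equivalence.to (displacement⇔lastColumn W (IsGSAW.starts G)) disp))
      (Vec.length-toList W)
    as-walk : ∀ (R : Word h) → length R ≡ suc n → ∃ λ (W : Walk h n) → toList W ≡ R
    as-walk (a ∷ R) refl = Vec.fromList (a ∷ R) , Vec.toList∘fromList (a ∷ R)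
    from : ∀ {R} → R ∈ filter (hasLength? (suc n)) (walkWords y₀ d) → R ∈ map toList (gsaws (0 , y₀) n d)
    from {R} R∈ with ∈-filter⁻ (hasLength? (suc n)) {xs = walkWords y₀ d} R∈
    ... | R∈′ , len with as-walk R len | ∈-walkWords⁻ y₀ {d} R∈′
    ...   | W , refl | V , L = ∈-map⁺ toList (Equivalence.from (∈-gsaws (0 , y₀) W d)
      (G , Equivalence.from (displacement⇔lastColumn W (IsGSAW.starts G)) L))
      where G = Equivalence.from (gsaw⇔valid W) V

  -- Generating functions of the states

  stepFactor : Word h → Vertex h → ℚ⟨C⟩
  stepFactor []      a = 1#
  stepFactor (b ∷ p) a = stepProb (fromWord b p) a

  module Prob = Weight K.*-commutativeMonoid y₀ stepFactor stepProb-win stepProb-next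
  module Steps = Weight ℕ.+-0-commutativeMonoid y₀ (λ _ _ → 1) (λ _ _ _ _ → refl) (λ _ _ _ _ → refl)

  prob-weight : ∀ {n} (W : Walk h n) → prob W ≗ Prob.weight (counted false) (toList W)
  prob-weight         (a ∷ [])    = K.refl
  prob-weight (a ∷ b ∷ W) = K.trans (K.*-comm (prob (b ∷ W)) (stepProb (b ∷ W) a)) (K.*-cong
    (K.reflexive (sym (fromList-toList (λ {m} V → stepProb {n = m} (b ∷ V) a) W))) (prob-weight (b ∷ W)))

  length-steps : ∀ (R : Word h) → Steps.weight (counted false) R ≡ length R ℕ.∸ 1
  length-steps []          = refl
  length-steps (a ∷ [])    = refl
  length-steps (a ∷ b ∷ R) = cong suc (length-steps (b ∷ R))

  -- The contribution of `R` to the coefficient of x^n: `shift k n δ₁` is 1 if `k` equals `n` and 0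
  -- otherwise. Only the counted steps enter, so that terms of consecutive windows multiply.
  term : Bool → ℕ → Word h → ℚ⟨C⟩
  term l n R = Prob.weight (counted l) R * shift (Steps.weight (counted l) R) n δ₁

  windowWeight : State y₀ → ℚ⟨C⟩
  windowWeight (l , τ) = Prob.weight (central l) τ

  windowSteps : State y₀ → ℕ
  windowSteps (l , τ) = Steps.weight (central l) τ

  term-decompose : ∀ {l R τ} → Path y₀ l false R → win 6 R ≡ τ → ∀ n →
    term l n R ≗ windowWeight (l , τ) * shift (windowSteps (l , τ)) n (λ a → term true a (next R))
  term-decompose {l} {R} {τ} P refl n = begin
    Prob.weight (counted l) R * shift (Steps.weight (counted l) R) n δ₁
      ≈⟨ K.*-cong (Prob.weight-decompose P) (K.reflexive (cong (λ k → shift k n δ₁) (Steps.weight-decompose P))) ⟩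
    w * w′ * shift (k ℕ.+ k′) n δ₁
      ≈⟨ K.*-assoc w w′ (shift (k ℕ.+ k′) n δ₁) ⟩
    w * (w′ * shift (k ℕ.+ k′) n δ₁)
      ≈⟨ K.*-congˡ {w} (K.*-congˡ {w′} (K.reflexive (shift-shift k k′ n δ₁))) ⟩
    w * (w′ * shift k n (λ a → shift k′ a δ₁))
      ≈⟨ K.*-congˡ {w} (shift-*ˡ k n w′ (λ a → shift k′ a δ₁)) ⟨
    w * shift k n (λ a → w′ * shift k′ a δ₁) ∎
    where
    open ≈-Reasoning K.setoid
    w  = Prob.weight (central l) (win 6 R)
    w′ = Prob.weight (counted true) (next R)
    k  = Steps.weight (central l) (win 6 R)
    k′ = Steps.weight (counted true) (next R)

  stateFun : State y₀ → Series
  stateFun (l , τ) n d = ∑ (rightWords y₀ d τ) (term l n)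

  isFinal : State y₀ → Bool
  isFinal (l , τ) = does (inFirstColumn? y₀ τ)

  stateFun-zero : ∀ {s} → s ∈ states y₀ → ∀ n →
    stateFun s n 0 ≗ (if isFinal s then windowWeight s * shift (windowSteps s) n δ₁ else 0#)
  stateFun-zero {l , τ} s∈ n with inFirstColumn? y₀ τ in first
  ... | no  _  = K.refl
  ... | yes τ0 = begin
    term l n τ + 0#                                              ≈⟨ K.+-identityʳ _ ⟩
    term l n τ                                                   ≈⟨ term-decompose path (first-column-win y₀ τ0) n ⟩
    w * shift k n (λ a → term true a (next τ))
      ≡⟨ cong (λ R → w * shift k n (λ a → term true a R)) (first-column-next y₀ τ0) ⟩
    w * shift k n (λ a → 1# * δ₁ a)                              ≈⟨ K.*-congˡ {w} (shift-cong k n (λ a → K.*-identityˡ (δ₁ a))) ⟩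
    w * shift k n δ₁                                             ∎
    where
    open ≈-Reasoning K.setoid
    w = windowWeight (l , τ)
    k = windowSteps (l , τ)
    -- A state only provides a path with open right side. The closed one comes from `τ` being a word
    -- of `rightWords` that ends in column 0.
    path : Path y₀ l false τ
    path = Valid.path (Extends.isValid (rightWords-sound y₀ 0 s∈
      (subst (λ d? → τ ∈ (if does d? then τ ∷ [] else [])) (sym first) (here refl))))

  stateFun-suc : ∀ {s} → s ∈ states y₀ → ∀ n d → stateFun s n (suc d) ≗
    ∑ (states y₀) (λ t → if follows y₀ (proj₂ s) t
                         then windowWeight s * shift (windowSteps s) n (λ a → stateFun t a d) else 0#)
  stateFun-suc {s@(l , τ)} s∈ n d = K.trans (∑-concatMap (extensions y₀ d τ) (states y₀) (term l n))
    (∑-cong (states y₀) λ {t} t∈ → extension-sum t t∈)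
    where
    open ≈-Reasoning K.setoid
    w = windowWeight s
    k = windowSteps s
    extension-sum : ∀ t → t ∈ states y₀ → ∑ (extensions y₀ d τ t) (term l n) ≗
      (if follows y₀ τ t then w * shift k n (λ a → stateFun t a d) else 0#)
    extension-sum (false , τ′) t∈ = K.refl
    extension-sum t@(true , τ′) t∈ with _≟ʷ_ y₀ (next τ) (win 5 τ′) in compatible
    ... | no  _ = K.refl
    ... | yes e = begin
      ∑ (map (merge τ) Rs) (term l n)                        ≈⟨ ∑-map (merge τ) Rs (term l n) ⟩
      ∑ Rs (λ R → term l n (merge τ R))                      ≈⟨ ∑-cong Rs merged ⟩
      ∑ Rs (λ R → w * shift k n (λ a → term true a R))       ≈⟨ ∑-*ˡ Rs w _ ⟨
      w * ∑ Rs (λ R → shift k n (λ a → term true a R))       ≈⟨ K.*-congˡ {w} (shift-∑ k n Rs (λ a R → term true a R)) ⟨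
      w * shift k n (λ a → ∑ Rs (term true a))               ∎
      where
      Rs = rightWords y₀ d τ′
      merged : ∀ {R} → R ∈ Rs → term l n (merge τ R) ≗ w * shift k n (λ a → term true a R)
      merged {R} R∈ = K.trans (term-decompose (Valid.path (Extends.isValid E)) (Extends.window E) n)
        (K.reflexive (cong (λ R → w * shift k n (λ a → term true a R)) (next-merge-rightWord y₀ {d} {τ} t∈ e R∈)))
        where
        E = proj₁ (extension-sound y₀ d s∈ t∈
          (subst (λ d? → merge τ R ∈ (if does d? then map (merge τ) Rs else [])) (sym compatible) (∈-map⁺ (merge τ) R∈)))

  genFun-states : ∀ n d → genFun (0 , y₀) n d ≗ ∑ (states y₀) (λ s → if not (proj₁ s) then stateFun s n d else 0#)
  genFun-states n d = begin
    ∑ (gsaws (0 , y₀) n d) prob                                       ≈⟨ ∑-cong (gsaws (0 , y₀) n d) (λ {W} _ → prob-term W) ⟩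
    ∑ (gsaws (0 , y₀) n d) (λ W → term false n (toList W))            ≈⟨ ∑-map toList (gsaws (0 , y₀) n d) (term false n) ⟨
    ∑ (map toList (gsaws (0 , y₀) n d)) (term false n)                ≈⟨ ∑-↭ (term false n) (gsaws↭walkWords n d) ⟩
    ∑ (filter (hasLength? (suc n)) (walkWords y₀ d)) (term false n)   ≈⟨ ∑-filter (hasLength? (suc n)) (walkWords y₀ d) wrong-length ⟩
    ∑ (walkWords y₀ d) (term false n)                                 ≈⟨ ∑-concatMap _ (states y₀) (term false n) ⟩
    ∑ (states y₀) (λ s → ∑ (if not (proj₁ s) then rightWords y₀ d (proj₂ s) else []) (term false n))
      ≈⟨ ∑-cong (states y₀) (λ {s} _ → initial s) ⟩
    ∑ (states y₀) (λ s → if not (proj₁ s) then stateFun s n d else 0#) ∎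
    where
    open ≈-Reasoning K.setoid
    prob-term : (W : Walk h n) → prob W ≗ term false n (toList W)
    prob-term W = K.trans (prob-weight W) (K.sym (K.trans
      (K.*-congˡ {w} (K.trans (K.reflexive (cong (λ k → shift k n δ₁)
        (trans (length-steps (toList W)) (cong (ℕ._∸ 1) (Vec.length-toList W))))) (shift-same n)))
      (K.*-identityʳ w)))
      where w = Prob.weight (counted false) (toList W)
    wrong-length : ∀ {R} → R ∈ walkWords y₀ d → ¬ length R ≡ suc n → term false n R ≗ 0#
    wrong-length {[]} R∈ _ with () ← proj₂ (proj₂ (∈-walkWords⁻ y₀ {d} R∈))
    wrong-length {a ∷ R} _ length≢ = K.trans
      (K.*-congˡ {w} (shift-different (λ e → length≢ (cong suc (trans (sym (length-steps (a ∷ R))) e))))) (K.zeroʳ w)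
      where w = Prob.weight (counted false) (a ∷ R)
    initial : ∀ s → ∑ (if not (proj₁ s) then rightWords y₀ d (proj₂ s) else []) (term false n) ≗
      (if not (proj₁ s) then stateFun s n d else 0#)
    initial (true  , τ) = K.refl
    initial (false , τ) = K.refl

  genFun-rational : IsRational (genFun (0 , y₀))
  genFun-rational = rational⇒IsRational (genFun (0 , y₀)) (quotient⇒rational {genFun (0 , y₀)}
    (TransferSystem.sum-quotient (states y₀) stateFun windowWeight windowSteps isFinal
      (λ s → follows y₀ (proj₂ s)) stateFun-zero stateFun-suc (not ∘ proj₁) {genFun (0 , y₀)} genFun-states))

theorem5p2 : (h : ℕ) .{{_ : NonZero h}} → IsRational (genFun (topLeft h))
theorem5p2 (suc k) = genFun-rational (fromℕ k)
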